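{- Let $p$ be a prime, $n \in \mathbb{N}$ (positive integers), $G = C_p \oplus C_{pn}$, and let $K$ be a splitting field of $G$. \begin{enumerate} \item If $p \le 3$, then $\mathsf d(G) = \mathsf d(G,K)$. \item If $p \ge 5$ and $n \ge 2$, then $\mathsf d(G) < \mathsf d(G,K)$. \end{enumerate}
   Context: $C_k$ denotes a cyclic group of order $k$; groups are written additively. A sequence over a finite abelian group $G$ is a finite unordered list $S = g_1 \cdot \ldots \cdot g_l$ of elements of $G$ (an element of the free abelian monoid on $G$); $|S| = l$ is its length. $S$ is zero-sum free if $\sum_{i \in I} g_i \ne 0$ for every nonempty $I \subset \{1,\dots,l\}$. $\mathsf d(G)$ is the maximal length of a zero-sum free sequence over $G$ (so $\mathsf d(G)+1$ is the Davenport constant). For a commutative ring $R$ (with $1 \neq 0$), $R[G]$ is the group algebra, free $R$-module with basis $\{X^g : g \in G\}$ and $X^gX^h = X^{g+h}$; $\mathsf d(G,R) \in \mathbb N \cup\{\infty\}$ is the supremum of all $l \in \mathbb N$ for which there exists a sequence $g_1 \cdot\ldots\cdot g_l$ over $G$ with $(X^{g_1}-a_1)\cdots(X^{g_l}-a_l) \ne 0$ in $R[G]$ for all $a_1,\dots,a_l \in R\setminus\{0\}$. A field $K$ is a splitting field of $G$ if the group of $\exp(G)$-th roots of unity in $K$ has exactly $\exp(G)$ elements. -}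

module Defs where

open import Level using (Level; _⊔_)
open import Data.Nat as ℕ using (ℕ; zero; suc; NonZero; _<_)
open import Data.Nat.DivMod using (_mod_)
open import Data.Nat.Properties using (m*n≢0)
open import Data.Nat.Primality using (Prime; prime⇒nonZero)
open import Data.Fin as Fin using (Fin; toℕ)
open import Data.Fin.Properties using () renaming (_≟_ to _≟ᶠ_)
open import Data.Product using (Σ; _×_; _,_; proj₁; proj₂; ∃; ∃-syntax)
open import Data.Product.Properties using (≡-dec)
open import Data.List using (List; []; _∷_; length; foldr; map; zipWith; allFin; cartesianProduct)
open import Data.List.Relation.Unary.All using (All)
open import Data.List.Relation.Unary.Any using (Any)
open import Data.List.Relation.Unary.AllPairs using (AllPairs)
open import Data.List.Relation.Binary.Sublist.Propositional using (_⊆_)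
open import Relation.Nullary using (¬_; Dec; yes; no)
open import Relation.Binary.PropositionalEquality using (_≡_; _≢_)
open import Algebra.Bundles using (CommutativeRing)

module Grp (m₁ m₂ : ℕ) .{{_ : NonZero m₁}} .{{_ : NonZero m₂}} where

  G : Set
  G = Fin m₁ × Fin m₂

  infixl 6 _⊕_
  _⊕_ : G → G → G
  (a , b) ⊕ (c , d) = ((toℕ a ℕ.+ toℕ c) mod m₁) , ((toℕ b ℕ.+ toℕ d) mod m₂)

  0G : G
  0G = (0 mod m₁) , (0 mod m₂)

  _≟G_ : (x y : G) → Dec (x ≡ y)
  _≟G_ = ≡-dec _≟ᶠ_ _≟ᶠ_

  allG : List G
  allG = cartesianProduct (allFin m₁) (allFin m₂)

  -- sequences over G are lists (order irrelevant for all notions below)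
  σ : List G → G
  σ = foldr _⊕_ 0G

  ZeroSumFree : List G → Set
  ZeroSumFree S = ∀ (T : List G) → T ⊆ S → T ≢ [] → σ T ≢ 0G

  IsSmallDavenport : ℕ → Set
  IsSmallDavenport l =
    (∃[ S ] (ZeroSumFree S × length S ≡ l)) ×
    (∀ S → ZeroSumFree S → length S ℕ.≤ l)

  module GroupAlgebra {c ℓ : Level} (R : CommutativeRing c ℓ) where
    open CommutativeRing R

    RG : Set c
    RG = G → Carrier

    ΣR : List Carrier → Carrier
    ΣR = foldr _+_ 0#

    X^ : G → RG
    X^ g x with g ≟G x
    ... | yes _ = 1#
    ... | no  _ = 0#

    factor : G → Carrier → RG
    factor g a x = (X^ g x) - (a * X^ 0G x)

    one : RG
    one = X^ 0G

    _⋆_ : RG → RG → RG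
    (f ⋆ h) x = ΣR (map (λ y → ΣR (map (λ z → term y z) allG)) allG)
      where
      term : G → G → Carrier
      term y z with (y ⊕ z) ≟G x
      ... | yes _ = f y * h z
      ... | no  _ = 0#

    ∏ : List RG → RG
    ∏ = foldr _⋆_ one

    IsZero : RG → Set ℓ
    IsZero f = ∀ x → f x ≈ 0#

    Good : List G → Set (c ⊔ ℓ)
    Good S = ∀ (as : List Carrier) → length as ≡ length S →
             All (λ a → ¬ (a ≈ 0#)) as →
             ¬ IsZero (∏ (zipWith factor S as))

    Is-dGR : ℕ → Set (c ⊔ ℓ)
    Is-dGR l = (∃[ S ] (Good S × length S ≡ l)) × (∀ S → Good S → length S ℕ.≤ l)

    -- l < d(G,R)  (including the case d(G,R) = ∞)
    _<dGR : ℕ → Set (c ⊔ ℓ)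
    l <dGR = ∃[ S ] (Good S × l < length S)

module _ {c ℓ : Level} (K : CommutativeRing c ℓ) where
  open CommutativeRing K

  record IsField : Set (c ⊔ ℓ) where
    field
      1≉0     : ¬ (1# ≈ 0#)
      inverse : ∀ x → ¬ (x ≈ 0#) → ∃[ y ] (x * y ≈ 1#)

  pow : Carrier → ℕ → Carrier
  pow x zero    = 1#
  pow x (suc k) = x * pow x k

  HasExactlyRootsOfUnity : ℕ → Set (c ⊔ ℓ)
  HasExactlyRootsOfUnity e =
    ∃[ rs ] ( length rs ≡ e
            × AllPairs (λ r s → ¬ (r ≈ s)) rs
            × All (λ r → pow r e ≈ 1#) rs
            × (∀ x → pow x e ≈ 1# → Any (λ r → x ≈ r) rs))

module Cp⊕Cpn (p n : ℕ) (pp : Prime p) .{{_ : NonZero n}} where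
  private
    instance
      nzp : NonZero p
      nzp = prime⇒nonZero pp
      nzpn : NonZero (p ℕ.* n)
      nzpn = m*n≢0 p n

  IsSmallDavenport : ℕ → Set
  IsSmallDavenport = Grp.IsSmallDavenport p (p ℕ.* n)

  Is-dGR : ∀ {c ℓ} (R : CommutativeRing c ℓ) → ℕ → Set (c ⊔ ℓ)
  Is-dGR R = Grp.GroupAlgebra.Is-dGR p (p ℕ.* n) R

  LessThan-dGR : ∀ {c ℓ} (R : CommutativeRing c ℓ) → ℕ → Set (c ⊔ ℓ)
  LessThan-dGR R = Grp.GroupAlgebra._<dGR p (p ℕ.* n) R

{-# OPTIONS --safe #-}
module Submission where

-- Evaluated at the character X^(x , y) ↦ θ^x η^y, where θ^p = 1 and η^(pn) = 1, the product
-- (X^g₁ - a₁) ⋯ (X^gₗ - aₗ) vanishes iff the character takes the value aᵢ at some gᵢ, and an element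
-- of K[G] at which all characters vanish is zero. So the question is whether the characters can be
-- covered by sets { χ : χ(gᵢ) = aᵢ }. The characters with a given value of η^p form an affine plane
-- over F_p; there are n of them, and each such set meets a plane in nothing, in the whole plane or in
-- a line whose direction depends only on the image of gᵢ in C_p ⊕ C_p.
--
-- A zero-sum free sequence is always good, because the coefficient of X^0 is ± a₁ ⋯ aₗ, and the
-- sequence of p - 1 copies of (1 , 0) and pn - 1 copies of (0 , 1) gives d(G) ≥ p + pn - 2.
--
-- If p ≤ 3, any pn + p - 1 elements contain n disjoint groups each able to cover a plane: p parallel
-- lines; or p - 1 parallel lines and one line through each of the p points left; or, for p = 3,
-- four lines of all directions through a point. Hence d(G, K) ≤ p + pn - 2.
--
-- If p ≥ 5, then d(G) ≤ p + pn - 2 by Olson's theorem for C_p^2 and C_p^3, but the sequence with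
-- (n - 1) p - 1 copies of (0 , 1), p - 1 copies of (1 , 1) and of (-1 , 1), and two copies of (2 , 1) is
-- good. Here each set { χ : χ(gᵢ) = aᵢ } meets one plane only, and in at least two planes some line of
-- slope 0 is not among the chosen ones. In such a plane every uncovered line of a given slope needs p lines of other slopes;
-- adding up these bounds leaves no slack, so that on an uncovered line of slope 0 each point is covered
-- exactly once. Summing coordinates over these points determines the line, yet there are at least two.

open import Defs
open import Level using (Level; _⊔_)
open import Data.Product using (∃; ∃₂; _×_; _,_; proj₁; proj₂; uncurry; ∃-syntax)
open import Data.Sum using (inj₁; inj₂; _⊎_)
open import Data.Empty using (⊥)
open import Function using (_∘_; case_of_; id)
open import Relation.Nullary using (¬_; yes; no; ¬?; contradiction; Dec)
open import Data.List.Relation.Unary.All as All using (All; []; _∷_)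
open import Data.List.Relation.Unary.Any as Any using (Any; here; there; any?)
open import Data.List.Relation.Unary.AllPairs as AllPairs using (AllPairs; []; _∷_)
open import Data.List.Relation.Unary.Unique.Propositional using (Unique)
open import Data.List.Membership.Propositional using (_∈_; find)
open import Algebra.Bundles using (CommutativeRing)
import Data.Nat.Properties as ℕₚ
import Data.List.Properties as Listₚ
import Data.List.Relation.Unary.All.Properties as Allₚ
import Data.List.Relation.Unary.Any.Properties as Anyₚ
import Data.List.Membership.Propositional.Properties as ∈ₚ
import Data.List.Relation.Unary.Unique.Propositional.Properties as Uniqueₚ
import Data.Fin.Properties as Finₚ
import Data.Vec.Properties as Vecₚ
import Data.List.Relation.Unary.AllPairs.Properties as AllPairsₚ
import Data.List.Relation.Binary.Permutation.Propositional.Properties as ↭ₚ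
import Data.Nat.Divisibility as ℕ∣
import Data.Integer.Properties as ℤₚ
import Data.List.Relation.Binary.Sublist.Propositional.Properties as ⊆ₚ

-- The extremal sequence for p ≥ 5 is dictated by a count. Let a, b, c, d be the numbers of lines of
-- slopes 0, 1, -1, 2 in a plane with an uncovered line of slope 0. There are too few lines of slope
-- 1 or -1 to use up those directions, so b + c + d, a + c + d and a + b + d are all at least p, in
-- sum 2 (a + b + c + d) + d ≥ 3p. Every other plane takes at least p lines, which leaves at most 3p
-- - 1 lines for two such planes together; as slope 2 occurs only twice in all, equality holds
-- throughout. Since p is odd, d = 1 and a = b = c = (p - 1) / 2. The line of slope s and value c
-- meets k = v where s j = c - v. For s = 1, -1, 2 the factors 2 / s are the integers 2, -2, 1, and
-- their total over the lines of nonzero slope is 2a - 2a + 1 = 1. Hence the sum of 2j over an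
-- uncovered line k = v is a constant minus v, while it is also the same for every v. Equality in K
-- is not assumed decidable. Statements about scalars therefore stay doubly negated until they have
-- become statements about lines or about listed roots of unity, which are decidable.

-- Fibers of maps on lists, pigeonhole principles and transversals.

module Lists where
  open import Data.Nat as ℕ using (ℕ; zero; suc; _+_; _*_; _≤_; _<_; z≤n)
  open import Data.Fin using (zero; suc)
  open import Data.List using (List; []; _∷_; _++_; length; filter; map; lookup; take; drop)
  open import Data.List.Relation.Binary.Sublist.Propositional.Properties using (filter⁺; filter-⊆; length-mono-≤)
  open import Data.Nat.ListAction using (sum)
  open import Data.List.Relation.Binary.Permutation.Propositional using (_↭_; refl; prep; trans; ↭-sym; ↭-trans; ↭-reflexive)
  open import Data.List.Relation.Binary.Permutation.Propositional.Properties using (shift; ↭-length; filter-↭)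
  open import Relation.Unary using (Pred; Decidable)
  open import Relation.Binary.Definitions using (DecidableEquality)
  open import Relation.Binary.PropositionalEquality using (_≡_; _≢_; cong; subst; sym) renaming (trans to ≡-trans; refl to ≡-refl)

  private variable
    a b ℓ : Level
    A : Set a
    B : Set b

  filter-split : ∀ {P : Pred A ℓ} (P? : Decidable P) xs → xs ↭ filter P? xs ++ filter (¬? ∘ P?) xs
  filter-split P? []       = refl
  filter-split P? (x ∷ xs) with P? x
  ... | yes _ = prep x (filter-split P? xs)
  ... | no  _ = trans (prep x (filter-split P? xs)) (↭-sym (shift x (filter P? xs) _))

  length-filter-split : ∀ {P : Pred A ℓ} (P? : Decidable P) xs →
                        length xs ≡ length (filter P? xs) + length (filter (¬? ∘ P?) xs)
  length-filter-split P? xs = ≡-trans (↭-length (filter-split P? xs)) (Listₚ.length-++ (filter P? xs))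

  module Fibers {A : Set a} {B : Set b} (_≟_ : DecidableEquality B) (f : A → B) where

    -- Applied to the p-th power map on the roots of unity, this picks one representative of each
    -- plane.
    transversal : ∀ xs → ∃ λ ys → AllPairs (λ x y → f x ≢ f y) ys × All (λ x → Any (λ y → f x ≡ f y) ys) xs
    transversal []       = [] , [] , []
    transversal (x ∷ xs) with ys , distinct , covered ← transversal xs | Any.any? (λ y → f x ≟ f y) ys
    ... | yes x∈ = ys , distinct , x∈ ∷ covered
    ... | no  x∉ = x ∷ ys , Allₚ.¬Any⇒All¬ ys x∉ ∷ distinct , here ≡-refl ∷ All.map there covered

    fiber : B → List A → List A
    fiber b = filter (λ x → f x ≟ b)

    -- Each value has its own quota `w b`, so that a direction known to be rare can be given a
    -- smaller one.
    pigeonhole : ∀ (w : B → ℕ) bs xs → All (λ x → f x ∈ bs) xs → sum (map w bs) < length xs →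
                 ∃ λ b → w b < length (fiber b xs)
    pigeonhole w []       (x ∷ xs) (() ∷ _) _
    pigeonhole w (b ∷ bs) xs over Σ< = case w b ℕ.<? length (fiber b xs) of λ where
        (yes w<fiber) → b , w<fiber
        (no  w≮fiber) → let b′ , w<fiber = pigeonhole w bs rest over-rest (ℕₚ.+-cancelˡ-< (w b) _ _ (rest-large (ℕₚ.≮⇒≥ w≮fiber)))
                        in b′ , ℕₚ.<-≤-trans w<fiber (fiber-mono b′)
      where
      open ℕₚ.≤-Reasoning
      over-b? : Decidable (λ x → f x ≡ b)
      over-b? x = f x ≟ b
      rest = filter (¬? ∘ over-b?) xs
      over-rest : All (λ x → f x ∈ bs) rest
      over-rest = All.zipWith (λ (x∉ , x∈) → Any.tail x∉ x∈) (Allₚ.all-filter (¬? ∘ over-b?) xs , Allₚ.filter⁺ (¬? ∘ over-b?) over)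
      rest-large : length (fiber b xs) ≤ w b → w b + sum (map w bs) < w b + length rest
      rest-large fiber≤w = begin-strict
        w b + sum (map w bs)                 <⟨ Σ< ⟩
        length xs                            ≡⟨ length-filter-split over-b? xs ⟩
        length (fiber b xs) + length rest    ≤⟨ ℕₚ.+-monoˡ-≤ (length rest) fiber≤w ⟩
        w b + length rest                    ∎
      fiber-mono : ∀ b′ → length (fiber b′ rest) ≤ length (fiber b′ xs)
      fiber-mono b′ = length-mono-≤ (filter⁺ (λ x → f x ≟ b′) (λ x → f x ≟ b′) (λ { ≡-refl p → p }) (filter-⊆ (¬? ∘ over-b?) xs))

    -- Contrapositive of `pigeonhole` with all quotas equal to `m`; it yields the lower bound for
    -- the number of planes.
    length≤fibers : ∀ {m} → (∀ b zs → Unique zs → All (λ z → f z ≡ b) zs → length zs ≤ m) →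
                    ∀ ys xs → Unique xs → All (λ x → Any (λ y → f x ≡ f y) ys) xs → length xs ≤ length ys * m
    length≤fibers {m} fiber≤m ys xs unique covered = ℕₚ.≮⇒≥ λ len< →
      let b , m<fiber = pigeonhole (λ _ → m) (map f ys) xs (All.map Anyₚ.map⁺ covered) (subst (_< length xs) (sym (sum-const ys)) len<)
      in ℕₚ.<⇒≱ m<fiber (fiber≤m b (fiber b xs) (Uniqueₚ.filter⁺ _ unique) (Allₚ.all-filter _ xs))
      where
      sum-const : ∀ ys → sum (map (λ _ → m) (map f ys)) ≡ length ys * m
      sum-const []       = ≡-refl
      sum-const (y ∷ ys) = cong (m +_) (sum-const ys)

    extract : ∀ b m xs → m ≤ length (fiber b xs) →
              ∃₂ λ ys zs → xs ↭ ys ++ zs × length ys ≡ m × All (λ x → f x ≡ b) ys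
    extract b m xs m≤ = take m (fiber b xs) , drop m (fiber b xs) ++ filter (¬? ∘ over-b?) xs ,
      ↭-trans (filter-split over-b? xs) (↭-reflexive (≡-trans
        (cong (_++ filter (¬? ∘ over-b?) xs) (sym (Listₚ.take++drop≡id m (fiber b xs))))
        (Listₚ.++-assoc (take m (fiber b xs)) (drop m (fiber b xs)) (filter (¬? ∘ over-b?) xs)))) ,
      ≡-trans (Listₚ.length-take m (fiber b xs)) (ℕₚ.m≤n⇒m⊓n≡m m≤) ,
      Allₚ.take⁺ m (Allₚ.all-filter over-b? xs)
      where
      over-b? : Decidable (λ x → f x ≡ b)
      over-b? x = f x ≟ b

    fiber-++ : ∀ {b b′ xs ys zs} → xs ↭ ys ++ zs → All (λ y → f y ≡ b) ys → b ≢ b′ →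
               length (fiber b′ xs) ≡ length (fiber b′ zs)
    fiber-++ {b} {b′} {xs} {ys} {zs} xs↭ ys-over-b b≢b′ = ≡-trans (↭-length (filter-↭ (λ x → f x ≟ b′) xs↭)) (cong length (≡-trans
      (Listₚ.filter-++ (λ x → f x ≟ b′) ys zs) (cong (_++ fiber b′ zs) (Listₚ.filter-none (λ x → f x ≟ b′)
        (All.map (λ fy≡b fy≡b′ → b≢b′ (≡-trans (sym fy≡b) fy≡b′)) ys-over-b)))))

    sum-fibers : ∀ bs xs → Unique bs → sum (map (λ b → length (fiber b xs)) bs) ≤ length xs
    sum-fibers []       xs bs!          = z≤n
    sum-fibers (b ∷ bs) xs (b∉bs ∷ bs!) = begin
      length (fiber b xs) + sum (map (λ b′ → length (fiber b′ xs)) bs)    ≡⟨ cong (λ ls → length (fiber b xs) + sum ls) (Listₚ.map-cong-local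
                                                                               (All.map (fiber-++ (filter-split (λ x → f x ≟ b) xs) (Allₚ.all-filter (λ x → f x ≟ b) xs)) b∉bs)) ⟩
      length (fiber b xs) + sum (map (λ b′ → length (fiber b′ rest)) bs)  ≤⟨ ℕₚ.+-monoʳ-≤ (length (fiber b xs)) (sum-fibers bs rest bs!) ⟩
      length (fiber b xs) + length rest                                   ≡⟨ length-filter-split (λ x → f x ≟ b) xs ⟨
      length xs                                                           ∎
      where
      open ℕₚ.≤-Reasoning
      rest = filter (¬? ∘ λ x → f x ≟ b) xs

    -- For the case p = 3 in which no direction is frequent: each of the two transversals contains
    -- every direction and so covers a plane as a star.
    two-transversals : ∀ bs xs → Unique bs → (∀ {b} → b ∈ bs → 2 ≤ length (fiber b xs)) →
      ∃ λ ys → ∃₂ λ zs rest → xs ↭ ys ++ zs ++ rest ×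
        (∀ {b} → b ∈ bs → Any (λ x → f x ≡ b) ys) × (∀ {b} → b ∈ bs → Any (λ x → f x ≡ b) zs)
    two-transversals []       xs bs!          2≤fiber = [] , [] , xs , refl , (λ ()) , (λ ())
    two-transversals (b ∷ bs) xs (b∉bs ∷ bs!) 2≤fiber
      with y ∷ z ∷ [] , xs′ , xs↭ , ≡-refl , fy≡b ∷ fz≡b ∷ [] ← extract b 2 xs (2≤fiber (here ≡-refl))
      with ys , zs , rest , xs′↭ , ys-all , zs-all ← two-transversals bs xs′ bs! (λ {b′} b′∈ →
             subst (2 ≤_) (fiber-++ xs↭ (fy≡b ∷ fz≡b ∷ []) (All.lookup b∉bs b′∈)) (2≤fiber (there b′∈))) =
      y ∷ ys , z ∷ zs , rest ,
      ↭-trans xs↭ (prep y (↭-trans (prep z xs′↭) (↭-sym (shift z ys (zs ++ rest))))) ,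
      (λ { (here ≡-refl) → here fy≡b ; (there b∈) → there (ys-all b∈) }) ,
      (λ { (here ≡-refl) → here fz≡b ; (there b∈) → there (zs-all b∈) })

  lookup-injective : ∀ {R : A → A → Set ℓ} {xs} → (∀ {x y} → R x y → R y x) → AllPairs (λ x y → ¬ R x y) xs →
                     ∀ i j → R (lookup xs i) (lookup xs j) → i ≡ j
  lookup-injective R-sym (x∉xs ∷ xs!) zero    zero    r = ≡-refl
  lookup-injective R-sym (x∉xs ∷ xs!) zero    (suc j) r = contradiction r (All.lookup x∉xs (∈ₚ.∈-lookup j))
  lookup-injective R-sym (x∉xs ∷ xs!) (suc i) zero    r = contradiction (R-sym r) (All.lookup x∉xs (∈ₚ.∈-lookup i))
  lookup-injective R-sym (x∉xs ∷ xs!) (suc i) (suc j) r = cong suc (lookup-injective R-sym xs! i j r)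

-- Powers in a field and the number of roots of a polynomial.

module Fields where
  open import Data.Nat as ℕ using (ℕ; zero; suc)
  open import Data.Nat.Divisibility using (_∣_; divides)
  open import Data.Fin using (zero; suc; fromℕ)
  open import Data.Vec using (Vec; []; _∷_; lookup)
  open import Data.List using (List; []; _∷_; length)
  open import Data.Maybe using (nothing)
  open import Relation.Binary.PropositionalEquality as ≡ using (_≡_)
  open import Tactic.RingSolver using (solve-∀)
  open import Tactic.RingSolver.Core.AlmostCommutativeRing using (AlmostCommutativeRing; fromCommutativeRing)

  module FieldLemmas {c ℓ : Level} (K : CommutativeRing c ℓ) (K-field : IsField K) where
    open CommutativeRing K hiding (zero)
    open IsField K-field
    open import Algebra.Properties.Ring ring using (-‿involutive; -0#≈0#)
    open import Relation.Binary.Reasoning.Setoid setoid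

    Kˢ : AlmostCommutativeRing c ℓ
    Kˢ = fromCommutativeRing K (λ _ → nothing)

    infixr 8 _^_
    _^_ : Carrier → ℕ → Carrier
    _^_ = pow K

    *-cancel-0 : ∀ {x y} → ¬ (x ≈ 0#) → x * y ≈ 0# → y ≈ 0#
    *-cancel-0 {x} {y} x≉0 xy≈0 with x⁻¹ , xx⁻¹≈1 ← inverse x x≉0 = begin
      y              ≈⟨ *-identityˡ y ⟨
      1# * y         ≈⟨ *-congʳ xx⁻¹≈1 ⟨
      (x * x⁻¹) * y  ≈⟨ *-congʳ (*-comm x x⁻¹) ⟩
      (x⁻¹ * x) * y  ≈⟨ *-assoc x⁻¹ x y ⟩
      x⁻¹ * (x * y)  ≈⟨ *-congˡ xy≈0 ⟩
      x⁻¹ * 0#       ≈⟨ zeroʳ x⁻¹ ⟩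
      0#             ∎

    *-cancelˡ : ∀ {x y z} → ¬ (x ≈ 0#) → x * y ≈ x * z → y ≈ z
    *-cancelˡ {x} {y} {z} x≉0 xy≈xz with x⁻¹ , xx⁻¹≈1 ← inverse x x≉0 = begin
      y              ≈⟨ undo y ⟨
      x⁻¹ * (x * y)  ≈⟨ *-congˡ xy≈xz ⟩
      x⁻¹ * (x * z)  ≈⟨ undo z ⟩
      z              ∎
      where
      undo : ∀ w → x⁻¹ * (x * w) ≈ w
      undo w = begin
        x⁻¹ * (x * w)  ≈⟨ *-assoc x⁻¹ x w ⟨
        (x⁻¹ * x) * w  ≈⟨ *-congʳ (*-comm x⁻¹ x) ⟩
        (x * x⁻¹) * w  ≈⟨ *-congʳ xx⁻¹≈1 ⟩
        1# * w         ≈⟨ *-identityˡ w ⟩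
        w              ∎

    *-≉0 : ∀ {x y} → ¬ (x ≈ 0#) → ¬ (y ≈ 0#) → ¬ (x * y ≈ 0#)
    *-≉0 x≉0 y≉0 xy≈0 = y≉0 (*-cancel-0 x≉0 xy≈0)

    -‿≉0 : ∀ {x} → ¬ (x ≈ 0#) → ¬ (- x ≈ 0#)
    -‿≉0 {x} x≉0 -x≈0 = x≉0 (begin
      x      ≈⟨ -‿involutive x ⟨
      - - x  ≈⟨ -‿cong -x≈0 ⟩
      - 0#   ≈⟨ -0#≈0# ⟩
      0#     ∎)

    ^-cong : ∀ {x y} k → x ≈ y → x ^ k ≈ y ^ k
    ^-cong zero    x≈y = refl
    ^-cong (suc k) x≈y = *-cong x≈y (^-cong k x≈y)

    1^ : ∀ k → 1# ^ k ≈ 1#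
    1^ zero    = refl
    1^ (suc k) = trans (*-identityˡ _) (1^ k)

    ^-+ : ∀ x j k → x ^ (j ℕ.+ k) ≈ x ^ j * x ^ k
    ^-+ x zero    k = sym (*-identityˡ _)
    ^-+ x (suc j) k = trans (*-congˡ (^-+ x j k)) (sym (*-assoc _ _ _))

    *-^ : ∀ x y k → (x * y) ^ k ≈ x ^ k * y ^ k
    *-^ x y zero    = sym (*-identityˡ _)
    *-^ x y (suc k) = trans (*-congˡ (*-^ x y k)) (interchange x y (x ^ k) (y ^ k))
      where
      open AlmostCommutativeRing Kˢ using () renaming (_*_ to _·_; _≈_ to _≋_)
      interchange : ∀ a b c d → (a · b) · (c · d) ≋ (a · c) · (b · d)
      interchange = solve-∀ Kˢ

    ^-* : ∀ x j k → x ^ (j ℕ.* k) ≈ (x ^ j) ^ k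
    ^-* x zero    k = sym (1^ k)
    ^-* x (suc j) k = begin
      x ^ (k ℕ.+ j ℕ.* k)    ≈⟨ ^-+ x k (j ℕ.* k) ⟩
      x ^ k * x ^ (j ℕ.* k)  ≈⟨ *-congˡ (^-* x j k) ⟩
      x ^ k * (x ^ j) ^ k    ≈⟨ *-^ x (x ^ j) k ⟨
      (x * x ^ j) ^ k        ∎

    ^-∣ : ∀ {x j k} → x ^ j ≈ 1# → j ∣ k → x ^ k ≈ 1#
    ^-∣ {x} {j} x^j≈1 (divides q ≡.refl) = begin
      x ^ (q ℕ.* j)  ≡⟨ ≡.cong (x ^_) (ℕₚ.*-comm q j) ⟩
      x ^ (j ℕ.* q)  ≈⟨ ^-* x j q ⟩
      (x ^ j) ^ q    ≈⟨ ^-cong q x^j≈1 ⟩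
      1# ^ q         ≈⟨ 1^ q ⟩
      1#             ∎

    ^-≉0 : ∀ {x} k → ¬ (x ≈ 0#) → ¬ (x ^ k ≈ 0#)
    ^-≉0 zero    x≉0 = 1≉0
    ^-≉0 (suc k) x≉0 = *-≉0 x≉0 (^-≉0 k x≉0)

    root≉0 : ∀ {x} k .{{_ : ℕ.NonZero k}} → x ^ k ≈ 1# → ¬ (x ≈ 0#)
    root≉0 {x} (suc k) x^k≈1 x≈0 = 1≉0 (trans (sym x^k≈1) (trans (*-congʳ x≈0) (zeroˡ _)))

    Distinct : List Carrier → Set (c ⊔ ℓ)
    Distinct = AllPairs (λ r s → ¬ (r ≈ s))

    ⟦_⟧ : ∀ {m} → Vec Carrier m → Carrier → Carrier
    ⟦ [] ⟧     x = 0#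
    ⟦ a ∷ as ⟧ x = a + x * ⟦ as ⟧ x

    ⟦⟧-cong : ∀ {m} (as : Vec Carrier m) {x y} → x ≈ y → ⟦ as ⟧ x ≈ ⟦ as ⟧ y
    ⟦⟧-cong []       x≈y = refl
    ⟦⟧-cong (a ∷ as) x≈y = +-congˡ (*-cong x≈y (⟦⟧-cong as x≈y))

    -- Synthetic division: the coefficients of (P(X) - P(r)) / (X - r), which are the Horner tails
    -- of P evaluated at r.
    quotient : ∀ {m} → Vec Carrier (suc m) → Carrier → Vec Carrier m
    quotient (a ∷ [])     r = []
    quotient (a ∷ b ∷ as) r = ⟦ b ∷ as ⟧ r ∷ quotient (b ∷ as) r

    -- The argument is written `r + d` instead of introducing a difference, so that the induction
    -- step is a pure ring identity.
    division : ∀ {m} (as : Vec Carrier (suc m)) r d →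
               ⟦ as ⟧ (r + d) ≈ ⟦ as ⟧ r + d * ⟦ quotient as r ⟧ (r + d)
    division (a ∷ []) r d = begin
      a + (r + d) * 0#       ≈⟨ +-congˡ (trans (zeroʳ _) (sym (zeroʳ r))) ⟩
      a + r * 0#             ≈⟨ +-identityʳ _ ⟨
      a + r * 0# + 0#        ≈⟨ +-congˡ (zeroʳ d) ⟨
      a + r * 0# + d * 0#    ∎
    division (a ∷ b ∷ as) r d = begin
      a + (r + d) * ⟦ b ∷ as ⟧ (r + d)
        ≈⟨ +-congˡ (*-congˡ (division (b ∷ as) r d)) ⟩
      a + (r + d) * (⟦ b ∷ as ⟧ r + d * ⟦ quotient (b ∷ as) r ⟧ (r + d))
        ≈⟨ rearrange a r d (⟦ b ∷ as ⟧ r) (⟦ quotient (b ∷ as) r ⟧ (r + d)) ⟩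
      a + r * ⟦ b ∷ as ⟧ r + d * (⟦ b ∷ as ⟧ r + (r + d) * ⟦ quotient (b ∷ as) r ⟧ (r + d)) ∎
      where
      open AlmostCommutativeRing Kˢ using () renaming (_*_ to _·_; _+_ to _⊹_; _≈_ to _≋_)
      rearrange : ∀ a r d u v → a ⊹ (r ⊹ d) · (u ⊹ d · v) ≋ a ⊹ r · u ⊹ d · (u ⊹ (r ⊹ d) · v)
      rearrange = solve-∀ Kˢ

    quotient-root : ∀ {m} (as : Vec Carrier (suc m)) {r s} → ¬ (r ≈ s) →
                    ⟦ as ⟧ r ≈ 0# → ⟦ as ⟧ s ≈ 0# → ⟦ quotient as r ⟧ s ≈ 0#
    quotient-root as {r} {s} r≉s Pr≈0 Ps≈0 = *-cancel-0 d≉0 (begin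
      d * ⟦ quotient as r ⟧ s                       ≈⟨ *-congˡ (⟦⟧-cong (quotient as r) r+d≈s) ⟨
      d * ⟦ quotient as r ⟧ (r + d)                 ≈⟨ +-identityˡ _ ⟨
      0# + d * ⟦ quotient as r ⟧ (r + d)            ≈⟨ +-congʳ Pr≈0 ⟨
      ⟦ as ⟧ r + d * ⟦ quotient as r ⟧ (r + d)      ≈⟨ division as r d ⟨
      ⟦ as ⟧ (r + d)                                ≈⟨ ⟦⟧-cong as r+d≈s ⟩
      ⟦ as ⟧ s                                      ≈⟨ Ps≈0 ⟩
      0#                                            ∎)
      where
      d = s - r
      r+d≈s : r + d ≈ s
      r+d≈s = begin
        r + (s - r)    ≈⟨ +-comm r (s - r) ⟩
        (s - r) + r    ≈⟨ +-assoc s (- r) r ⟩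
        s + (- r + r)  ≈⟨ +-congˡ (-‿inverseˡ r) ⟩
        s + 0#         ≈⟨ +-identityʳ s ⟩
        s              ∎
      d≉0 : ¬ (d ≈ 0#)
      d≉0 d≈0 = r≉s (trans (sym (+-identityʳ r)) (trans (+-congˡ (sym d≈0)) r+d≈s))

    quotient-zero : ∀ {m} (as : Vec Carrier (suc m)) {r} → ⟦ as ⟧ r ≈ 0# →
                    (∀ i → lookup (quotient as r) i ≈ 0#) → ∀ i → lookup as i ≈ 0#
    quotient-zero (a ∷ []) {r} Pr≈0 Q≈0 zero = begin
      a           ≈⟨ +-identityʳ a ⟨
      a + 0#      ≈⟨ +-congˡ (zeroʳ r) ⟨
      a + r * 0#  ≈⟨ Pr≈0 ⟩
      0#          ∎
    quotient-zero (a ∷ b ∷ as) {r} Pr≈0 Q≈0 zero = begin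
      a                         ≈⟨ +-identityʳ a ⟨
      a + 0#                    ≈⟨ +-congˡ (zeroʳ r) ⟨
      a + r * 0#                ≈⟨ +-congˡ (*-congˡ (Q≈0 zero)) ⟨
      a + r * ⟦ b ∷ as ⟧ r      ≈⟨ Pr≈0 ⟩
      0#                        ∎
    quotient-zero (a ∷ b ∷ as) Pr≈0 Q≈0 (suc i) =
      quotient-zero (b ∷ as) (Q≈0 zero) (λ j → Q≈0 (suc j)) i

    -- A vector of length m is a polynomial of degree less than m. Each root divides off one degree,
    -- and the remaining roots, being different from it, are roots of the quotient.
    coefficients≈0 : ∀ {m} (as : Vec Carrier m) (rs : List Carrier) → length rs ≡ m → Distinct rs →
                     All (λ r → ⟦ as ⟧ r ≈ 0#) rs → ∀ i → lookup as i ≈ 0#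
    coefficients≈0 as@(_ ∷ _) (r ∷ rs) len (r∉rs ∷ distinct) (Pr≈0 ∷ Prs≈0) =
      quotient-zero as Pr≈0 (coefficients≈0 (quotient as r) rs (ℕₚ.suc-injective len) distinct
        (All.zipWith (λ (r≉s , Ps≈0) → quotient-root as r≉s Pr≈0 Ps≈0) (r∉rs , Prs≈0)))

    monomial : ∀ m → Vec Carrier (suc m)
    monomial zero    = 1# ∷ []
    monomial (suc m) = 0# ∷ monomial m

    monomial-eval : ∀ m x → ⟦ monomial m ⟧ x ≈ x ^ m
    monomial-eval zero    x = trans (+-congˡ (zeroʳ x)) (+-identityʳ 1#)
    monomial-eval (suc m) x = trans (+-identityˡ _) (*-congˡ (monomial-eval m x))

    monomial-last : ∀ m → lookup (monomial m) (fromℕ m) ≡ 1#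
    monomial-last zero    = ≡.refl
    monomial-last (suc m) = monomial-last m

    -- Only lists of length exactly m + 2 need to be excluded: longer ones are cut.
    roots-bound : ∀ m b (rs : List Carrier) → Distinct rs → All (λ r → r ^ suc m ≈ b) rs → length rs ℕ.≤ suc m
    roots-bound m b rs distinct roots with length rs ℕₚ.≤? suc m
    ... | yes len≤ = len≤
    ... | no  len≰ = contradiction 1≈0 1≉0
      where
      open import Data.List using (take)
      open import Data.List.Properties using (length-take)
      import Data.List.Relation.Unary.All.Properties as Allₚ
      import Data.List.Relation.Unary.AllPairs.Properties as AllPairsₚ
      k = suc (suc m)
      poly : Vec Carrier k
      poly = - b ∷ monomial m
      poly-root : ∀ {r} → r ^ suc m ≈ b → ⟦ poly ⟧ r ≈ 0#
      poly-root {r} r^m≈b = begin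
        - b + r * ⟦ monomial m ⟧ r  ≈⟨ +-congˡ (*-congˡ (monomial-eval m r)) ⟩
        - b + r ^ suc m             ≈⟨ +-congˡ r^m≈b ⟩
        - b + b                     ≈⟨ -‿inverseˡ b ⟩
        0#                          ∎
      1≈0 : 1# ≈ 0#
      1≈0 = trans (reflexive (≡.sym (monomial-last m)))
        (coefficients≈0 poly (take k rs) (≡.trans (length-take k rs) (ℕₚ.m≤n⇒m⊓n≡m (ℕₚ.≰⇒> len≰)))
          (AllPairsₚ.take⁺ k distinct) (Allₚ.take⁺ k (All.map poly-root roots)) (suc (fromℕ m)))

-- Arithmetic in C_m₁ ⊕ C_m₂.

module Groups where
  open import Data.Nat as ℕ using (ℕ; _+_; NonZero)
  open import Data.Nat.DivMod using (_mod_; _%_; m%n<n; m%n%n≡m%n; m<n⇒m%n≡m; %-distribˡ-+)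
  open import Data.Nat.Divisibility using (_∣_; _∣0; m%n≡0⇒n∣m; n∣m⇒m%n≡0)
  open import Data.Fin using (Fin; toℕ)
  open import Data.List using (List; []; _∷_; map)
  open import Data.Nat.ListAction using (sum)
  open import Relation.Binary.PropositionalEquality

  0%n≡0 : ∀ m .{{_ : NonZero m}} → 0 % m ≡ 0
  0%n≡0 m = n∣m⇒m%n≡0 0 m (m ∣0)

  toℕ-mod : ∀ a m .{{_ : NonZero m}} → toℕ (a mod m) ≡ a % m
  toℕ-mod a m = Finₚ.toℕ-fromℕ< (m%n<n a m)

  toℕ-mod-small : ∀ {a} m .{{_ : NonZero m}} → a ℕ.< m → toℕ (a mod m) ≡ a
  toℕ-mod-small m a<m = trans (toℕ-mod _ m) (m<n⇒m%n≡m a<m)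

  mod-≡ : ∀ {a b} m .{{_ : NonZero m}} → a % m ≡ b % m → a mod m ≡ b mod m
  mod-≡ m eq = Finₚ.toℕ-injective (trans (toℕ-mod _ m) (trans eq (sym (toℕ-mod _ m))))

  toℕ-0mod : ∀ m .{{_ : NonZero m}} → toℕ (0 mod m) ≡ 0
  toℕ-0mod m = trans (toℕ-mod 0 m) (0%n≡0 m)

  module GroupLemmas (m₁ m₂ : ℕ) .{{_ : NonZero m₁}} .{{_ : NonZero m₂}} where
    open Grp m₁ m₂

    ⊕-identityˡ : ∀ x → 0G ⊕ x ≡ x
    ⊕-identityˡ (i , j) = cong₂ _,_ (component m₁ i) (component m₂ j)
      where
      component : ∀ m .{{_ : NonZero m}} (i : Fin m) → (toℕ (0 mod m) + toℕ i) mod m ≡ i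
      component m i = Finₚ.toℕ-injective (begin
        toℕ ((toℕ (0 mod m) + toℕ i) mod m)  ≡⟨ cong (λ a → toℕ ((a + toℕ i) mod m)) (toℕ-0mod m) ⟩
        toℕ (toℕ i mod m)                    ≡⟨ toℕ-mod-small m (Finₚ.toℕ<n i) ⟩
        toℕ i                                ∎)
        where open ≡-Reasoning

    sum₁ sum₂ : List G → ℕ
    sum₁ = sum ∘ map (toℕ ∘ proj₁)
    sum₂ = sum ∘ map (toℕ ∘ proj₂)

    -- Reducing modulo m₁ and m₂ only once, at the end, turns zero-sum conditions into divisibility
    -- of sums of natural numbers.
    σ-sum : ∀ S → σ S ≡ (sum₁ S mod m₁ , sum₂ S mod m₂)
    σ-sum []            = refl
    σ-sum ((i , j) ∷ S) rewrite σ-sum S = cong₂ _,_ (component m₁ (toℕ i) (sum₁ S)) (component m₂ (toℕ j) (sum₂ S))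
      where
      component : ∀ m .{{_ : NonZero m}} a b → (a + toℕ (b mod m)) mod m ≡ (a + b) mod m
      component m a b = mod-≡ m (begin
        (a + toℕ (b mod m)) % m   ≡⟨ cong (λ c → (a + c) % m) (toℕ-mod b m) ⟩
        (a + b % m) % m           ≡⟨ %-distribˡ-+ a (b % m) m ⟩
        (a % m + b % m % m) % m   ≡⟨ cong (λ c → (a % m + c) % m) (m%n%n≡m%n b m) ⟩
        (a % m + b % m) % m       ≡⟨ %-distribˡ-+ a b m ⟨
        (a + b) % m               ∎)
        where open ≡-Reasoning

    σ≡0⇒∣ : ∀ S → σ S ≡ 0G → m₁ ∣ sum₁ S × m₂ ∣ sum₂ S
    σ≡0⇒∣ S σ≡0 = component m₁ (cong proj₁ eq) , component m₂ (cong proj₂ eq)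
      where
      eq = trans (sym (σ-sum S)) σ≡0
      component : ∀ m .{{_ : NonZero m}} {a} → a mod m ≡ 0 mod m → m ∣ a
      component m {a} eq = m%n≡0⇒n∣m a m (trans (sym (toℕ-mod a m)) (trans (cong toℕ eq) (toℕ-0mod m)))

    ∣⇒σ≡0 : ∀ S → m₁ ∣ sum₁ S → m₂ ∣ sum₂ S → σ S ≡ 0G
    ∣⇒σ≡0 S m₁∣ m₂∣ = trans (σ-sum S) (cong₂ _,_ (component m₁ m₁∣) (component m₂ m₂∣))
      where
      component : ∀ m .{{_ : NonZero m}} {a} → m ∣ a → a mod m ≡ 0 mod m
      component m {a} m∣a = mod-≡ m (trans (n∣m⇒m%n≡0 a m m∣a) (sym (0%n≡0 m)))

-- Products in the group algebra, their coefficients and their values at characters.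

module GroupAlgebras where
  open Fields
  open Groups
  open import Data.Nat as ℕ using (ℕ; zero; suc; NonZero)
  open import Data.Nat.DivMod using (_mod_; _%_; _/_; m≡m%n+[m/n]*n)
  open import Data.Nat.Divisibility using (divides)
  open import Data.Fin using (Fin; zero; suc; toℕ)
  open import Data.Vec as Vec using (Vec; []; _∷_; lookup)
  open import Data.List using (List; []; _∷_; _++_; length; map; zipWith; zip; allFin; tabulate; cartesianProduct)
  open import Data.List.Relation.Binary.Sublist.Propositional using (_⊆_; []; _∷_; _∷ʳ_)
  open import Relation.Binary.PropositionalEquality as ≡ using (_≡_; _≢_)

  module Characters {c ℓ : Level} (K : CommutativeRing c ℓ) (K-field : IsField K)
                    (m₁ m₂ : ℕ) .{{_ : NonZero m₁}} .{{_ : NonZero m₂}} where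
    open Grp m₁ m₂
    open Grp.GroupAlgebra m₁ m₂ K
    open GroupLemmas m₁ m₂ using (⊕-identityˡ)
    open CommutativeRing K hiding (zero)
    open IsField K-field
    open FieldLemmas K K-field
    open import Algebra.Properties.Ring ring using (-‿distribˡ-*; -0#≈0#)
    open import Relation.Binary.Reasoning.Setoid setoid
    open import Algebra.Properties.CommutativeSemigroup *-commutativeSemigroup using () renaming (interchange to *-interchange)
    open import Algebra.Properties.CommutativeSemigroup +-commutativeSemigroup using () renaming (interchange to +-interchange)

    Σ[_] : ∀ {a} {A : Set a} → List A → (A → Carrier) → Carrier
    Σ[ xs ] f = ΣR (map f xs)

    module _ {a} {A : Set a} where

      Σ-cong : ∀ (xs : List A) {f h : A → Carrier} → (∀ x → f x ≈ h x) → Σ[ xs ] f ≈ Σ[ xs ] h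
      Σ-cong []       f≈h = refl
      Σ-cong (x ∷ xs) f≈h = +-cong (f≈h x) (Σ-cong xs f≈h)

      Σ-zero : ∀ (xs : List A) {f : A → Carrier} → (∀ x → f x ≈ 0#) → Σ[ xs ] f ≈ 0#
      Σ-zero []       f≈0 = refl
      Σ-zero (x ∷ xs) f≈0 = trans (+-cong (f≈0 x) (Σ-zero xs f≈0)) (+-identityˡ 0#)

      Σ-+ : ∀ (xs : List A) (f h : A → Carrier) → Σ[ xs ] (λ x → f x + h x) ≈ Σ[ xs ] f + Σ[ xs ] h
      Σ-+ []       f h = sym (+-identityˡ 0#)
      Σ-+ (x ∷ xs) f h = trans (+-congˡ (Σ-+ xs f h)) (+-interchange _ _ _ _)

      Σ-*ˡ : ∀ (xs : List A) a (f : A → Carrier) → Σ[ xs ] (λ x → a * f x) ≈ a * Σ[ xs ] f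
      Σ-*ˡ []       a f = sym (zeroʳ a)
      Σ-*ˡ (x ∷ xs) a f = trans (+-congˡ (Σ-*ˡ xs a f)) (sym (distribˡ a _ _))

      Σ-*ʳ : ∀ (xs : List A) a (f : A → Carrier) → Σ[ xs ] (λ x → f x * a) ≈ Σ[ xs ] f * a
      Σ-*ʳ xs a f = trans (Σ-cong xs (λ x → *-comm (f x) a)) (trans (Σ-*ˡ xs a f) (*-comm a _))

      Σ-++ : ∀ (xs ys : List A) (f : A → Carrier) → Σ[ xs ++ ys ] f ≈ Σ[ xs ] f + Σ[ ys ] f
      Σ-++ []       ys f = sym (+-identityˡ _)
      Σ-++ (x ∷ xs) ys f = trans (+-congˡ (Σ-++ xs ys f)) (sym (+-assoc _ _ _))

    Σ-swap : ∀ {a b} {A : Set a} {B : Set b} (xs : List A) (ys : List B) (f : A → B → Carrier) →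
             Σ[ xs ] (λ x → Σ[ ys ] (f x)) ≈ Σ[ ys ] (λ y → Σ[ xs ] (λ x → f x y))
    Σ-swap []       ys f = sym (Σ-zero ys (λ _ → refl))
    Σ-swap (x ∷ xs) ys f = trans (+-congˡ (Σ-swap xs ys f)) (sym (Σ-+ ys (f x) (λ y → Σ[ xs ] (λ x′ → f x′ y))))

    Σ-× : ∀ {a b} {A : Set a} {B : Set b} (xs : List A) (ys : List B) (f : A × B → Carrier) →
          Σ[ cartesianProduct xs ys ] f ≈ Σ[ xs ] (λ x → Σ[ ys ] (λ y → f (x , y)))
    Σ-× []       ys f = refl
    Σ-× (x ∷ xs) ys f = trans (Σ-++ (map (x ,_) ys) (cartesianProduct xs ys) f)
      (+-cong (reflexive (≡.cong ΣR (≡.sym (Listₚ.map-∘ ys)))) (Σ-× xs ys f))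

    -- The case distinctions of `X^` and `_⋆_` with the decision as an explicit argument, so that
    -- sums can be rearranged around them.
    δ : ∀ {p} {P : Set p} → Dec P → Carrier → Carrier
    δ (yes _) a = a
    δ (no  _) a = 0#

    δ-no : ∀ {p} {P : Set p} (P? : Dec P) {a} → ¬ P → δ P? a ≈ 0#
    δ-no (yes p) ¬p = contradiction p ¬p
    δ-no (no  _) ¬p = refl

    δ-*ʳ : ∀ {p} {P : Set p} (P? : Dec P) a b → δ P? a * b ≈ δ P? (a * b)
    δ-*ʳ (yes _) a b = refl
    δ-*ʳ (no  _) a b = zeroˡ b

    δ-*ˡ : ∀ {p} {P : Set p} (P? : Dec P) a b → a * δ P? b ≈ δ P? (a * b)
    δ-*ˡ (yes _) a b = refl
    δ-*ˡ (no  _) a b = zeroʳ a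

    δ-⇔ : ∀ {p q} {P : Set p} {Q : Set q} (P? : Dec P) (Q? : Dec Q) → (P → Q) → (Q → P) → ∀ {a} → δ P? a ≈ δ Q? a
    δ-⇔ (yes _) (yes _) P⇒Q Q⇒P = refl
    δ-⇔ (yes p) (no ¬q) P⇒Q Q⇒P = contradiction (P⇒Q p) ¬q
    δ-⇔ (no ¬p) (yes q) P⇒Q Q⇒P = contradiction (Q⇒P q) ¬p
    δ-⇔ (no  _) (no  _) P⇒Q Q⇒P = refl

    allG-unique : Unique allG
    allG-unique = Uniqueₚ.cartesianProduct⁺ (Uniqueₚ.allFin⁺ m₁) (Uniqueₚ.allFin⁺ m₂)

    ∈-allG : ∀ g → g ∈ allG
    ∈-allG (i , j) = ∈ₚ.∈-cartesianProduct⁺ (∈ₚ.∈-allFin i) (∈ₚ.∈-allFin j)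

    Σ-δ-∉ : ∀ g xs (f : G → Carrier) → All (g ≢_) xs → Σ[ xs ] (λ x → δ (g ≟G x) (f x)) ≈ 0#
    Σ-δ-∉ g []       f []           = refl
    Σ-δ-∉ g (x ∷ xs) f (g≢x ∷ g∉xs) =
      trans (+-cong (δ-no (g ≟G x) g≢x) (Σ-δ-∉ g xs f g∉xs)) (+-identityˡ 0#)

    Σ-δ : ∀ g xs (f : G → Carrier) → Unique xs → g ∈ xs → Σ[ xs ] (λ x → δ (g ≟G x) (f x)) ≈ f g
    Σ-δ g (x ∷ xs) f (x∉xs ∷ xs!) g∈ with g ≟G x | g∈
    ... | yes ≡.refl | _            = trans (+-congˡ (Σ-δ-∉ g xs f x∉xs)) (+-identityʳ (f g))
    ... | no  g≢x    | here g≡x     = contradiction g≡x g≢x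
    ... | no  g≢x    | there g∈xs   = trans (+-identityˡ _) (Σ-δ g xs f xs! g∈xs)

    Σ-δ-allG : ∀ g (f : G → Carrier) → Σ[ allG ] (λ x → δ (g ≟G x) (f x)) ≈ f g
    Σ-δ-allG g f = Σ-δ g allG f allG-unique (∈-allG g)

    X^-δ : ∀ g x → X^ g x ≈ δ (g ≟G x) 1#
    X^-δ g x with g ≟G x
    ... | yes _ = refl
    ... | no  _ = refl

    -- The summand of the convolution is local to its definition, hence the inferred left-hand side.
    mutual
      ⋆-δ : ∀ f h x → (f ⋆ h) x ≈ Σ[ allG ] (λ y → Σ[ allG ] (λ z → δ ((y ⊕ z) ≟G x) (f y * h z)))
      ⋆-δ f h x = Σ-cong allG (λ y → Σ-cong allG (λ z → summand f h x y z))

      summand : ∀ (f h : RG) (x y z : G) → _ ≈ δ ((y ⊕ z) ≟G x) (f y * h z)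
      summand f h x y z with (y ⊕ z) ≟G x
      ... | yes _ = refl
      ... | no  _ = refl

    -- Multiplication by X^g - a gives the translate of `h` by `g` minus a times `h`. The translate
    -- is kept as a sum over all z with g ⊕ z = x, which avoids the inverse of g.
    factor-⋆ : ∀ g a h x → (factor g a ⋆ h) x ≈ Σ[ allG ] (λ z → δ ((g ⊕ z) ≟G x) (h z)) + - a * h x
    factor-⋆ g a h x = begin
      (factor g a ⋆ h) x
        ≈⟨ ⋆-δ (factor g a) h x ⟩
      Σ[ allG ] (λ y → Σ[ allG ] (λ z → δ ((y ⊕ z) ≟G x) (factor g a y * h z)))
        ≈⟨ Σ-swap allG allG _ ⟩
      Σ[ allG ] (λ z → Σ[ allG ] (λ y → δ ((y ⊕ z) ≟G x) (factor g a y * h z)))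
        ≈⟨ Σ-cong allG inner ⟩
      Σ[ allG ] (λ z → δ ((g ⊕ z) ≟G x) (h z) + - a * δ ((0G ⊕ z) ≟G x) (h z))
        ≈⟨ Σ-+ allG _ _ ⟩
      Σ[ allG ] (λ z → δ ((g ⊕ z) ≟G x) (h z)) + Σ[ allG ] (λ z → - a * δ ((0G ⊕ z) ≟G x) (h z))
        ≈⟨ +-congˡ (trans (Σ-*ˡ allG (- a) _) (*-congˡ (trans (Σ-cong allG identity) (Σ-δ-allG x h)))) ⟩
      Σ[ allG ] (λ z → δ ((g ⊕ z) ≟G x) (h z)) + - a * h x ∎
      where
      identity : ∀ z → δ ((0G ⊕ z) ≟G x) (h z) ≈ δ (x ≟G z) (h z)
      identity z = δ-⇔ ((0G ⊕ z) ≟G x) (x ≟G z)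
        (λ 0⊕z≡x → ≡.trans (≡.sym 0⊕z≡x) (⊕-identityˡ z)) (λ x≡z → ≡.trans (⊕-identityˡ z) (≡.sym x≡z))
      expand : ∀ y z → δ ((y ⊕ z) ≟G x) (factor g a y * h z) ≈
               δ (g ≟G y) (δ ((y ⊕ z) ≟G x) (h z)) + - a * δ (0G ≟G y) (δ ((y ⊕ z) ≟G x) (h z))
      expand y z = begin
        δ ((y ⊕ z) ≟G x) (factor g a y * h z)
          ≈⟨ δ-*ˡ ((y ⊕ z) ≟G x) (factor g a y) (h z) ⟨
        factor g a y * w
          ≈⟨ *-congʳ (+-cong (X^-δ g y) (trans (-‿cong (*-congˡ (X^-δ 0G y))) (-‿distribˡ-* a _))) ⟩
        (δ (g ≟G y) 1# + - a * δ (0G ≟G y) 1#) * w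
          ≈⟨ distribʳ w _ _ ⟩
        δ (g ≟G y) 1# * w + (- a * δ (0G ≟G y) 1#) * w
          ≈⟨ +-cong (unit (g ≟G y)) (trans (*-assoc _ _ _) (*-congˡ (unit (0G ≟G y)))) ⟩
        δ (g ≟G y) w + - a * δ (0G ≟G y) w ∎
        where
        w = δ ((y ⊕ z) ≟G x) (h z)
        unit : ∀ {p} {P : Set p} (P? : Dec P) → δ P? 1# * w ≈ δ P? w
        unit (yes _) = *-identityˡ w
        unit (no  _) = zeroˡ w
      inner : ∀ z → Σ[ allG ] (λ y → δ ((y ⊕ z) ≟G x) (factor g a y * h z)) ≈
              δ ((g ⊕ z) ≟G x) (h z) + - a * δ ((0G ⊕ z) ≟G x) (h z)
      inner z = begin
        Σ[ allG ] (λ y → δ ((y ⊕ z) ≟G x) (factor g a y * h z))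
          ≈⟨ Σ-cong allG (λ y → expand y z) ⟩
        Σ[ allG ] (λ y → δ (g ≟G y) (δ ((y ⊕ z) ≟G x) (h z)) + - a * δ (0G ≟G y) (δ ((y ⊕ z) ≟G x) (h z)))
          ≈⟨ Σ-+ allG _ _ ⟩
        Σ[ allG ] (λ y → δ (g ≟G y) (δ ((y ⊕ z) ≟G x) (h z))) +
        Σ[ allG ] (λ y → - a * δ (0G ≟G y) (δ ((y ⊕ z) ≟G x) (h z)))
          ≈⟨ +-cong (Σ-δ-allG g _) (trans (Σ-*ˡ allG (- a) _) (*-congˡ (Σ-δ-allG 0G _))) ⟩
        δ ((g ⊕ z) ≟G x) (h z) + - a * δ ((0G ⊕ z) ≟G x) (h z) ∎

    factors : List (G × Carrier) → RG
    factors = ∏ ∘ map (uncurry factor)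

    NonZeros : List (G × Carrier) → Set (c ⊔ ℓ)
    NonZeros = All (λ (g , a) → ¬ (a ≈ 0#))

    -- Expanding the product, every basis element that occurs is X to the sum of a subsequence.
    coefficient-off-sums : ∀ ps x → (∀ T → T ⊆ map proj₁ ps → σ T ≢ x) → factors ps x ≈ 0#
    coefficient-off-sums []             x avoid = trans (X^-δ 0G x) (δ-no (0G ≟G x) (avoid [] []))
    coefficient-off-sums ((g , a) ∷ ps) x avoid = begin
      (factor g a ⋆ factors ps) x
        ≈⟨ factor-⋆ g a (factors ps) x ⟩
      Σ[ allG ] (λ z → δ ((g ⊕ z) ≟G x) (factors ps z)) + - a * factors ps x
        ≈⟨ +-cong (Σ-zero allG shifted) (trans (*-congˡ (coefficient-off-sums ps x (λ T T⊆ → avoid T (g ∷ʳ T⊆)))) (zeroʳ _)) ⟩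
      0# + 0#
        ≈⟨ +-identityˡ 0# ⟩
      0# ∎
      where
      shifted : ∀ z → δ ((g ⊕ z) ≟G x) (factors ps z) ≈ 0#
      shifted z with (g ⊕ z) ≟G x
      ... | no  _      = refl
      ... | yes ≡.refl = coefficient-off-sums ps z (λ T T⊆ σT≡z → avoid (g ∷ T) (≡.refl ∷ T⊆) (≡.cong (g ⊕_) σT≡z))

    -- Only the choice of -a in every factor reaches X^0: a term with X^g would need a subsequence
    -- of the rest with sum -g, giving a nonempty zero-sum subsequence.
    coefficient-at-0 : ∀ ps → ZeroSumFree (map proj₁ ps) → NonZeros ps → ¬ (factors ps 0G ≈ 0#)
    coefficient-at-0 [] free [] 1≈0 = 1≉0 (trans (sym (δ-yes (0G ≟G 0G))) (trans (sym (X^-δ 0G 0G)) 1≈0))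
      where
      δ-yes : (0≟0 : Dec (0G ≡ 0G)) → δ 0≟0 1# ≈ 1#
      δ-yes (yes _)   = refl
      δ-yes (no  0≢0) = contradiction ≡.refl 0≢0
    coefficient-at-0 ((g , a) ∷ ps) free (a≉0 ∷ ps≉0) coefficient≈0 =
      *-≉0 (-‿≉0 a≉0) (coefficient-at-0 ps (λ T T⊆ → free T (g ∷ʳ T⊆)) ps≉0) (begin
        - a * factors ps 0G
          ≈⟨ +-identityˡ _ ⟨
        0# + - a * factors ps 0G
          ≈⟨ +-congʳ (Σ-zero allG shifted) ⟨
        Σ[ allG ] (λ z → δ ((g ⊕ z) ≟G 0G) (factors ps z)) + - a * factors ps 0G
          ≈⟨ factor-⋆ g a (factors ps) 0G ⟨
        (factor g a ⋆ factors ps) 0G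
          ≈⟨ coefficient≈0 ⟩
        0# ∎)
      where
      shifted : ∀ z → δ ((g ⊕ z) ≟G 0G) (factors ps z) ≈ 0#
      shifted z with (g ⊕ z) ≟G 0G
      ... | no  _     = refl
      ... | yes g⊕z≡0 = coefficient-off-sums ps z (λ T T⊆ σT≡z →
              free (g ∷ T) (≡.refl ∷ T⊆) (λ ()) (≡.trans (≡.cong (g ⊕_) σT≡z) g⊕z≡0))

    -- `Good` with each scalar attached to its element, so that both move together when the sequence
    -- is split or permuted.
    Nonvanishing : List G → Set (c ⊔ ℓ)
    Nonvanishing S = ∀ ps → map proj₁ ps ≡ S → NonZeros ps → ¬ IsZero (factors ps)

    nonvanishing⇒good : ∀ {S} → Nonvanishing S → Good S
    nonvanishing⇒good {S} nonvanishing as len as≉0 ∏≈0 =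
      nonvanishing (zip S as) (fst S as len) (nonzeros S as as≉0) (λ x → ≡.subst (λ fs → ∏ fs x ≈ 0#) (≡.sym (pairs S as)) (∏≈0 x))
      where
      fst : ∀ S (as : List Carrier) → length as ≡ length S → map proj₁ (zip S as) ≡ S
      fst []      []       len = ≡.refl
      fst (g ∷ S) (a ∷ as) len = ≡.cong (g ∷_) (fst S as (ℕₚ.suc-injective len))
      nonzeros : ∀ S as → All (λ a → ¬ (a ≈ 0#)) as → NonZeros (zip S as)
      nonzeros []      as       as≉0           = []
      nonzeros (g ∷ S) []       []             = []
      nonzeros (g ∷ S) (a ∷ as) (a≉0 ∷ as≉0)   = a≉0 ∷ nonzeros S as as≉0
      pairs : ∀ S as → map (uncurry factor) (zip S as) ≡ zipWith factor S as
      pairs []      as       = ≡.refl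
      pairs (g ∷ S) []       = ≡.refl
      pairs (g ∷ S) (a ∷ as) = ≡.cong (factor g a ∷_) (pairs S as)

    good⇒nonvanishing : ∀ {S} → Good S → Nonvanishing S
    good⇒nonvanishing good ps ≡.refl ps≉0 zero-product = good (map proj₂ ps)
      (≡.trans (Listₚ.length-map proj₂ ps) (≡.sym (Listₚ.length-map proj₁ ps)))
      (Allₚ.map⁺ ps≉0) (λ x → ≡.subst (λ fs → ∏ fs x ≈ 0#) (≡.sym (pairs ps)) (zero-product x))
      where
      pairs : ∀ ps → zipWith factor (map proj₁ ps) (map proj₂ ps) ≡ map (uncurry factor) ps
      pairs []             = ≡.refl
      pairs ((g , a) ∷ ps) = ≡.cong (factor g a ∷_) (pairs ps)

    zeroSumFree⇒good : ∀ {S} → ZeroSumFree S → Good S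
    zeroSumFree⇒good {S} free = nonvanishing⇒good {S} λ where
      ps ≡.refl ps≉0 zero-product → coefficient-at-0 ps free ps≉0 (zero-product 0G)

    χ : Carrier → Carrier → G → Carrier
    χ θ η (i , j) = θ ^ toℕ i * η ^ toℕ j

    ^-mod : ∀ {θ} m .{{_ : NonZero m}} → θ ^ m ≈ 1# → ∀ k → θ ^ toℕ (k mod m) ≈ θ ^ k
    ^-mod {θ} m θ^m≈1 k = begin
      θ ^ toℕ (k mod m)               ≡⟨ ≡.cong (θ ^_) (toℕ-mod k m) ⟩
      θ ^ (k % m)                     ≈⟨ *-identityʳ _ ⟨
      θ ^ (k % m) * 1#                ≈⟨ *-congˡ (^-∣ θ^m≈1 (divides (k / m) ≡.refl)) ⟨
      θ ^ (k % m) * θ ^ (k / m ℕ.* m) ≈⟨ ^-+ θ (k % m) _ ⟨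
      θ ^ (k % m ℕ.+ k / m ℕ.* m)     ≡⟨ ≡.cong (θ ^_) (m≡m%n+[m/n]*n k m) ⟨
      θ ^ k                           ∎

    module _ {θ η : Carrier} (θ^m₁≈1 : θ ^ m₁ ≈ 1#) (η^m₂≈1 : η ^ m₂ ≈ 1#) where

      χ-⊕ : ∀ x y → χ θ η (x ⊕ y) ≈ χ θ η x * χ θ η y
      χ-⊕ (i , j) (i′ , j′) = begin
        θ ^ toℕ ((toℕ i ℕ.+ toℕ i′) mod m₁) * η ^ toℕ ((toℕ j ℕ.+ toℕ j′) mod m₂)
          ≈⟨ *-cong (^-mod m₁ θ^m₁≈1 (toℕ i ℕ.+ toℕ i′)) (^-mod m₂ η^m₂≈1 (toℕ j ℕ.+ toℕ j′)) ⟩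
        θ ^ (toℕ i ℕ.+ toℕ i′) * η ^ (toℕ j ℕ.+ toℕ j′)
          ≈⟨ *-cong (^-+ θ (toℕ i) (toℕ i′)) (^-+ η (toℕ j) (toℕ j′)) ⟩
        (θ ^ toℕ i * θ ^ toℕ i′) * (η ^ toℕ j * η ^ toℕ j′)
          ≈⟨ *-interchange _ _ _ _ ⟩
        (θ ^ toℕ i * η ^ toℕ j) * (θ ^ toℕ i′ * η ^ toℕ j′) ∎

      χ-0 : χ θ η 0G ≈ 1#
      χ-0 = trans (*-cong (^-mod m₁ θ^m₁≈1 0) (^-mod m₂ η^m₂≈1 0)) (*-identityˡ 1#)

      χ≉0 : ∀ x → ¬ (χ θ η x ≈ 0#)
      χ≉0 (i , j) = *-≉0 (^-≉0 (toℕ i) (root≉0 m₁ θ^m₁≈1)) (^-≉0 (toℕ j) (root≉0 m₂ η^m₂≈1))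

      eval : RG → Carrier
      eval f = Σ[ allG ] (λ x → f x * χ θ η x)

      eval-⋆ : ∀ f h → eval (f ⋆ h) ≈ eval f * eval h
      eval-⋆ f h = begin
        Σ[ allG ] (λ x → (f ⋆ h) x * χ θ η x)
          ≈⟨ Σ-cong allG (λ x → trans (*-congʳ (⋆-δ f h x)) (sym (trans (Σ-cong allG (λ y → Σ-*ʳ allG _ _)) (Σ-*ʳ allG _ _)))) ⟩
        Σ[ allG ] (λ x → Σ[ allG ] (λ y → Σ[ allG ] (λ z → δ ((y ⊕ z) ≟G x) (f y * h z) * χ θ η x)))
          ≈⟨ Σ-swap allG allG _ ⟩
        Σ[ allG ] (λ y → Σ[ allG ] (λ x → Σ[ allG ] (λ z → δ ((y ⊕ z) ≟G x) (f y * h z) * χ θ η x)))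
          ≈⟨ Σ-cong allG (λ y → Σ-swap allG allG _) ⟩
        Σ[ allG ] (λ y → Σ[ allG ] (λ z → Σ[ allG ] (λ x → δ ((y ⊕ z) ≟G x) (f y * h z) * χ θ η x)))
          ≈⟨ Σ-cong allG (λ y → Σ-cong allG (λ z → pair-term y z)) ⟩
        Σ[ allG ] (λ y → Σ[ allG ] (λ z → (f y * χ θ η y) * (h z * χ θ η z)))
          ≈⟨ Σ-cong allG (λ y → Σ-*ˡ allG _ _) ⟩
        Σ[ allG ] (λ y → (f y * χ θ η y) * eval h)
          ≈⟨ Σ-*ʳ allG _ _ ⟩
        eval f * eval h ∎
        where
        pair-term : ∀ y z → Σ[ allG ] (λ x → δ ((y ⊕ z) ≟G x) (f y * h z) * χ θ η x) ≈ (f y * χ θ η y) * (h z * χ θ η z)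
        pair-term y z = begin
          Σ[ allG ] (λ x → δ ((y ⊕ z) ≟G x) (f y * h z) * χ θ η x)
            ≈⟨ Σ-cong allG (λ x → δ-*ʳ ((y ⊕ z) ≟G x) _ _) ⟩
          Σ[ allG ] (λ x → δ ((y ⊕ z) ≟G x) ((f y * h z) * χ θ η x))
            ≈⟨ Σ-δ-allG (y ⊕ z) _ ⟩
          (f y * h z) * χ θ η (y ⊕ z)
            ≈⟨ *-congˡ (χ-⊕ y z) ⟩
          (f y * h z) * (χ θ η y * χ θ η z)
            ≈⟨ *-interchange _ _ _ _ ⟩
          (f y * χ θ η y) * (h z * χ θ η z) ∎

      eval-X^ : ∀ g → eval (X^ g) ≈ χ θ η g
      eval-X^ g = begin
        Σ[ allG ] (λ x → X^ g x * χ θ η x)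
          ≈⟨ Σ-cong allG (λ x → trans (*-congʳ (X^-δ g x)) (δ-*ʳ (g ≟G x) _ _)) ⟩
        Σ[ allG ] (λ x → δ (g ≟G x) (1# * χ θ η x))
          ≈⟨ Σ-δ-allG g _ ⟩
        1# * χ θ η g
          ≈⟨ *-identityˡ _ ⟩
        χ θ η g ∎

      eval-factor : ∀ g a → eval (factor g a) ≈ χ θ η g + - a
      eval-factor g a = begin
        Σ[ allG ] (λ x → (X^ g x + - (a * X^ 0G x)) * χ θ η x)
          ≈⟨ Σ-cong allG (λ x → trans (distribʳ _ _ _) (+-congˡ (trans (*-congʳ (-‿distribˡ-* a _)) (*-assoc _ _ _)))) ⟩
        Σ[ allG ] (λ x → X^ g x * χ θ η x + - a * (X^ 0G x * χ θ η x))
          ≈⟨ Σ-+ allG _ _ ⟩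
        eval (X^ g) + Σ[ allG ] (λ x → - a * (X^ 0G x * χ θ η x))
          ≈⟨ +-cong (eval-X^ g) (trans (Σ-*ˡ allG _ _) (*-congˡ (trans (eval-X^ 0G) χ-0))) ⟩
        χ θ η g + - a * 1#
          ≈⟨ +-congˡ (*-identityʳ _) ⟩
        χ θ η g + - a ∎

      eval-zero : ∀ ps → Any (λ (g , a) → χ θ η g ≈ a) ps → eval (factors ps) ≈ 0#
      eval-zero ((g , a) ∷ ps) (here χg≈a) = begin
        eval (factor g a ⋆ factors ps)            ≈⟨ eval-⋆ (factor g a) (factors ps) ⟩
        eval (factor g a) * eval (factors ps)     ≈⟨ *-congʳ (trans (eval-factor g a) (+-congʳ χg≈a)) ⟩
        (a + - a) * eval (factors ps)             ≈⟨ *-congʳ (-‿inverseʳ a) ⟩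
        0# * eval (factors ps)                    ≈⟨ zeroˡ _ ⟩
        0#                                        ∎
      eval-zero ((g , a) ∷ ps) (there any) =
        trans (eval-⋆ (factor g a) (factors ps)) (trans (*-congˡ (eval-zero ps any)) (zeroʳ _))

      -- A product in K is zero only if some factor is, but finding that factor would mean deciding
      -- equality in K; hence the double negation.
      zero-hit : ∀ ps → eval (factors ps) ≈ 0# → ¬ ¬ Any (λ (g , a) → χ θ η g ≈ a) ps
      zero-hit []             eval≈0 none = 1≉0 (trans (sym (trans (eval-X^ 0G) χ-0)) eval≈0)
      zero-hit ((g , a) ∷ ps) eval≈0 none = zero-hit ps
        (*-cancel-0 χg-a≉0 (trans (*-congʳ (sym (eval-factor g a))) (trans (sym (eval-⋆ (factor g a) (factors ps))) eval≈0)))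
        (none ∘ there)
        where
        χg-a≉0 : ¬ (χ θ η g + - a ≈ 0#)
        χg-a≉0 χg-a≈0 = none (here (begin
          χ θ η g               ≈⟨ +-identityʳ _ ⟨
          χ θ η g + 0#          ≈⟨ +-congˡ (-‿inverseˡ a) ⟨
          χ θ η g + (- a + a)   ≈⟨ +-assoc _ _ _ ⟨
          (χ θ η g + - a) + a   ≈⟨ +-congʳ χg-a≈0 ⟩
          0# + a                ≈⟨ +-identityˡ a ⟩
          a                     ∎))

      isZero⇒hit : ∀ ps → IsZero (factors ps) → ¬ ¬ Any (λ (g , a) → χ θ η g ≈ a) ps
      isZero⇒hit ps zero-product = zero-hit ps (Σ-zero allG (λ x → trans (*-congʳ (zero-product x)) (zeroˡ _)))

    Σ-powers : ∀ {m} (f : Fin m → Carrier) x → Σ[ allFin m ] (λ i → f i * x ^ toℕ i) ≈ ⟦ Vec.tabulate f ⟧ x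
    Σ-powers f x = trans (reflexive (≡.cong ΣR (Listₚ.map-tabulate id (λ i → f i * x ^ toℕ i)))) (powers f)
      where
      Σ-tabulate-*ˡ : ∀ {m} a (f : Fin m → Carrier) → ΣR (tabulate (λ i → a * f i)) ≈ a * ΣR (tabulate f)
      Σ-tabulate-*ˡ {zero}  a f = sym (zeroʳ a)
      Σ-tabulate-*ˡ {suc m} a f = trans (+-congˡ (Σ-tabulate-*ˡ a (f ∘ suc))) (sym (distribˡ a _ _))
      Σ-tabulate-cong : ∀ {m} {f h : Fin m → Carrier} → (∀ i → f i ≈ h i) → ΣR (tabulate f) ≈ ΣR (tabulate h)
      Σ-tabulate-cong {zero}  f≈h = refl
      Σ-tabulate-cong {suc m} f≈h = +-cong (f≈h zero) (Σ-tabulate-cong (f≈h ∘ suc))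
      powers : ∀ {m} (f : Fin m → Carrier) → ΣR (tabulate (λ i → f i * x ^ toℕ i)) ≈ ⟦ Vec.tabulate f ⟧ x
      powers {zero}  f = refl
      powers {suc m} f = +-cong (*-identityʳ _) (begin
        ΣR (tabulate (λ i → f (suc i) * (x * x ^ toℕ i)))
          ≈⟨ Σ-tabulate-cong {m} (λ i → trans (sym (*-assoc _ _ _)) (trans (*-congʳ (*-comm _ _)) (*-assoc _ _ _))) ⟩
        ΣR (tabulate (λ i → x * (f (suc i) * x ^ toℕ i)))
          ≈⟨ Σ-tabulate-*ˡ x (λ i → f (suc i) * x ^ toℕ i) ⟩
        x * ΣR (tabulate (λ i → f (suc i) * x ^ toℕ i))
          ≈⟨ *-congˡ (powers (f ∘ suc)) ⟩
        x * ⟦ Vec.tabulate (f ∘ suc) ⟧ x ∎)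

    -- Characters separate R[G]: vanishing at all pairs of roots is vanishing of a polynomial of
    -- degree < m₁ in the first root whose coefficients are polynomials of degree < m₂ in the second.
    characters-separate : ∀ f (θs ηs : List Carrier) →
      length θs ≡ m₁ → Distinct θs → length ηs ≡ m₂ → Distinct ηs →
      All (λ θ → All (λ η → Σ[ allG ] (λ x → f x * χ θ η x) ≈ 0#) ηs) θs → IsZero f
    characters-separate f θs ηs lenθ distinctθ lenη distinctη vanish (i , j) = begin
      f (i , j)                                     ≡⟨ Vecₚ.lookup∘tabulate (λ j → f (i , j)) j ⟨
      lookup (Vec.tabulate (λ j → f (i , j))) j     ≈⟨ coefficients≈0 (Vec.tabulate (λ j → f (i , j))) ηs lenη distinctη (All.tabulate inner) j ⟩
      0#                                            ∎
      where
      inner : ∀ {η} → η ∈ ηs → ⟦ Vec.tabulate (λ j → f (i , j)) ⟧ η ≈ 0#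
      inner {η} η∈ = trans (reflexive (≡.sym (Vecₚ.lookup∘tabulate (λ i → ⟦ Vec.tabulate (λ j → f (i , j)) ⟧ η) i)))
        (coefficients≈0 (Vec.tabulate (λ i → ⟦ Vec.tabulate (λ j → f (i , j)) ⟧ η)) θs lenθ distinctθ (All.map outer vanish) i)
        where
        outer : ∀ {θ} → All (λ η → Σ[ allG ] (λ x → f x * χ θ η x) ≈ 0#) ηs →
                ⟦ Vec.tabulate (λ i → ⟦ Vec.tabulate (λ j → f (i , j)) ⟧ η) ⟧ θ ≈ 0#
        outer {θ} vanishη = begin
          ⟦ Vec.tabulate (λ i → ⟦ Vec.tabulate (λ j → f (i , j)) ⟧ η) ⟧ θ
            ≈⟨ Σ-powers (λ i → ⟦ Vec.tabulate (λ j → f (i , j)) ⟧ η) θ ⟨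
          Σ[ allFin m₁ ] (λ i → ⟦ Vec.tabulate (λ j → f (i , j)) ⟧ η * θ ^ toℕ i)
            ≈⟨ Σ-cong (allFin m₁) (λ i → trans (*-congʳ (sym (Σ-powers (λ j → f (i , j)) η))) (sym (Σ-*ʳ (allFin m₂) _ _))) ⟩
          Σ[ allFin m₁ ] (λ i → Σ[ allFin m₂ ] (λ j → f (i , j) * η ^ toℕ j * θ ^ toℕ i))
            ≈⟨ Σ-cong (allFin m₁) (λ i → Σ-cong (allFin m₂) (λ j → trans (*-assoc _ _ _) (*-congˡ (*-comm _ _)))) ⟩
          Σ[ allFin m₁ ] (λ i → Σ[ allFin m₂ ] (λ j → f (i , j) * χ θ η (i , j)))
            ≈⟨ Σ-× (allFin m₁) (allFin m₂) _ ⟨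
          Σ[ allG ] (λ x → f x * χ θ η x)
            ≈⟨ All.lookup vanishη η∈ ⟩
          0# ∎

-- The roots of unity as n cosets of the p-th roots of unity.

module RootsOfUnity where
  open Fields
  open Lists
  open import Data.Nat as ℕ using (ℕ; zero; suc; NonZero; _≤_; _<_; _∸_)
  open import Data.Nat.Divisibility using (_∣_; _∣?_; divides; ∣⇒≤)
  open import Data.Nat.Primality using (Prime; prime⇒irreducible; prime⇒nonTrivial; prime⇒nonZero)
  open import Data.Nat.Coprimality using (Coprime; coprime-Bézout)
  open import Data.Nat.GCD using (module Bézout)
  open import Data.Fin as Fin using (Fin; zero; suc; toℕ)
  open import Data.List using (List; _∷_; length; map; lookup; allFin; tabulate)
  open import Relation.Nullary.Decidable using (map′; decidable-stable)
  open import Relation.Binary.PropositionalEquality as ≡ using (_≡_; _≢_)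

  prime∤⇒coprime : ∀ {p d} → Prime p → ¬ (p ∣ d) → Coprime p d
  prime∤⇒coprime pp p∤d (e∣p , e∣d) with prime⇒irreducible pp e∣p
  ... | inj₁ e≡1    = e≡1
  ... | inj₂ ≡.refl = contradiction e∣d p∤d

  module Roots {c ℓ : Level} (K : CommutativeRing c ℓ) (K-field : IsField K)
               (p n : ℕ) (pp : Prime p) .{{_ : NonZero n}}
               (roots : HasExactlyRootsOfUnity K (p ℕ.* n)) where
    open CommutativeRing K hiding (zero)
    open IsField K-field
    open FieldLemmas K K-field
    open import Relation.Binary.Reasoning.Setoid setoid

    private instance
      p≢0 : NonZero p
      p≢0 = prime⇒nonZero pp

    N : ℕ
    N = p ℕ.* n

    rs : List Carrier
    rs = proj₁ roots

    |rs|≡N : length rs ≡ N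
    |rs|≡N = proj₁ (proj₂ roots)

    rs-distinct : Distinct rs
    rs-distinct = proj₁ (proj₂ (proj₂ roots))

    rs-roots : All (λ r → r ^ N ≈ 1#) rs
    rs-roots = proj₁ (proj₂ (proj₂ (proj₂ roots)))

    rs-complete : ∀ {x} → x ^ N ≈ 1# → Any (x ≈_) rs
    rs-complete = proj₂ (proj₂ (proj₂ (proj₂ roots))) _

    private instance
      N≢0 : NonZero N
      N≢0 = ℕₚ.m*n≢0 p n

    N-root≉0 : ∀ {x} → x ^ N ≈ 1# → ¬ (x ≈ 0#)
    N-root≉0 = root≉0 N

    length-roots≤ : ∀ m .{{_ : NonZero m}} b xs → Distinct xs → All (λ x → x ^ m ≈ b) xs → length xs ≤ m
    length-roots≤ (suc m) = roots-bound m

    root : Fin (length rs) → Carrier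
    root = lookup rs

    root^N : ∀ i → root i ^ N ≈ 1#
    root^N i = All.lookup rs-roots (∈ₚ.∈-lookup i)

    root-injective : ∀ i j → root i ≈ root j → i ≡ j
    root-injective = lookup-injective sym rs-distinct

    index : ∀ {x} → x ^ N ≈ 1# → ∃ λ i → x ≈ root i
    index x^N≈1 = Any.index (rs-complete x^N≈1) , Anyₚ.lookup-index (rs-complete x^N≈1)


    -- Equality of K need not be decidable, but equality of roots of unity is, since they are listed.
    root-≟ : ∀ {x y} → x ^ N ≈ 1# → y ^ N ≈ 1# → Dec (x ≈ y)
    root-≟ x^N≈1 y^N≈1 with i , x≈i ← index x^N≈1 | j , y≈j ← index y^N≈1 = map′
      (λ i≡j → trans x≈i (trans (reflexive (≡.cong root i≡j)) (sym y≈j)))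
      (λ x≈y → root-injective i j (trans (sym x≈i) (trans x≈y y≈j)))
      (i Finₚ.≟ j)

    ^-root : ∀ {x} k → x ^ N ≈ 1# → (x ^ k) ^ N ≈ 1#
    ^-root {x} k x^N≈1 = begin
      (x ^ k) ^ N    ≈⟨ ^-* x k N ⟨
      x ^ (k ℕ.* N)  ≈⟨ ^-∣ x^N≈1 (divides k ≡.refl) ⟩
      1#             ∎

    *-root : ∀ {x y} m → x ^ m ≈ 1# → y ^ m ≈ 1# → (x * y) ^ m ≈ 1#
    *-root m x^m≈1 y^m≈1 = trans (*-^ _ _ m) (trans (*-cong x^m≈1 y^m≈1) (*-identityˡ 1#))

    p-root⇒N-root : ∀ {x} → x ^ p ≈ 1# → x ^ N ≈ 1#
    p-root⇒N-root x^p≈1 = ^-∣ x^p≈1 (divides n (ℕₚ.*-comm p n))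

    -- The p-th power of a root, given by its position in `rs`: two roots belong to the same plane
    -- iff their classes agree, and positions can be compared.
    class : Fin (length rs) → Fin (length rs)
    class i = proj₁ (index (^-root p (root^N i)))

    class-correct : ∀ i → root i ^ p ≈ root (class i)
    class-correct i = proj₂ (index (^-root p (root^N i)))

    open Fibers Finₚ._≟_ class using (transversal; length≤fibers)

    abstract
      planes : List (Fin (length rs))
      planes = proj₁ (transversal (allFin (length rs)))

      planes-distinct : AllPairs (λ i j → class i ≢ class j) planes
      planes-distinct = proj₁ (proj₂ (transversal (allFin (length rs))))

      planes-cover : All (λ i → Any (λ j → class i ≡ class j) planes) (allFin (length rs))
      planes-cover = proj₂ (proj₂ (transversal (allFin (length rs))))

    class-≡ : ∀ i j → root i ^ p ≈ root j ^ p → class i ≡ class j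
    class-≡ i j eq = root-injective _ _ (trans (sym (class-correct i)) (trans eq (class-correct j)))

    -- The p-th powers of the representatives are distinct n-th roots of unity.
    |planes|≤n : length planes ≤ n
    |planes|≤n = ≡.subst (_≤ n) (Listₚ.length-map _ planes) (length-roots≤ n 1# (map (λ i → root i ^ p) planes)
      (AllPairsₚ.map⁺ (AllPairs.map (λ {i} {j} i≢j eq → i≢j (class-≡ i j eq)) planes-distinct))
      (Allₚ.map⁺ (All.tabulate (λ {i} _ → trans (sym (^-* (root i) p n)) (root^N i)))))

    -- The p n roots fall into the classes, and a class has at most p members, all being roots of
    -- X^p = b for one b.
    n≤|planes| : n ≤ length planes
    n≤|planes| = ℕₚ.*-cancelʳ-≤ n (length planes) p (≡.subst (_≤ length planes ℕ.* p) n*p≡ count)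
      where
      n*p≡ : length (allFin (length rs)) ≡ n ℕ.* p
      n*p≡ = ≡.trans (Listₚ.length-tabulate (λ i → i)) (≡.trans |rs|≡N (ℕₚ.*-comm p n))
      count : length (allFin (length rs)) ≤ length planes ℕ.* p
      count = length≤fibers fiber planes _ (Uniqueₚ.allFin⁺ _) planes-cover
        where
        fiber : ∀ b zs → Unique zs → All (λ z → class z ≡ b) zs → length zs ≤ p
        fiber b zs unique same = ≡.subst (_≤ p) (Listₚ.length-map root zs) (length-roots≤ p (root b) (map root zs)
          (AllPairsₚ.map⁺ (AllPairs.map (λ i≢j eq → i≢j (root-injective _ _ eq)) unique))
          (Allₚ.map⁺ (All.map (λ {i} eq → trans (class-correct i) (reflexive (≡.cong root eq))) same)))

    |planes|≡n : length planes ≡ n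
    |planes|≡n = ℕₚ.≤-antisym |planes|≤n n≤|planes|

    rep : Fin (length rs) → Fin (length planes)
    rep i = Any.index (All.lookup planes-cover (∈ₚ.∈-allFin i))
    rep-correct : ∀ i → class i ≡ class (lookup planes (rep i))
    rep-correct i = Anyₚ.lookup-index (All.lookup planes-cover (∈ₚ.∈-allFin i))
    |planes|<N : length planes < length rs
    |planes|<N = ≡.subst₂ _<_ (≡.sym |planes|≡n) (≡.sym |rs|≡N)
      (≡.subst (n <_) (ℕₚ.*-comm n p) (ℕₚ.m<m*n n p (ℕ.nonTrivial⇒n>1 p {{prime⇒nonTrivial pp}})))

    -- There are more N-th roots of unity than p-th powers of them, so two of them have a p-th root of unity as ratio.
    abstract
      θ-exists : ∃[ θ ] (θ ^ p ≈ 1# × ¬ (θ ≈ 1#))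
      θ-exists = ratio (Finₚ.pigeonhole |planes|<N rep)
        where
        ratio : (∃₂ λ i j → i Fin.< j × rep i ≡ rep j) → ∃[ θ ] (θ ^ p ≈ 1# × ¬ (θ ≈ 1#))
        ratio (i , j , i<j , eq) = root i * u , θ^p≈1 , θ≉1
          where
          u : Carrier
          u = proj₁ (inverse (root j) (N-root≉0 (root^N j)))
          u-inverse : root j * u ≈ 1#
          u-inverse = proj₂ (inverse (root j) (N-root≉0 (root^N j)))
          powers≈ : root i ^ p ≈ root j ^ p
          powers≈ = trans (class-correct i) (trans (reflexive (≡.cong root
            (≡.trans (rep-correct i) (≡.trans (≡.cong (class ∘ lookup planes) eq) (≡.sym (rep-correct j)))))) (sym (class-correct j)))
          θ^p≈1 : (root i * u) ^ p ≈ 1#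
          θ^p≈1 = begin
            (root i * u) ^ p      ≈⟨ *-^ (root i) u p ⟩
            root i ^ p * u ^ p    ≈⟨ *-congʳ powers≈ ⟩
            root j ^ p * u ^ p    ≈⟨ *-^ (root j) u p ⟨
            (root j * u) ^ p      ≈⟨ ^-cong p u-inverse ⟩
            1# ^ p                ≈⟨ 1^ p ⟩
            1#                    ∎
          θ≉1 : ¬ (root i * u ≈ 1#)
          θ≉1 θ≈1 = Finₚ.<⇒≢ i<j (root-injective i j (begin
            root i                 ≈⟨ *-identityʳ _ ⟨
            root i * 1#            ≈⟨ *-congˡ u-inverse ⟨
            root i * (root j * u)  ≈⟨ *-congˡ (*-comm _ _) ⟩
            root i * (u * root j)  ≈⟨ *-assoc _ _ _ ⟨
            (root i * u) * root j  ≈⟨ *-congʳ θ≈1 ⟩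
            1# * root j            ≈⟨ *-identityˡ _ ⟩
            root j                 ∎))

    θ : Carrier
    θ = proj₁ θ-exists

    θ^p≈1 : θ ^ p ≈ 1#
    θ^p≈1 = proj₁ (proj₂ θ-exists)

    θ^N≈1 : θ ^ N ≈ 1#
    θ^N≈1 = p-root⇒N-root θ^p≈1

    -- Otherwise p and d are coprime, and a Bézout identity between them gives θ = 1.
    θ^-order : ∀ d → θ ^ d ≈ 1# → p ∣ d
    θ^-order d θ^d≈1 = decidable-stable (p ∣? d) λ p∤d → proj₂ (proj₂ θ-exists) (θ≈1 (coprime-Bézout (prime∤⇒coprime pp p∤d)))
      where
      multiple : ∀ {e} y → θ ^ e ≈ 1# → θ ^ (y ℕ.* e) ≈ 1#
      multiple y θ^e≈1 = ^-∣ θ^e≈1 (divides y ≡.refl)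
      from : ∀ {a b} → 1 ℕ.+ a ≡ b → θ ^ a ≈ 1# → θ ^ b ≈ 1# → θ ≈ 1#
      from {a} {b} eq θ^a≈1 θ^b≈1 = begin
        θ            ≈⟨ *-identityʳ θ ⟨
        θ * 1#       ≈⟨ *-congˡ θ^a≈1 ⟨
        θ * θ ^ a    ≡⟨ ≡.cong (θ ^_) eq ⟩
        θ ^ b        ≈⟨ θ^b≈1 ⟩
        1#           ∎
      θ≈1 : Bézout.Identity 1 p d → θ ≈ 1#
      θ≈1 (Bézout.+- x y eq) = from eq (multiple y θ^d≈1) (multiple x θ^p≈1)
      θ≈1 (Bézout.-+ x y eq) = from eq (multiple x θ^p≈1) (multiple y θ^d≈1)

    θ^-injective-≤ : ∀ {a b} → a ≤ b → θ ^ a ≈ θ ^ b → p ∣ b ∸ a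
    θ^-injective-≤ {a} {b} a≤b eq = θ^-order (b ∸ a) (*-cancelˡ (^-≉0 a (N-root≉0 θ^N≈1)) (begin
      θ ^ a * θ ^ (b ∸ a)   ≈⟨ ^-+ θ a (b ∸ a) ⟨
      θ ^ (a ℕ.+ (b ∸ a))   ≡⟨ ≡.cong (θ ^_) (ℕₚ.m+[n∸m]≡n a≤b) ⟩
      θ ^ b                 ≈⟨ eq ⟨
      θ ^ a                 ≈⟨ *-identityʳ _ ⟨
      θ ^ a * 1#            ∎))

    θ-power : Fin p → Carrier
    θ-power k = θ ^ toℕ k

    θ-power-injective : ∀ {j k} → θ-power j ≈ θ-power k → j ≡ k
    θ-power-injective {j} {k} eq = case ℕₚ.≤-total (toℕ j) (toℕ k) of λ where
        (inj₁ j≤k) → ordered j≤k eq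
        (inj₂ k≤j) → ≡.sym (ordered k≤j (sym eq))
      where
      small : ∀ {d} → p ∣ d → d < p → d ≡ 0
      small {zero}  p∣d d<p = ≡.refl
      small {suc d} p∣d d<p = contradiction (∣⇒≤ p∣d) (ℕₚ.<⇒≱ d<p)
      ordered : ∀ {j k} → toℕ j ≤ toℕ k → θ-power j ≈ θ-power k → j ≡ k
      ordered {j} {k} j≤k eq = Finₚ.toℕ-injective (ℕₚ.≤-antisym j≤k (ℕₚ.m∸n≡0⇒m≤n (small (θ^-injective-≤ j≤k eq)
        (ℕₚ.≤-<-trans (ℕₚ.m∸n≤m (toℕ k) (toℕ j)) (Finₚ.toℕ<n k)))))

    θ-powers : List Carrier
    θ-powers = tabulate θ-power

    θ-powers-distinct : Distinct θ-powers
    θ-powers-distinct = AllPairsₚ.tabulate⁺ (λ j≢k eq → j≢k (θ-power-injective eq))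

    θ-power-root : ∀ k → θ-power k ^ p ≈ 1#
    θ-power-root k = begin
      (θ ^ toℕ k) ^ p   ≈⟨ ^-* θ (toℕ k) p ⟨
      θ ^ (toℕ k ℕ.* p) ≈⟨ ^-∣ θ^p≈1 (divides (toℕ k) ≡.refl) ⟩
      1#                ∎

    -- Together with the p powers of θ, a further root would be root number p + 1 of X^p = 1.
    p-root⇒θ-power : ∀ {x} → x ^ p ≈ 1# → ∃[ k ] x ≈ θ-power k
    p-root⇒θ-power {x} x^p≈1 = decidable-stable
      (Finₚ.any? (λ k → root-≟ (p-root⇒N-root x^p≈1) (p-root⇒N-root (θ-power-root k))))
      λ none → ℕₚ.<-irrefl (Listₚ.length-tabulate θ-power)
        (length-roots≤ p 1# (x ∷ θ-powers) (Allₚ.tabulate⁺ (λ k x≈ → none (k , x≈)) ∷ θ-powers-distinct)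
          (x^p≈1 ∷ Allₚ.tabulate⁺ θ-power-root))

    ratio-power : ∀ {x r} → ¬ (r ≈ 0#) → x ^ p ≈ r ^ p → ∃[ k ] x ≈ r * θ-power k
    ratio-power {x} {r} r≉0 x^p≈r^p = k , (begin
        x                ≈⟨ *-identityʳ x ⟨
        x * 1#           ≈⟨ *-congˡ (proj₂ r-inverse) ⟨
        x * (r * u)      ≈⟨ *-assoc x r u ⟨
        (x * r) * u      ≈⟨ *-congʳ (*-comm x r) ⟩
        (r * x) * u      ≈⟨ *-assoc r x u ⟩
        r * (x * u)      ≈⟨ *-congˡ (proj₂ xu-power) ⟩
        r * θ-power k    ∎)
      where
      r-inverse : ∃[ u ] r * u ≈ 1#
      r-inverse = inverse r r≉0
      u : Carrier
      u = proj₁ r-inverse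
      xu-power : ∃[ k ] x * u ≈ θ-power k
      xu-power = p-root⇒θ-power (begin
        (x * u) ^ p       ≈⟨ *-^ x u p ⟩
        x ^ p * u ^ p     ≈⟨ *-congʳ x^p≈r^p ⟩
        r ^ p * u ^ p     ≈⟨ *-^ r u p ⟨
        (r * u) ^ p       ≈⟨ ^-cong p (proj₂ r-inverse) ⟩
        1# ^ p            ≈⟨ 1^ p ⟩
        1#                ∎)
      k : Fin p
      k = proj₁ xu-power

    ∈-plane : ∀ i → ∃ λ u → root i ^ p ≈ root (lookup planes u) ^ p
    ∈-plane i = rep i , (begin
      root i ^ p                            ≈⟨ class-correct i ⟩
      root (class i)                        ≡⟨ ≡.cong root (rep-correct i) ⟩
      root (class (lookup planes (rep i)))  ≈⟨ class-correct (lookup planes (rep i)) ⟨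
      root (lookup planes (rep i)) ^ p      ∎)

    -- The representative serves as origin of the plane `u`, and `k` becomes an affine coordinate in
    -- it.
    plane : ∀ {x} → x ^ N ≈ 1# → ∃₂ λ u k → x ≈ root (lookup planes u) * θ-power k
    plane x^N≈1 =
      let i , x≈i  = index x^N≈1
          u , eq   = ∈-plane i
          k , i≈rθ = ratio-power (N-root≉0 (root^N (lookup planes u))) eq
      in u , k , trans x≈i i≈rθ

-- The affine planes over F_2 and F_3.

module ParallelClassesOfLines where
  open import Data.Nat as ℕ using (ℕ; zero; suc; _+_; _*_; NonZero)
  open import Data.Nat.DivMod using (_mod_; _%_)
  open import Data.Fin using (Fin; zero; suc; toℕ)
  open import Data.List using (List; length; filter; allFin; cartesianProduct)
  open import Relation.Nullary.Decidable using (toWitness; _→-dec_)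
  open import Relation.Binary.PropositionalEquality using (_≡_)

  module Lines (p : ℕ) .{{_ : NonZero p}} where

    Point : Set
    Point = Fin p × Fin p

    points : List Point
    points = cartesianProduct (allFin p) (allFin p)

    _·_ : ℕ × ℕ → Point → ℕ
    (x , y) · (j , k) = (toℕ j * x + toℕ k * y) % p

    -- The level sets of the p + 1 forms are the p + 1 parallel classes of lines of the plane.
    form : Fin (suc p) → Point → Fin p
    form zero    (j , k) = j
    form (suc i) (j , k) = (toℕ i * toℕ j + toℕ k) mod p

    -- The level sets of P ↦ v · P are unions of lines of class `c`. The zero vector is allowed; it
    -- factors through every form.
    FactorsThrough : Fin (suc p) → ℕ × ℕ → Set
    FactorsThrough c v = ∀ j k j′ k′ → form c (j , k) ≡ form c (j′ , k′) → v · (j , k) ≡ v · (j′ , k′)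

    -- All that the covering argument uses about the plane, isolated so that for p = 2 and p = 3 it
    -- can be verified by enumeration.
    record ParallelClasses : Set where
      field
        origin         : Point
        direction      : ∀ x y → ∃ λ c → FactorsThrough c (toℕ {p} x , toℕ {p} y)
        through-origin : ∀ j k → ∃ λ c → form c (j , k) ≡ form c origin
        point-on       : ∀ c v → ∃₂ λ j k → form c (j , k) ≡ v
        line-length    : ∀ c v → length (filter (λ P → form c P Finₚ.≟ v) points) ≡ p

    all² : ∀ {ℓ} {A : Fin p → Fin p → Set ℓ} → (∀ j k → Dec (A j k)) → Dec (∀ j k → A j k)
    all² A? = Finₚ.all? (λ j → Finₚ.all? (λ k → A? j k))

    direction? : Dec (∀ x y → ∃ λ c → FactorsThrough c (toℕ {p} x , toℕ {p} y))
    direction? = all² λ x y → Finₚ.any? λ c → all² λ j k → all² λ j′ k′ →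
      (form c (j , k) Finₚ.≟ form c (j′ , k′)) →-dec (((toℕ x , toℕ y) · (j , k)) ℕ.≟ ((toℕ x , toℕ y) · (j′ , k′)))

    through-origin? : ∀ o → Dec (∀ j k → ∃ λ c → form c (j , k) ≡ form c o)
    through-origin? o = all² λ j k → Finₚ.any? λ c → form c (j , k) Finₚ.≟ form c o

    point-on? : Dec (∀ c v → ∃₂ λ j k → form c (j , k) ≡ v)
    point-on? = Finₚ.all? λ c → Finₚ.all? λ v → Finₚ.any? λ j → Finₚ.any? λ k → form c (j , k) Finₚ.≟ v

    line-length? : Dec (∀ c v → length (filter (λ P → form c P Finₚ.≟ v) points) ≡ p)
    line-length? = Finₚ.all? λ c → Finₚ.all? λ v → length (filter (λ P → form c P Finₚ.≟ v) points) ℕ.≟ p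

  parallelClasses₂ : Lines.ParallelClasses 2
  parallelClasses₂ = record
    { origin         = zero , zero
    ; direction      = toWitness {a? = direction?} _
    ; through-origin = toWitness {a? = through-origin? (zero , zero)} _
    ; point-on       = toWitness {a? = point-on?} _
    ; line-length    = toWitness {a? = line-length?} _
    }
    where open Lines 2

  parallelClasses₃ : Lines.ParallelClasses 3
  parallelClasses₃ = record
    { origin         = zero , zero
    ; direction      = toWitness {a? = direction?} _
    ; through-origin = toWitness {a? = through-origin? (zero , zero)} _
    ; point-on       = toWitness {a? = point-on?} _
    ; line-length    = toWitness {a? = line-length?} _
    }
    where open Lines 3

-- Long sequences are not good when p ≤ 3.

module CoveringPlanes where
  open Fields
  open Groups
  open Lists
  open ParallelClassesOfLines
  open GroupAlgebras
  open RootsOfUnity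
  open import Data.Nat as ℕ using (ℕ; zero; suc; NonZero; _≤_; _<_; _∸_; s≤s; z≤n)
  open import Data.Nat.DivMod using (_mod_; _%_; %-distribˡ-+; %-distribˡ-*; m%n%n≡m%n)
  open import Data.Nat.Primality using (Prime)
  open import Data.Nat.ListAction using (sum)
  open import Data.Fin using (Fin; zero; suc; toℕ)
  open import Data.List using (List; []; _∷_; _++_; length; map; lookup; allFin; tabulate; concat; take; drop; filter)
  open import Data.List.Relation.Binary.Permutation.Propositional using (_↭_; ↭-refl; ↭-sym; ↭-trans; ↭-reflexive)
  open import Relation.Binary.PropositionalEquality as ≡ using (_≡_; _≢_)

  module FewClasses {A : Set} (p : ℕ) (f : A → Fin (suc p)) where
    open Fibers Finₚ._≟_ f using (fiber; pigeonhole)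

    over-all : ∀ xs → All (λ x → f x ∈ allFin (suc p)) xs
    over-all xs = All.tabulate (λ _ → ∈ₚ.∈-allFin _)

    -- There are at least 2p - 1 elements in p + 1 directions: at least 3 elements when one
    -- suffices, and at least 5 in 4 directions when two are wanted.
    fiber-p∸1 : p ≡ 2 ⊎ p ≡ 3 → ∀ xs → p ℕ.+ p ≤ suc (length xs) → ∃ λ c → p ∸ 1 ≤ length (fiber c xs)
    fiber-p∸1 (inj₁ ≡.refl) xs len = pigeonhole (λ _ → 0) (allFin 3) xs (over-all xs) (ℕₚ.≤-trans (s≤s z≤n) (ℕₚ.≤-pred len))
    fiber-p∸1 (inj₂ ≡.refl) xs len = pigeonhole (λ _ → 1) (allFin 4) xs (over-all xs) (ℕₚ.≤-pred len)

    -- Quotas for p = 3 when direction `c` occurs at most once. They add up to 7, so with eight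
    -- elements some quota is exceeded, and it cannot be that of `c`.
    weight : Fin (suc p) → Fin (suc p) → ℕ
    weight c b with b Finₚ.≟ c
    ... | yes _ = 1
    ... | no  _ = 2

    -- For p = 3 and eight vectors no three of which are parallel, every parallel class is hit exactly twice.
    fiber-p : p ≡ 2 ⊎ p ≡ 3 → ∀ m xs → p ℕ.* (2 ℕ.+ m) ℕ.+ p ≤ suc (length xs) →
              (∃ λ c → p ≤ length (fiber c xs)) ⊎ (m ≡ 0 × (∀ c → 2 ≤ length (fiber c xs)))
    fiber-p (inj₁ ≡.refl) m xs len = inj₁ (pigeonhole (λ _ → 1) (allFin 3) xs (over-all xs)
      (ℕₚ.≤-trans (ℕₚ.m≤n+m 4 1) (ℕₚ.≤-pred (ℕₚ.≤-trans (ℕₚ.+-monoˡ-≤ 2 (ℕₚ.*-monoʳ-≤ 2 (ℕₚ.m≤m+n 2 m))) len))))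
    fiber-p (inj₂ ≡.refl) m xs len with 8 ℕₚ.<? length xs
    ... | yes 8< = inj₁ (pigeonhole (λ _ → 2) (allFin 4) xs (over-all xs) 8<)
    fiber-p (inj₂ ≡.refl) (suc m) xs len | no 8≮ = contradiction
      (ℕₚ.≤-trans (ℕₚ.m≤n+m 9 2) (ℕₚ.≤-pred (ℕₚ.≤-trans (ℕₚ.+-monoˡ-≤ 3 (ℕₚ.*-monoʳ-≤ 3 (ℕₚ.m≤m+n 3 m))) len))) 8≮
    fiber-p (inj₂ ≡.refl) zero xs len | no 8≮ with Finₚ.all? (λ c → 2 ℕₚ.≤? length (fiber c xs))
    ... | yes all≥2 = inj₂ (≡.refl , all≥2)
    ... | no ¬all≥2 = inj₁ (deficient (Finₚ.¬∀⟶∃¬ 4 _ (λ c → 2 ℕₚ.≤? length (fiber c xs)) ¬all≥2))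
      where
      total : ∀ c → sum (map (weight c) (allFin 4)) ≤ 7
      total zero                   = ℕₚ.≤-refl
      total (suc zero)             = ℕₚ.≤-refl
      total (suc (suc zero))       = ℕₚ.≤-refl
      total (suc (suc (suc zero))) = ℕₚ.≤-refl
      heavy : ∀ c b → weight c b < length (fiber b xs) → ¬ (2 ≤ length (fiber c xs)) → 3 ≤ length (fiber b xs)
      heavy c b w<fiber c<2 with b Finₚ.≟ c
      ... | yes ≡.refl = contradiction w<fiber c<2
      ... | no  _      = w<fiber
      deficient : (∃ λ c → ¬ (2 ≤ length (fiber c xs))) → ∃ λ c → 3 ≤ length (fiber c xs)
      deficient (c , c<2) =
        let b , w<fiber = pigeonhole (weight c) (allFin 4) xs (over-all xs) (ℕₚ.≤-trans (s≤s (total c)) (ℕₚ.≤-pred len))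
        in b , heavy c b w<fiber c<2

  module Covering {c ℓ : Level} (K : CommutativeRing c ℓ) (K-field : IsField K)
                  (p n : ℕ) (pp : Prime p) .{{p≢0 : NonZero p}} .{{n≢0 : NonZero n}} .{{N≢0 : NonZero (p ℕ.* n)}}
                  (roots : HasExactlyRootsOfUnity K (p ℕ.* n))
                  (small : p ≡ 2 ⊎ p ≡ 3) (classes : Lines.ParallelClasses p) where
    open Grp p (p ℕ.* n)
    open Grp.GroupAlgebra p (p ℕ.* n) K
    open CommutativeRing K hiding (zero)
    open IsField K-field
    open FieldLemmas K K-field
    open Characters K K-field p (p ℕ.* n)
    open Roots K K-field p n pp roots using (N; rs; |rs|≡N; rs-distinct; rs-roots; root; root^N; planes; |planes|≡n; θ; θ^p≈1;
      θ^N≈1; θ-power; θ-powers; θ-powers-distinct; θ-power-root; p-root⇒N-root; *-root; plane)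
    open Lines p
    open ParallelClasses classes
    open import Relation.Binary.Reasoning.Setoid setoid

    Plane : Set
    Plane = Fin (length planes)

    η : Plane → Fin p → Carrier
    η u k = root (lookup planes u) * θ-power k

    η-root : ∀ u k → η u k ^ N ≈ 1#
    η-root u k = *-root N (root^N (lookup planes u)) (p-root⇒N-root (θ-power-root k))

    value : Plane → Point → G → Carrier
    value u (j , k) = χ (θ-power j) (η u k)

    value≉0 : ∀ u P g → ¬ (value u P g ≈ 0#)
    value≉0 u (j , k) = χ≉0 (θ-power-root j) (η-root u k)

    vector : G → ℕ × ℕ
    vector (x , y) = toℕ x , toℕ y

    θ^-% : ∀ a → θ ^ (a % p) ≈ θ ^ a
    θ^-% a = trans (reflexive (≡.cong (θ ^_) (≡.sym (toℕ-mod a p)))) (^-mod p θ^p≈1 a)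

    -- Inside one plane the value depends on the point only through the exponent of θ, a linear form
    -- in its coordinates; this is why scalars cut out lines.
    value-formula : ∀ u P g → value u P g ≈ root (lookup planes u) ^ toℕ (proj₂ g) * θ ^ (vector g · P)
    value-formula u (j , k) (x , y) = begin
      (θ ^ toℕ j) ^ toℕ x * (r * θ ^ toℕ k) ^ toℕ y
        ≈⟨ *-cong (^-* θ (toℕ j) (toℕ x)) (trans (*-congˡ (^-* θ (toℕ k) (toℕ y))) (sym (*-^ r (θ ^ toℕ k) (toℕ y)))) ⟨
      θ ^ (toℕ j ℕ.* toℕ x) * (r ^ toℕ y * θ ^ (toℕ k ℕ.* toℕ y))
        ≈⟨ x∙yz≈y∙xz _ _ _ ⟩
      r ^ toℕ y * (θ ^ (toℕ j ℕ.* toℕ x) * θ ^ (toℕ k ℕ.* toℕ y))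
        ≈⟨ *-congˡ (sym (^-+ θ (toℕ j ℕ.* toℕ x) (toℕ k ℕ.* toℕ y))) ⟩
      r ^ toℕ y * θ ^ (toℕ j ℕ.* toℕ x ℕ.+ toℕ k ℕ.* toℕ y)
        ≈⟨ *-congˡ (θ^-% _) ⟨
      r ^ toℕ y * θ ^ (vector (x , y) · (j , k)) ∎
      where
      r = root (lookup planes u)
      open import Algebra.Properties.CommutativeSemigroup *-commutativeSemigroup using (x∙yz≈y∙xz)

    -- `direction` speaks of residues modulo p, while the second coordinate of `g` lives modulo p n;
    -- the form is unchanged when that coordinate is reduced.
    class-of : ∀ g → ∃ λ c → FactorsThrough c (vector g)
    class-of (x , y) with c , through ← direction x (toℕ y mod p) = c , λ j k j′ k′ same →
      ≡.trans (reduce j k) (≡.trans (through j k j′ k′ same) (≡.sym (reduce j′ k′)))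
      where
      reduce : ∀ j k → (toℕ j ℕ.* toℕ x ℕ.+ toℕ k ℕ.* toℕ y) % p ≡ (toℕ j ℕ.* toℕ x ℕ.+ toℕ k ℕ.* toℕ (toℕ y mod p)) % p
      reduce j k = ≡R.begin
        (a ℕ.+ toℕ k ℕ.* toℕ y) % p                        ≡R.≡⟨ %-distribˡ-+ a _ p ⟩
        (a % p ℕ.+ (toℕ k ℕ.* toℕ y) % p) % p              ≡R.≡⟨ ≡.cong (λ b → (a % p ℕ.+ b) % p) reduce-* ⟩
        (a % p ℕ.+ (toℕ k ℕ.* toℕ (toℕ y mod p)) % p) % p  ≡R.≡⟨ %-distribˡ-+ a _ p ⟨
        (a ℕ.+ toℕ k ℕ.* toℕ (toℕ y mod p)) % p            ≡R.∎
        where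
        module ≡R = ≡.≡-Reasoning
        a = toℕ j ℕ.* toℕ x
        reduce-* : (toℕ k ℕ.* toℕ y) % p ≡ (toℕ k ℕ.* toℕ (toℕ y mod p)) % p
        reduce-* = ≡R.begin
          (toℕ k ℕ.* toℕ y) % p                       ≡R.≡⟨ %-distribˡ-* (toℕ k) (toℕ y) p ⟩
          (toℕ k % p ℕ.* (toℕ y % p)) % p             ≡R.≡⟨ ≡.cong (λ b → (toℕ k % p ℕ.* b) % p) (m%n%n≡m%n (toℕ y) p) ⟨
          (toℕ k % p ℕ.* (toℕ y % p % p)) % p         ≡R.≡⟨ %-distribˡ-* (toℕ k) (toℕ y % p) p ⟨
          (toℕ k ℕ.* (toℕ y % p)) % p                 ≡R.≡⟨ ≡.cong (λ b → (toℕ k ℕ.* b) % p) (toℕ-mod (toℕ y) p) ⟨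
          (toℕ k ℕ.* toℕ (toℕ y mod p)) % p           ≡R.∎

    class : G → Fin (suc p)
    class g = proj₁ (class-of g)

    value-constant : ∀ {c} u P Q g → class g ≡ c → form c P ≡ form c Q → value u P g ≈ value u Q g
    value-constant u P@(j , k) Q@(j′ , k′) g ≡.refl same = begin
      value u P g                                                  ≈⟨ value-formula u P g ⟩
      root (lookup planes u) ^ toℕ (proj₂ g) * θ ^ (vector g · P)  ≡⟨ ≡.cong (λ e → _ * θ ^ e) (proj₂ (class-of g) j k j′ k′ same) ⟩
      root (lookup planes u) ^ toℕ (proj₂ g) * θ ^ (vector g · Q)  ≈⟨ value-formula u Q g ⟨
      value u Q g                                                  ∎

    Covers : Plane → List (G × Carrier) → Set (c ⊔ ℓ)
    Covers u zs = ∀ P → Any (λ (g , a) → value u P g ≈ a) zs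

    -- Demanded for every plane at once, so that blocks can be split off before it is settled which
    -- plane each of them covers.
    Coverable : List G → Set (c ⊔ ℓ)
    Coverable T = ∀ u → ∃[ zs ] (map proj₁ zs ≡ T × NonZeros zs × Covers u zs)

    -- Each element receives its own value at the next target point, so that its level set passes
    -- through that point. Once the targets are exhausted, 1 stands for an arbitrary nonzero scalar.
    assign : Plane → List Point → List G → List (G × Carrier)
    assign u ts       []      = []
    assign u []       (g ∷ T) = (g , 1#) ∷ assign u [] T
    assign u (t ∷ ts) (g ∷ T) = (g , value u t g) ∷ assign u ts T

    assign-elements : ∀ u ts T → map proj₁ (assign u ts T) ≡ T
    assign-elements u ts       []      = ≡.refl
    assign-elements u []       (g ∷ T) = ≡.cong (g ∷_) (assign-elements u [] T)
    assign-elements u (t ∷ ts) (g ∷ T) = ≡.cong (g ∷_) (assign-elements u ts T)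

    assign-nonzero : ∀ u ts T → NonZeros (assign u ts T)
    assign-nonzero u ts       []      = []
    assign-nonzero u []       (g ∷ T) = 1≉0 ∷ assign-nonzero u [] T
    assign-nonzero u (t ∷ ts) (g ∷ T) = value≉0 u t g ∷ assign-nonzero u ts T

    assign-covers : ∀ {q} {Q : G → Set q} u {t ts T} → t ∈ ts → length ts ≤ length T → All Q T →
                    Any (λ (g , a) → Q g × a ≡ value u t g) (assign u ts T)
    assign-covers u {T = g ∷ T} (here ≡.refl) len        (Qg ∷ QT) = here (Qg , ≡.refl)
    assign-covers u {T = g ∷ T} (there t∈)    (s≤s len)  (Qg ∷ QT) = there (assign-covers u t∈ len QT)

    open Fibers Finₚ._≟_ class using (fiber; extract; two-transversals)
    open FewClasses p class

    point : Fin (suc p) → Fin p → Point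
    point c v = proj₁ (point-on c v) , proj₁ (proj₂ (point-on c v))

    form-point : ∀ c v → form c (point c v) ≡ v
    form-point c v = proj₂ (proj₂ (point-on c v))

    parallel-hit : ∀ u {c} vs T → length vs ≤ length T → All (λ g → class g ≡ c) T → ∀ P → form c P ∈ vs →
                   Any (λ (g , a) → value u P g ≈ a) (assign u (map (point c) vs) T)
    parallel-hit u {c} vs T len T∥c P v∈ =
      Any.map hit (assign-covers u (∈ₚ.∈-map⁺ (point c) v∈) (≡.subst (_≤ length T) (≡.sym (Listₚ.length-map (point c) vs)) len) T∥c)
      where
      Q : Point
      Q = point c (form c P)
      hit : ∀ {z : G × Carrier} → class (proj₁ z) ≡ c × proj₂ z ≡ value u Q (proj₁ z) → value u P (proj₁ z) ≈ proj₂ z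
      hit {g , a} (g∥c , a≡) = trans (value-constant u P Q g g∥c (≡.sym (form-point c (form c P)))) (reflexive (≡.sym a≡))

    parallel-coverable : ∀ {c} T → length T ≡ p → All (λ g → class g ≡ c) T → Coverable T
    parallel-coverable T len T∥c u = _ , assign-elements u _ T , assign-nonzero u _ T , λ P →
      parallel-hit u (allFin p) T (ℕₚ.≤-reflexive (≡.trans (Listₚ.length-tabulate (λ i → i)) (≡.sym len))) T∥c P (∈ₚ.∈-allFin _)

    -- All parallel lines but one are covered by T; the p points left are covered one by one, in any direction.
    almost-parallel-coverable : ∀ {c} T T′ → length T ≡ p ∸ 1 → All (λ g → class g ≡ c) T → length T′ ≡ p → Coverable (T ++ T′)
    almost-parallel-coverable {c} T T′ len T∥c len′ u =
      zs ++ zs′ ,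
      ≡.trans (Listₚ.map-++ proj₁ zs zs′) (≡.cong₂ _++_ (assign-elements u _ T) (assign-elements u left-points T′)) ,
      Allₚ.++⁺ (assign-nonzero u _ T) (assign-nonzero u left-points T′) ,
      λ P → case form c P Finₚ.≟ proj₁ (split p) of λ where
        (yes left) → Anyₚ.++⁺ʳ zs (Any.map (λ { (_ , ≡.refl) → refl })
          (assign-covers {Q = λ g → g ≡ g} u (∈ₚ.∈-filter⁺ _ (∈ₚ.∈-cartesianProduct⁺ (∈ₚ.∈-allFin _) (∈ₚ.∈-allFin _)) left)
            (ℕₚ.≤-reflexive (≡.trans (line-length c _) (≡.sym len′))) (All.tabulate (λ _ → ≡.refl))))
        (no ¬left) → Anyₚ.++⁺ˡ (parallel-hit u others T (ℕₚ.≤-reflexive (≡.trans (proj₁ (proj₂ (proj₂ (split p)))) (≡.sym len))) T∥c P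
          (proj₂ (proj₂ (proj₂ (split p))) (form c P) ¬left))
      where
      split : ∀ p .{{_ : NonZero p}} → ∃[ v ] ∃[ vs ] (length vs ≡ p ∸ 1 × (∀ (w : Fin p) → w ≢ v → w ∈ vs))
      split (suc q) = zero , tabulate suc , Listₚ.length-tabulate suc , λ where
        zero    w≢0 → contradiction ≡.refl w≢0
        (suc w) w≢0 → ∈ₚ.∈-tabulate⁺ w
      others = proj₁ (proj₂ (split p))
      left-points = filter (λ P → form c P Finₚ.≟ proj₁ (split p)) points
      zs = assign u (map (point c) others) T
      zs′ = assign u left-points T′

    -- Lines of all directions through a common point.
    star-coverable : ∀ T → (∀ c → Any (λ g → class g ≡ c) T) → Coverable T
    star-coverable T all-classes u = map (λ g → g , value u origin g) T ,
      ≡.trans (≡.sym (Listₚ.map-∘ T)) (Listₚ.map-id T) ,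
      Allₚ.map⁺ (All.tabulate (λ {g} _ → value≉0 u origin g)) ,
      λ (j , k) → let c , same = through-origin j k in
        Anyₚ.map⁺ (Any.map (λ {g} g∥c → value-constant u (j , k) origin g g∥c same) (all-classes c))

    drop-block : ∀ {B R S : List G} m → S ↭ B ++ R → length B ≡ p → p ℕ.* suc m ℕ.+ p ≤ suc (length S) →
                 p ℕ.* m ℕ.+ p ≤ suc (length R)
    drop-block {B} {R} {S} m S↭ len le = ℕₚ.+-cancelˡ-≤ p _ _ (≡.subst₂ _≤_ lhs rhs le)
      where
      lhs : p ℕ.* suc m ℕ.+ p ≡ p ℕ.+ (p ℕ.* m ℕ.+ p)
      lhs = ≡.trans (≡.cong (ℕ._+ p) (ℕₚ.*-suc p m)) (ℕₚ.+-assoc p _ p)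
      rhs : suc (length S) ≡ p ℕ.+ suc (length R)
      rhs = ≡.trans (≡.cong suc (≡.trans (↭ₚ.↭-length S↭) (≡.trans (Listₚ.length-++ B) (≡.cong (ℕ._+ length R) len)))) (≡.sym (ℕₚ.+-suc p _))

    Blocks : ℕ → List G → Set (c ⊔ ℓ)
    Blocks m S = ∃₂ λ Bs R → length Bs ≡ m × All Coverable Bs × S ↭ concat Bs ++ R

    ∷-block : ∀ {m B R S} → Coverable B → S ↭ B ++ R → Blocks m R → Blocks (suc m) S
    ∷-block {B = B} coverable S↭ (Bs , R , len , all-coverable , R↭) = B ∷ Bs , R , ≡.cong suc len , coverable ∷ all-coverable ,
      ↭-trans S↭ (↭-trans (↭ₚ.++⁺ˡ B R↭) (↭-reflexive (≡.sym (Listₚ.++-assoc B (concat Bs) R))))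

    extend : ∀ m S → p ℕ.* suc (suc m) ℕ.+ p ≤ suc (length S) →
             (∀ R → p ℕ.* suc m ℕ.+ p ≤ suc (length R) → Blocks (suc m) R) →
             (∃ λ c → p ≤ length (fiber c S)) ⊎ (m ≡ 0 × (∀ c → 2 ≤ length (fiber c S))) → Blocks (suc (suc m)) S
    extend m S len blocks (inj₁ (c , p≤)) =
      let B , R , S↭ , |B| , B∥c = extract c p S p≤
      in ∷-block (parallel-coverable B |B| B∥c) S↭ (blocks R (drop-block {B} (suc m) S↭ |B| len))
    -- Exactly two planes remain here, and the two stars serve one each, so the recursion ends.
    extend m S len blocks (inj₂ (≡.refl , all≥2)) =
      let T , T′ , R , S↭ , T-star , T′-star = two-transversals (allFin (suc p)) S (Uniqueₚ.allFin⁺ (suc p)) (λ {b} _ → all≥2 b)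
      in T ∷ T′ ∷ [] , R , ≡.refl ,
         star-coverable T (λ c → T-star (∈ₚ.∈-allFin c)) ∷ star-coverable T′ (λ c → T′-star (∈ₚ.∈-allFin c)) ∷ [] ,
         ↭-trans S↭ (↭-reflexive (≡.trans (≡.sym (Listₚ.++-assoc T T′ R)) (≡.cong (λ T″ → (T ++ T″) ++ R) (≡.sym (Listₚ.++-identityʳ T′)))))

    -- With m planes to go there are at least p m + p - 1 elements. A block of p parallel elements
    -- lowers m by one and preserves this invariant; the surplus p - 1 is kept for the end.
    blocks : ∀ m S → p ℕ.* m ℕ.+ p ≤ suc (length S) → Blocks m S
    blocks zero    S len = [] , S , ≡.refl , [] , ↭-refl
    -- For the last plane 2p - 1 elements are at hand: p - 1 parallel ones, then p more in whatever
    -- directions.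
    blocks (suc zero) S len =
      let c , p∸1≤ = fiber-p∸1 small S (≡.subst (λ q → q ℕ.+ p ≤ suc (length S)) (ℕₚ.*-identityʳ p) len)
          T , R , S↭ , |T| , T∥c = extract c (p ∸ 1) S p∸1≤
          p≤R = rest-large T R S↭ |T|
      in (T ++ take p R) ∷ [] , drop p R , ≡.refl ,
         almost-parallel-coverable T (take p R) |T| T∥c (≡.trans (Listₚ.length-take p R) (ℕₚ.m≤n⇒m⊓n≡m p≤R)) ∷ [] ,
         ↭-trans S↭ (↭-reflexive (≡.trans (≡.cong (T ++_) (≡.sym (Listₚ.take++drop≡id p R)))
           (≡.trans (≡.sym (Listₚ.++-assoc T (take p R) (drop p R))) (≡.cong (_++ drop p R) (≡.sym (Listₚ.++-identityʳ (T ++ take p R)))))))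
      where
      rest-large : ∀ T R → S ↭ T ++ R → length T ≡ p ∸ 1 → p ≤ length R
      rest-large T R S↭ |T| = ℕₚ.+-cancelˡ-≤ p _ _ (ℕₚ.≤-trans (≡.subst (λ q → q ℕ.+ p ≤ suc (length S)) (ℕₚ.*-identityʳ p) len)
        (ℕₚ.≤-reflexive (≡.trans (≡.cong suc (≡.trans (↭ₚ.↭-length S↭) (Listₚ.length-++ T)))
          (≡.cong (ℕ._+ length R) (≡.trans (≡.cong suc |T|) (ℕₚ.suc-pred p))))))
    blocks (suc (suc m)) S len = extend m S len (blocks (suc m)) (fiber-p small m S len)

    cover-planes : ∀ us Bs → length us ≡ length Bs → All Coverable Bs →
                   ∃[ zs ] (map proj₁ zs ≡ concat Bs × NonZeros zs × All (λ u → Covers u zs) us)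
    cover-planes []       []       len []                        = [] , ≡.refl , [] , []
    cover-planes (u ∷ us) (B ∷ Bs) len (coverable ∷ all-coverable) =
      let zs , elements , nonzero , covers = coverable u
          zs′ , elements′ , nonzero′ , covers′ = cover-planes us Bs (ℕₚ.suc-injective len) all-coverable
      in zs ++ zs′ , ≡.trans (Listₚ.map-++ proj₁ zs zs′) (≡.cong₂ _++_ elements elements′) , Allₚ.++⁺ nonzero nonzero′ ,
         (λ P → Anyₚ.++⁺ˡ (covers P)) ∷ All.map (λ covers-u P → Anyₚ.++⁺ʳ zs (covers-u P)) covers′

    long⇒¬good : ∀ S → p ℕ.* n ℕ.+ p ≤ suc (length S) → ¬ Good S
    long⇒¬good S len good =
      let Bs , R , |Bs| , coverable , S↭ = blocks n S len
          zs , elements , nonzero , covers = cover-planes (allFin (length planes)) Bs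
            (≡.trans (Listₚ.length-tabulate (λ i → i)) (≡.trans |planes|≡n (≡.sym |Bs|))) coverable
          -- Elements outside all blocks may take any nonzero scalar.
          zs′ = zs ++ map (λ g → g , 1#) R
          elements′ = ≡.trans (Listₚ.map-++ proj₁ zs (map (λ g → g , 1#) R))
            (≡.cong₂ _++_ elements (≡.trans (≡.sym (Listₚ.map-∘ R)) (Listₚ.map-id R)))
          -- The blocks rearranged the sequence; the scalars are carried back along the permutation
          -- to the order of `S`.
          ps , S≡ , zs↭ps = ↭ₚ.↭-map-inv proj₁ {zs′} (↭-trans (↭-reflexive elements′) (↭-sym S↭))
      in good⇒nonvanishing good ps (≡.sym S≡)
           (↭ₚ.All-resp-↭ zs↭ps (Allₚ.++⁺ nonzero (Allₚ.map⁺ (All.tabulate (λ _ → 1≉0)))))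
           (vanish ps (λ u P → ↭ₚ.Any-resp-↭ zs↭ps (Anyₚ.++⁺ˡ (All.lookup covers (∈ₚ.∈-allFin u) P))))
      where
      hit : ∀ {u j k r} → r ≈ η u k → ∀ (z : G × Carrier) → value u (j , k) (proj₁ z) ≈ proj₂ z → χ (θ-power j) r (proj₁ z) ≈ proj₂ z
      hit {u} {j} {k} {r} r≈η (g , a) = trans (*-congˡ {θ-power j ^ toℕ (proj₁ g)} (^-cong {r} {η u k} (toℕ (proj₂ g)) r≈η))
      vanish : ∀ ps → (∀ u → Covers u ps) → IsZero (factors ps)
      vanish ps covers = characters-separate (factors ps) θ-powers rs (Listₚ.length-tabulate θ-power) θ-powers-distinct |rs|≡N rs-distinct
        (Allₚ.tabulate⁺ {f = θ-power} λ j → All.map (λ {r} r^N≈1 → let u , k , r≈η = plane r^N≈1 in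
          eval-zero (θ-power-root j) r^N≈1 ps (Any.map (λ {z} → hit {u} {j} {k} {r} r≈η z) (covers u (j , k)))) rs-roots)

-- Olson's theorem for elementary abelian p-groups, by finite differences.

module OlsonTheorem where
  open import Data.Nat as ℕ using (ℕ; zero; suc; NonZero; _≤_; _<_; _∸_; s≤s)
  open import Data.Nat.DivMod using (_%_; _/_; m≡m%n+[m/n]*n; m%n<n)
  open import Data.Nat.Primality using (Prime; prime⇒nonZero; prime⇒nonTrivial; euclidsLemma)
  open import Data.Integer using (ℤ; +_; 0ℤ; 1ℤ; _+_; _*_; _-_; -_; ∣_∣)
  open import Data.Integer.Divisibility.Signed using (_∣_; divides; ∣m∣n⇒∣m+n; ∣m∣n⇒∣m-n; ∣n⇒∣m*n; ∣m⇒∣m*n; ∣ᵤ⇒∣; ∣⇒∣ᵤ)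
  open import Data.Integer.Tactic.RingSolver using (solve-∀)
  open import Data.Fin using (Fin; zero; suc; toℕ; fromℕ<)
  open import Data.Vec using (Vec; []; _∷_; zipWith; replicate; lookup)
  open import Data.List using (List; []; _∷_; length; map; allFin; cartesianProduct)
  open import Data.List.Relation.Binary.Sublist.Propositional using (_⊆_; []; _∷_; _∷ʳ_)
  open import Relation.Binary.PropositionalEquality

  -- Olson's theorem for C_p^r: the indicator function of pℤ^r is, up to a unit modulo p, a product of
  -- r (p - 1) affine forms, so r (p - 1) + 1 differences annihilate it, whereas at 0 they
  -- give an alternating sum over all subsequences to which only the zero-sum ones contribute.
  module Olson (p : ℕ) (pp : Prime p) (r : ℕ) where

    V : Set
    V = Vec ℕ r

    infixl 6 _⊹_
    _⊹_ : V → V → V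
    _⊹_ = zipWith ℕ._+_

    0ᵥ : V
    0ᵥ = replicate r 0

    ⊹-comm : ∀ x y → x ⊹ y ≡ y ⊹ x
    ⊹-comm = Vecₚ.zipWith-comm ℕₚ.+-comm

    ⊹-assoc : ∀ x y z → (x ⊹ y) ⊹ z ≡ x ⊹ (y ⊹ z)
    ⊹-assoc = Vecₚ.zipWith-assoc ℕₚ.+-assoc

    ⊹-identityʳ : ∀ x → x ⊹ 0ᵥ ≡ x
    ⊹-identityʳ = Vecₚ.zipWith-identityʳ ℕₚ.+-identityʳ

    ⊹-identityˡ : ∀ x → 0ᵥ ⊹ x ≡ x
    ⊹-identityˡ = Vecₚ.zipWith-identityˡ ℕₚ.+-identityˡ

    Δ : V → (V → ℤ) → V → ℤ
    Δ g f x = f x - f (x ⊹ g)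

    -- Polynomial functions of degree < d modulo p, by repeated differences.
    Degree< : ℕ → (V → ℤ) → Set
    Degree< zero    f = ∀ x → + p ∣ f x
    Degree< (suc d) f = ∀ g → Degree< d (Δ g f)

    Degree<-cong : ∀ d {f h} → (∀ x → f x ≡ h x) → Degree< d f → Degree< d h
    Degree<-cong zero    f≗h Df x = subst (+ p ∣_) (f≗h x) (Df x)
    Degree<-cong (suc d) f≗h Df g = Degree<-cong d (λ x → cong₂ _-_ (f≗h x) (f≗h (x ⊹ g))) (Df g)

    Degree<-suc : ∀ d {f} → Degree< d f → Degree< (suc d) f
    Degree<-suc zero    Df g x = ∣m∣n⇒∣m-n (Df x) (Df (x ⊹ g))
    Degree<-suc (suc d) Df g   = Degree<-suc d (Df g)

    Degree<-- : ∀ d {f h} → Degree< d f → Degree< d h → Degree< d (λ x → f x - h x)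
    Degree<-- zero            Df Dh x = ∣m∣n⇒∣m-n (Df x) (Dh x)
    Degree<-- (suc d) {f} {h} Df Dh g =
      Degree<-cong d (λ x → regroup (f x) (f (x ⊹ g)) (h x) (h (x ⊹ g))) (Degree<-- d (Df g) (Dh g))
      where
      regroup : ∀ a b c d → (a - b) - (c - d) ≡ (a - c) - (b - d)
      regroup = solve-∀

    Degree<-* : ∀ d a {f} → Degree< d f → Degree< d (λ x → a * f x)
    Degree<-* zero    a     Df x = ∣n⇒∣m*n a (Df x)
    Degree<-* (suc d) a {f} Df g = Degree<-cong d (λ x → factor-out a (f x) (f (x ⊹ g))) (Degree<-* d a (Df g))
      where
      factor-out : ∀ a b c → a * (b - c) ≡ a * b - a * c
      factor-out = solve-∀

    Degree<-shift : ∀ d h {f} → Degree< d f → Degree< d (λ x → f (x ⊹ h))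
    Degree<-shift zero    h     Df x = Df (x ⊹ h)
    Degree<-shift (suc d) h {f} Df g = Degree<-cong d (λ x → cong (λ y → f (x ⊹ h) - f y) (swap x)) (Degree<-shift d h (Df g))
      where
      swap : ∀ x → (x ⊹ h) ⊹ g ≡ (x ⊹ g) ⊹ h
      swap x = trans (⊹-assoc x h g) (trans (cong (x ⊹_) (⊹-comm h g)) (sym (⊹-assoc x g h)))

    record AffineForm : Set where
      field
        form   : V → ℤ
        slope  : V → ℤ
        affine : ∀ x g → form (x ⊹ g) ≡ form x + slope g
    open AffineForm

    -- By the Leibniz rule the difference of ℓ f is ℓ times the difference of f, minus the constant
    -- slope times a translate of f.
    Degree<-affine : ∀ d ℓ {f} → Degree< d f → Degree< (suc d) (λ x → form ℓ x * f x)
    Degree<-affine zero    ℓ     Df g x = ∣m∣n⇒∣m-n (∣n⇒∣m*n (form ℓ x) (Df x)) (∣n⇒∣m*n (form ℓ (x ⊹ g)) (Df (x ⊹ g)))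
    Degree<-affine (suc d) ℓ {f} Df g   =
      Degree<-cong (suc d) (λ x → trans (leibniz (form ℓ x) (slope ℓ g) (f x) (f (x ⊹ g)))
          (cong (λ b → form ℓ x * f x - b * f (x ⊹ g)) (sym (affine ℓ x g))))
        (Degree<-- (suc d) {λ x → form ℓ x * Δ g f x} {λ x → slope ℓ g * f (x ⊹ g)}
          (Degree<-affine d ℓ (Df g)) (Degree<-* (suc d) (slope ℓ g) {λ x → f (x ⊹ g)} (Degree<-shift (suc d) g {f} Df)))
      where
      leibniz : ∀ a s b c → a * (b - c) - s * c ≡ a * b - (a + s) * c
      leibniz = solve-∀

    ∏ : List AffineForm → V → ℤ
    ∏ []       x = 1ℤ
    ∏ (ℓ ∷ ℓs) x = form ℓ x * ∏ ℓs x

    Degree<-∏ : ∀ ℓs → Degree< (suc (length ℓs)) (∏ ℓs)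
    Degree<-∏ []       g x = divides 0ℤ refl
    Degree<-∏ (ℓ ∷ ℓs)     = Degree<-affine (suc (length ℓs)) ℓ (Degree<-∏ ℓs)

    ∏-∣ : ∀ ℓs x → Any (λ ℓ → + p ∣ form ℓ x) ℓs → + p ∣ ∏ ℓs x
    ∏-∣ (ℓ ∷ ℓs) x (here p∣)  = ∣m⇒∣m*n (∏ ℓs x) p∣
    ∏-∣ (ℓ ∷ ℓs) x (there p∣) = ∣n⇒∣m*n (form ℓ x) (∏-∣ ℓs x p∣)

    ∏-∣⁻ : ∀ ℓs x → + p ∣ ∏ ℓs x → Any (λ ℓ → + p ∣ form ℓ x) ℓs
    ∏-∣⁻ []       x p∣1 = contradiction (ℕ∣.∣1⇒≡1 (∣⇒∣ᵤ p∣1)) λ { refl → contradiction (ℕ.nonTrivial⇒n>1 1 {{prime⇒nonTrivial pp}}) (ℕₚ.<-irrefl refl) }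
    ∏-∣⁻ (ℓ ∷ ℓs) x p∣∏ with euclidsLemma ∣ form ℓ x ∣ ∣ ∏ ℓs x ∣ pp (subst (p ℕ∣.∣_) (ℤₚ.abs-* (form ℓ x) (∏ ℓs x)) (∣⇒∣ᵤ p∣∏))
    ... | inj₁ p∣ℓ = here (∣ᵤ⇒∣ p∣ℓ)
    ... | inj₂ p∣∏ = there (∏-∣⁻ ℓs x (∣ᵤ⇒∣ p∣∏))

    private instance
      p≢0 : NonZero p
      p≢0 = prime⇒nonZero pp

    coordinate-form : Fin r × Fin (p ∸ 1) → AffineForm
    coordinate-form (i , a) = record
      { form   = λ x → + lookup x i - + suc (toℕ a)
      ; slope  = λ g → + lookup g i
      ; affine = λ x g → trans (cong (λ b → + b - + suc (toℕ a)) (Vecₚ.lookup-zipWith ℕ._+_ i x g))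
          (trans (cong (_- + suc (toℕ a)) (ℤₚ.pos-+ (lookup x i) (lookup g i))) (regroup (+ lookup x i) (+ lookup g i) (+ suc (toℕ a))))
      }
      where
      regroup : ∀ b c a → (b + c) - a ≡ (b - a) + c
      regroup = solve-∀

    -- For each coordinate the factors x - 1, ..., x - (p - 1): a nonzero residue annihilates one of
    -- them, while at 0 their product is up to sign (p - 1)!, which is prime to p.
    forms : List AffineForm
    forms = map coordinate-form (cartesianProduct (allFin r) (allFin (p ∸ 1)))

    length-× : ∀ {a b} {A : Set a} {B : Set b} (xs : List A) (ys : List B) →
               length (cartesianProduct xs ys) ≡ length xs ℕ.* length ys
    length-× []       ys = refl
    length-× (x ∷ xs) ys = trans (Listₚ.length-++ (map (x ,_) ys)) (cong₂ ℕ._+_ (Listₚ.length-map (x ,_) ys) (length-× xs ys))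

    length-forms : length forms ≡ r ℕ.* (p ∸ 1)
    length-forms = trans (Listₚ.length-map coordinate-form (cartesianProduct (allFin r) (allFin (p ∸ 1))))
      (trans (length-× (allFin r) (allFin (p ∸ 1))) (cong₂ ℕ._*_ (Listₚ.length-tabulate {n = r} (λ i → i)) (Listₚ.length-tabulate {n = p ∸ 1} (λ i → i))))

    indicator : V → ℤ
    indicator = ∏ forms

    Zero : V → Set
    Zero x = ∀ i → p ℕ∣.∣ lookup x i

    nonzero-coordinate : ∀ x i → ¬ (p ℕ∣.∣ lookup x i) → + p ∣ indicator x
    nonzero-coordinate x i p∤xᵢ =
      ∏-∣ forms x (Anyₚ.map⁺ (Any.map (λ { refl → residue }) (∈ₚ.∈-cartesianProduct⁺ (∈ₚ.∈-allFin i) (∈ₚ.∈-allFin a))))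
      where
      y : ℕ
      y = lookup x i
      rem : ℕ
      rem = y % p
      rem≢0 : rem ≢ 0
      rem≢0 rem≡0 = p∤xᵢ (ℕ∣.m%n≡0⇒n∣m y p rem≡0)
      -- `coordinate-form` subtracts `suc (toℕ a)`, so the factor for the residue `rem` has index
      -- `rem` - 1.
      rem≡ : suc (ℕ.pred rem) ≡ rem
      rem≡ = ℕₚ.suc-pred rem {{ℕ.≢-nonZero rem≢0}}
      rem<p : ℕ.pred rem < p ∸ 1
      rem<p = ℕₚ.≤-pred (subst₂ _<_ (sym rem≡) (sym (ℕₚ.suc-pred p)) (m%n<n y p))
      a : Fin (p ∸ 1)
      a = fromℕ< rem<p
      residue : + p ∣ + y - + suc (toℕ a)
      residue = divides (+ (y / p)) (begin
        + y - + suc (toℕ a)                           ≡⟨ cong (λ b → + y - + suc b) (Finₚ.toℕ-fromℕ< rem<p) ⟩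
        + y - + suc (ℕ.pred rem)                      ≡⟨ cong (λ b → + y - + b) rem≡ ⟩
        + y - + rem                                   ≡⟨ cong (λ b → + b - + rem) (m≡m%n+[m/n]*n y p) ⟩
        + (rem ℕ.+ y / p ℕ.* p) - + rem               ≡⟨ cong (_- + rem) (ℤₚ.pos-+ rem (y / p ℕ.* p)) ⟩
        (+ rem + + (y / p ℕ.* p)) - + rem             ≡⟨ cancel (+ rem) (+ (y / p ℕ.* p)) ⟩
        + (y / p ℕ.* p)                               ≡⟨ ℤₚ.pos-* (y / p) p ⟩
        + (y / p) * + p                               ∎)
        where
        open ≡-Reasoning
        cancel : ∀ a b → (a + b) - a ≡ b
        cancel = solve-∀

    indicator-nonzero : ∀ x → ¬ Zero x → + p ∣ indicator x
    indicator-nonzero x x≢0 =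
      let i , p∤xᵢ = Finₚ.¬∀⟶∃¬ r _ (λ i → p ℕ∣.∣? lookup x i) x≢0 in nonzero-coordinate x i p∤xᵢ

    indicator-zero : ¬ (+ p ∣ indicator 0ᵥ)
    indicator-zero p∣ = no-root (Any.satisfied (Anyₚ.map⁻ {f = coordinate-form} (∏-∣⁻ forms 0ᵥ p∣)))
      where
      no-root : ¬ (∃ λ ia → + p ∣ form (coordinate-form ia) 0ᵥ)
      no-root ((i , a) , p∣form) = ℕₚ.<⇒≱ (ℕₚ.<-≤-trans (s≤s (Finₚ.toℕ<n a)) (ℕₚ.≤-reflexive (ℕₚ.suc-pred p)))
        (ℕ∣.∣⇒≤ (subst (λ b → p ℕ∣.∣ ∣ + b - + suc (toℕ a) ∣) (Vecₚ.lookup-replicate i 0) (∣⇒∣ᵤ p∣form)))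

    module _ {a} {A : Set a} (w : A → V) where

      total : List A → V
      total []      = 0ᵥ
      total (g ∷ T) = w g ⊹ total T

      differences : (V → ℤ) → List A → V → ℤ
      differences f []      = f
      differences f (g ∷ S) = differences (Δ (w g) f) S

      differences-∣ : ∀ S f x → Degree< (length S) f → + p ∣ differences f S x
      differences-∣ []      f x Df = Df x
      differences-∣ (g ∷ S) f x Df = differences-∣ S (Δ (w g) f) x (Df (w g))

      differences-cong : ∀ S {f h} → (∀ x → f x ≡ h x) → ∀ x → differences f S x ≡ differences h S x
      differences-cong []      f≗h x = f≗h x
      differences-cong (g ∷ S) f≗h x = differences-cong S (λ y → cong₂ _-_ (f≗h y) (f≗h (y ⊹ w g))) x

      -- Differences commute, so the one for `g`, which is applied first, can be pulled to the
      -- outside.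
      differences-∷ : ∀ g S f x → differences f (g ∷ S) x ≡ differences f S x - differences f S (x ⊹ w g)
      differences-∷ g []      f x = refl
      differences-∷ g (h ∷ S) f x = begin
        differences (Δ (w h) (Δ (w g) f)) S x
          ≡⟨ differences-cong S (λ y → trans (regroup (f y) (f (y ⊹ w g)) (f (y ⊹ w h)) (f ((y ⊹ w h) ⊹ w g)))
               (cong (λ z → (f y - f (y ⊹ w h)) - (f (y ⊹ w g) - f z)) (swap y))) x ⟩
        differences (Δ (w g) (Δ (w h) f)) S x
          ≡⟨ differences-∷ g S (Δ (w h) f) x ⟩
        differences (Δ (w h) f) S x - differences (Δ (w h) f) S (x ⊹ w g) ∎
        where
        open ≡-Reasoning
        regroup : ∀ a b c d → (a - b) - (c - d) ≡ (a - c) - (b - d)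
        regroup = solve-∀
        swap : ∀ y → (y ⊹ w h) ⊹ w g ≡ (y ⊹ w g) ⊹ w h
        swap y = trans (⊹-assoc y (w h) (w g)) (trans (cong (y ⊹_) (⊹-comm (w h) (w g))) (sym (⊹-assoc y (w g) (w h))))

      -- The iterated difference is an alternating sum of `indicator` over all x + total T; if none
      -- of these is zero modulo p, every term is divisible by p. The base point moves in the
      -- induction, hence the general `x`.
      hitting-or-∣ : ∀ S x → (∃[ T ] (T ⊆ S × Zero (x ⊹ total T))) ⊎ (+ p ∣ differences indicator S x)
      hitting-or-∣ [] x with Finₚ.all? (λ i → p ℕ∣.∣? lookup x i)
      ... | yes x≡0 = inj₁ ([] , [] , subst Zero (sym (⊹-identityʳ x)) x≡0)
      ... | no  x≢0 = inj₂ (indicator-nonzero x x≢0)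
      hitting-or-∣ (g ∷ S) x with hitting-or-∣ S x | hitting-or-∣ S (x ⊹ w g)
      ... | inj₁ (T , T⊆ , Σ≡0) | _                     = inj₁ (T , g ∷ʳ T⊆ , Σ≡0)
      ... | inj₂ _               | inj₁ (T , T⊆ , Σ≡0) = inj₁ (g ∷ T , refl ∷ T⊆ , subst Zero (⊹-assoc x (w g) (total T)) Σ≡0)
      ... | inj₂ p∣              | inj₂ p∣′              = inj₂ (subst (+ p ∣_) (sym (differences-∷ g S indicator x)) (∣m∣n⇒∣m-n p∣ p∣′))

      -- The empty subsequence always contributes `indicator 0ᵥ`; subtracting that term leaves the
      -- nonempty subsequences.
      zero-sum-or-∣ : ∀ S → (∃[ T ] (T ⊆ S × T ≢ [] × Zero (total T))) ⊎ (+ p ∣ indicator 0ᵥ - differences indicator S 0ᵥ)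
      zero-sum-or-∣ []      = inj₂ (divides 0ℤ (ℤₚ.+-inverseʳ (indicator 0ᵥ)))
      zero-sum-or-∣ (g ∷ S) with zero-sum-or-∣ S | hitting-or-∣ S (w g)
      ... | inj₁ (T , T⊆ , T≢[] , Σ≡0) | _                     = inj₁ (T , g ∷ʳ T⊆ , T≢[] , Σ≡0)
      ... | inj₂ _                      | inj₁ (T , T⊆ , Σ≡0) = inj₁ (g ∷ T , refl ∷ T⊆ , (λ ()) , Σ≡0)
      ... | inj₂ p∣                     | inj₂ p∣′              = inj₂ (subst (+ p ∣_) (sym eq) (∣m∣n⇒∣m+n p∣ p∣′))
        where
        regroup : ∀ a b c → a - (b - c) ≡ (a - b) + c
        regroup = solve-∀
        eq : indicator 0ᵥ - differences indicator (g ∷ S) 0ᵥ ≡ (indicator 0ᵥ - differences indicator S 0ᵥ) + differences indicator S (w g)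
        eq = trans (cong (λ z → indicator 0ᵥ - z) (trans (differences-∷ g S indicator 0ᵥ)
               (cong (λ y → differences indicator S 0ᵥ - differences indicator S y) (⊹-identityˡ (w g)))))
             (regroup (indicator 0ᵥ) (differences indicator S 0ᵥ) (differences indicator S (w g)))

      Degree<-≤ : ∀ {d e f} → d ≤ e → Degree< d f → Degree< e f
      Degree<-≤ d≤e = go (ℕₚ.≤⇒≤′ d≤e)
        where
        go : ∀ {d e f} → d ℕ.≤′ e → Degree< d f → Degree< e f
        go ℕ.≤′-refl       Df = Df
        go (ℕ.≤′-step d≤e) Df = Degree<-suc _ (go d≤e Df)

      zero-sum : ∀ S → r ℕ.* (p ∸ 1) < length S → ∃[ T ] (T ⊆ S × T ≢ [] × Zero (total T))
      zero-sum S large with zero-sum-or-∣ S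
      ... | inj₁ found = found
      ... | inj₂ p∣    = contradiction (subst (+ p ∣_) (cancel (indicator 0ᵥ) (differences indicator S 0ᵥ)) (∣m∣n⇒∣m+n p∣ vanish)) indicator-zero
        where
        vanish : + p ∣ differences indicator S 0ᵥ
        vanish = differences-∣ S indicator 0ᵥ (Degree<-≤ (subst (_< length S) (sym length-forms) large) (Degree<-∏ forms))
        cancel : ∀ a b → (a - b) + b ≡ a
        cancel = solve-∀

-- Zero-sum subsequences over C_p ⊕ C_pn.

module DavenportConstants where
  open Groups
  open OlsonTheorem
  open import Data.Nat using (ℕ; zero; suc; NonZero; _+_; _*_; _≤_; _<_; _∸_; s≤s)
  open import Data.Nat.Divisibility using (_∣_; divides; ∣m+n∣m⇒∣n; ∣m∣n⇒∣m+n; *-monoʳ-∣)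
  open import Data.Nat.DivMod using (_mod_; _%_; _/_; m≡m%n+[m/n]*n; m/n*n≡m)
  open import Data.Nat.ListAction using (sum)
  open import Data.Nat.ListAction.Properties using (sum-++; sum-↭)
  open import Data.Nat.Primality using (Prime; prime⇒nonZero)
  open import Data.Fin as Fin using (Fin; zero; suc; toℕ)
  open import Data.Vec as Vec using (Vec; []; _∷_)
  open import Data.List using (List; []; _∷_; _++_; length; map; concat; take; drop)
  open import Data.List.Relation.Binary.Sublist.Propositional using (_⊆_; []; _∷_; _∷ʳ_; ⊆-refl; ⊆-trans)
  open import Data.List.Relation.Binary.Permutation.Propositional using (_↭_; refl; prep; swap; trans; ↭-refl; ↭-sym; ↭-trans; ↭-reflexive)
  open import Relation.Binary.PropositionalEquality as ≡ using (_≡_; _≢_; cong; cong₂; subst; sym)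

  module _ {a} {A : Set a} where

    ⊆-complement : ∀ {T S : List A} → T ⊆ S → ∃[ R ] S ↭ T ++ R
    ⊆-complement []                = [] , refl
    ⊆-complement (y ∷ʳ T⊆) with R , S↭ ← ⊆-complement T⊆ = y ∷ R , ↭-trans (prep y S↭) (↭-sym (↭ₚ.shift y _ R))
    ⊆-complement (≡.refl ∷ T⊆) with R , S↭ ← ⊆-complement T⊆ = R , prep _ S↭

    -- Blocks are found in a rearrangement, whereas `ZeroSumFree` speaks of sublists in the given
    -- order.
    ⊆-↭ : ∀ {T S S′ : List A} → T ⊆ S → S ↭ S′ → ∃[ T′ ] (T′ ⊆ S′ × T ↭ T′)
    ⊆-↭ T⊆                          refl            = _ , T⊆ , refl
    ⊆-↭ (x ∷ʳ T⊆)                   (prep x S↭)     with T′ , T′⊆ , T↭ ← ⊆-↭ T⊆ S↭ = T′ , x ∷ʳ T′⊆ , T↭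
    ⊆-↭ (≡.refl ∷ T⊆)               (prep x S↭)     with T′ , T′⊆ , T↭ ← ⊆-↭ T⊆ S↭ = x ∷ T′ , ≡.refl ∷ T′⊆ , prep x T↭
    ⊆-↭ (x ∷ʳ y ∷ʳ T⊆)              (swap x y S↭)   with T′ , T′⊆ , T↭ ← ⊆-↭ T⊆ S↭ = T′ , y ∷ʳ x ∷ʳ T′⊆ , T↭
    ⊆-↭ (x ∷ʳ (≡.refl ∷ T⊆))        (swap x y S↭)   with T′ , T′⊆ , T↭ ← ⊆-↭ T⊆ S↭ = y ∷ T′ , ≡.refl ∷ x ∷ʳ T′⊆ , prep y T↭
    ⊆-↭ (≡.refl ∷ (y ∷ʳ T⊆))        (swap x y S↭)   with T′ , T′⊆ , T↭ ← ⊆-↭ T⊆ S↭ = x ∷ T′ , y ∷ʳ ≡.refl ∷ T′⊆ , prep x T↭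
    ⊆-↭ (≡.refl ∷ (≡.refl ∷ T⊆))    (swap x y S↭)   with T′ , T′⊆ , T↭ ← ⊆-↭ T⊆ S↭ = y ∷ x ∷ T′ , ≡.refl ∷ ≡.refl ∷ T′⊆ , swap x y T↭
    ⊆-↭ T⊆                          (trans S↭ S′↭)  with T′ , T′⊆ , T↭ ← ⊆-↭ T⊆ S↭ with T″ , T″⊆ , T′↭ ← ⊆-↭ T′⊆ S′↭ =
      T″ , T″⊆ , ↭-trans T↭ T′↭

    concat-⊆ : ∀ {Cs Bs : List (List A)} → Cs ⊆ Bs → concat Cs ⊆ concat Bs
    concat-⊆ []               = []
    concat-⊆ (B ∷ʳ Cs⊆)      = ⊆ₚ.++⁺ˡ B (concat-⊆ Cs⊆)
    concat-⊆ (≡.refl ∷ Cs⊆)   = ⊆ₚ.++⁺ ⊆-refl (concat-⊆ Cs⊆)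

    -- Two of the n + 1 partial sums agree modulo n.
    cyclic-zero-sum : ∀ n .{{_ : NonZero n}} (w : A → ℕ) xs → length xs ≡ n →
                      ∃[ ys ] (ys ⊆ xs × ys ≢ [] × n ∣ sum (map w ys))
    cyclic-zero-sum n w xs len = segment (Finₚ.pigeonhole (ℕₚ.n<1+n n) (λ i → partial (toℕ i) mod n))
      where
      partial : ℕ → ℕ
      partial i = sum (map w (take i xs))
      segment : (∃₂ λ i j → i Fin.< j × partial (toℕ i) mod n ≡ partial (toℕ j) mod n) →
                ∃[ ys ] (ys ⊆ xs × ys ≢ [] × n ∣ sum (map w ys))
      segment (i , j , i<j , eq) = ys , ⊆-trans (⊆ₚ.drop-⊆ (toℕ i) (take (toℕ j) xs)) (⊆ₚ.take-⊆ (toℕ j) xs) , ys≢[] , n∣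
        where
        ys : List A
        ys = drop (toℕ i) (take (toℕ j) xs)
        |ys| : length ys ≡ toℕ j ∸ toℕ i
        |ys| = ≡.trans (Listₚ.length-drop (toℕ i) (take (toℕ j) xs))
          (cong (_∸ toℕ i) (≡.trans (Listₚ.length-take (toℕ j) xs) (ℕₚ.m≤n⇒m⊓n≡m (subst (toℕ j ≤_) (sym len) (ℕₚ.≤-pred (Finₚ.toℕ<n j))))))
        ys≢[] : ys ≢ []
        ys≢[] ys≡[] = ℕₚ.m>n⇒m∸n≢0 i<j (≡.trans (sym |ys|) (cong length ys≡[]))
        take-take : take (toℕ i) (take (toℕ j) xs) ≡ take (toℕ i) xs
        take-take = ≡.trans (Listₚ.take-take (toℕ i) (toℕ j) xs) (cong (λ k → take k xs) (ℕₚ.m≤n⇒m⊓n≡m (ℕₚ.<⇒≤ i<j)))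
        split : partial (toℕ j) ≡ partial (toℕ i) + sum (map w ys)
        split = ≡.trans (cong (sum ∘ map w) (≡.trans (sym (Listₚ.take++drop≡id (toℕ i) (take (toℕ j) xs))) (cong (_++ ys) take-take)))
          (≡.trans (cong sum (Listₚ.map-++ w (take (toℕ i) xs) ys)) (sum-++ (map w (take (toℕ i) xs)) (map w ys)))
        rem≡ : partial (toℕ i) % n ≡ partial (toℕ j) % n
        rem≡ = ≡.trans (sym (toℕ-mod (partial (toℕ i)) n)) (≡.trans (cong toℕ eq) (toℕ-mod (partial (toℕ j)) n))
        n∣ : n ∣ sum (map w ys)
        n∣ = ∣m+n∣m⇒∣n (divides (partial (toℕ j) / n) (ℕₚ.+-cancelˡ-≡ (partial (toℕ j) % n) _ _ (begin
          partial (toℕ j) % n + (partial (toℕ i) / n * n + sum (map w ys))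
            ≡⟨ ℕₚ.+-assoc (partial (toℕ j) % n) _ _ ⟨
          partial (toℕ j) % n + partial (toℕ i) / n * n + sum (map w ys)
            ≡⟨ cong (λ r → r + partial (toℕ i) / n * n + sum (map w ys)) rem≡ ⟨
          partial (toℕ i) % n + partial (toℕ i) / n * n + sum (map w ys)
            ≡⟨ cong (_+ sum (map w ys)) (m≡m%n+[m/n]*n (partial (toℕ i)) n) ⟨
          partial (toℕ i) + sum (map w ys)
            ≡⟨ split ⟨
          partial (toℕ j)
            ≡⟨ m≡m%n+[m/n]*n (partial (toℕ j)) n ⟩
          partial (toℕ j) % n + partial (toℕ j) / n * n ∎))) (divides (partial (toℕ i) / n) ≡.refl)
          where open ≡.≡-Reasoning

  module ShortZeroSums {a} {A : Set a} (p : ℕ) (pp : Prime p) (w₁ w₂ : A → ℕ) where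

    private instance
      p≢0 : NonZero p
      p≢0 = prime⇒nonZero pp

    W : (A → ℕ) → List A → ℕ
    W w T = sum (map w T)

    W-++ : ∀ w T R → W w (T ++ R) ≡ W w T + W w R
    W-++ w T R = ≡.trans (cong sum (Listₚ.map-++ w T R)) (sum-++ (map w T) (map w R))

    W-↭ : ∀ w {S T} → S ↭ T → W w S ≡ W w T
    W-↭ w S↭T = sum-↭ (↭ₚ.map⁺ w S↭T)

    ZeroSum : List A → Set
    ZeroSum T = p ∣ W w₁ T × p ∣ W w₂ T

    complement-zero-sum : ∀ {S T R} → S ↭ T ++ R → ZeroSum S → ZeroSum T → ZeroSum R
    complement-zero-sum {S} {T} {R} S↭ (p∣S₁ , p∣S₂) (p∣T₁ , p∣T₂) = component w₁ p∣S₁ p∣T₁ , component w₂ p∣S₂ p∣T₂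
      where
      component : ∀ w → p ∣ W w S → p ∣ W w T → p ∣ W w R
      component w p∣S p∣T = ∣m+n∣m⇒∣n (subst (p ∣_) (≡.trans (W-↭ w S↭) (W-++ w T R)) p∣S) p∣T

    lookup-total : ∀ r (v : A → Vec ℕ r) T i → Vec.lookup (Olson.total p pp r v T) i ≡ W (λ g → Vec.lookup (v g) i) T
    lookup-total r v []      i = Vecₚ.lookup-replicate i 0
    lookup-total r v (g ∷ T) i = ≡.trans (Vecₚ.lookup-zipWith _+_ i (v g) (Olson.total p pp r v T)) (cong (_ +_) (lookup-total r v T i))

    zero-sum-2 : ∀ S → 2 * (p ∸ 1) < length S → ∃[ T ] (T ⊆ S × T ≢ [] × ZeroSum T)
    zero-sum-2 S large =
      let v = λ g → w₁ g ∷ w₂ g ∷ []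
          T , T⊆ , T≢[] , Σ≡0 = Olson.zero-sum p pp 2 v S large
      in T , T⊆ , T≢[] , subst (p ∣_) (lookup-total 2 v T zero) (Σ≡0 zero) , subst (p ∣_) (lookup-total 2 v T (suc zero)) (Σ≡0 (suc zero))

    -- A third coordinate constantly equal to 1 forces the length to be divisible by p as well.
    zero-sum-3 : ∀ S → 3 * (p ∸ 1) < length S → ∃[ T ] (T ⊆ S × T ≢ [] × ZeroSum T × p ∣ length T)
    zero-sum-3 S large =
      let v = λ g → w₁ g ∷ w₂ g ∷ 1 ∷ []
          T , T⊆ , T≢[] , Σ≡0 = Olson.zero-sum p pp 3 v S large
      in T , T⊆ , T≢[] , (subst (p ∣_) (lookup-total 3 v T zero) (Σ≡0 zero) , subst (p ∣_) (lookup-total 3 v T (suc zero)) (Σ≡0 (suc zero))) ,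
         subst (p ∣_) (≡.trans (lookup-total 3 v T (suc (suc zero))) (count T)) (Σ≡0 (suc (suc zero)))
      where
      count : ∀ T → W (λ _ → 1) T ≡ length T
      count []      = ≡.refl
      count (g ∷ T) = cong suc (count T)

    Block : List A → Set a
    Block T = T ≢ [] × ZeroSum T

    q : ℕ
    q = p ∸ 1

    p≡1+q : p ≡ suc q
    p≡1+q = sym (ℕₚ.suc-pred p)

    -- With `t` set aside, the other 2p - 1 elements contain a zero-sum subsequence. It and its
    -- complement, which is nonempty thanks to `t`, both sum to zero, and of their 2p elements one
    -- of the two has at most p.
    short-in-2p : ∀ t T → length T ≡ suc (2 * q) → ZeroSum (t ∷ T) →
                  ∃₂ λ T′ R → t ∷ T ↭ T′ ++ R × Block T′ × length T′ ≤ p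
    short-in-2p t T |T| Σ≡0 = split (zero-sum-2 T (subst (2 * q <_) (sym |T|) (ℕₚ.n<1+n (2 * q))))
      where
      split : ∃[ T′ ] (T′ ⊆ T × T′ ≢ [] × ZeroSum T′) → ∃₂ λ T′ R → t ∷ T ↭ T′ ++ R × Block T′ × length T′ ≤ p
      split (T′ , T′⊆ , T′≢[] , Σ′≡0) with R , T↭ ← ⊆-complement T′⊆ | length T′ ℕₚ.≤? p
      ... | yes |T′|≤p = T′ , t ∷ R , tT↭ , (T′≢[] , Σ′≡0) , |T′|≤p
        where
        tT↭ : t ∷ T ↭ T′ ++ t ∷ R
        tT↭ = ↭-trans (prep t T↭) (↭-sym (↭ₚ.shift t T′ R))
      ... | no  |T′|≰p = t ∷ R , T′ , ↭-trans (prep t T↭) (prep t (↭ₚ.++-comm T′ R)) ,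
        ((λ ()) , complement-zero-sum (↭-trans (prep t T↭) (↭-sym (↭ₚ.shift t T′ R))) Σ≡0 Σ′≡0) , |tR|≤p
        where
        |tR|≤p : suc (length R) ≤ p
        |tR|≤p = ℕₚ.+-cancelˡ-≤ (suc q) _ _ (begin
          suc q + suc (length R)           ≤⟨ ℕₚ.+-monoˡ-≤ (suc (length R)) (subst (_≤ length T′) p≡1+q (ℕₚ.<⇒≤ (ℕₚ.≰⇒> |T′|≰p))) ⟩
          length T′ + suc (length R)       ≡⟨ ℕₚ.+-suc (length T′) (length R) ⟩
          suc (length T′ + length R)       ≡⟨ cong suc (≡.trans (sym (Listₚ.length-++ T′)) (sym (↭ₚ.↭-length T↭))) ⟩
          suc (length T)                   ≡⟨ cong suc |T| ⟩
          suc (suc (2 * q))                ≡⟨ cong (λ a → suc (suc (q + a))) (ℕₚ.+-identityʳ q) ⟩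
          suc (suc (q + q))                ≡⟨ cong suc (ℕₚ.+-suc q q) ⟨
          suc q + suc q                    ≡⟨ cong (suc q +_) p≡1+q ⟨
          suc q + p                        ∎)
          where open ℕₚ.≤-Reasoning

    -- Among the first 3p - 2 elements there is a zero-sum subsequence whose length is a multiple of
    -- p, hence p or 2p; the latter is halved by `short-in-2p`.
    short-block : ∀ S → 3 * q < length S → ∃₂ λ T R → S ↭ T ++ R × Block T × length T ≤ p
    short-block S large = from-3 (zero-sum-3 S′ (subst (3 * q <_) (sym |S′|) (ℕₚ.n<1+n (3 * q))))
      where
      S′ : List A
      S′ = take (suc (3 * q)) S
      |S′| : length S′ ≡ suc (3 * q)
      |S′| = ≡.trans (Listₚ.length-take (suc (3 * q)) S) (ℕₚ.m≤n⇒m⊓n≡m large)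
      classify : ∀ T → T ≢ [] → length T ≤ suc (3 * q) → ZeroSum T → p ∣ length T → ∃₂ λ T′ R → T ↭ T′ ++ R × Block T′ × length T′ ≤ p
      classify [] T≢[] |T|≤ Σ≡0 (divides zero eq)               = contradiction ≡.refl T≢[]
      classify T T≢[] |T|≤ Σ≡0 (divides (suc zero) eq)          = T , [] , ↭-reflexive (sym (Listₚ.++-identityʳ T)) , (T≢[] , Σ≡0) , ℕₚ.≤-reflexive (≡.trans eq (ℕₚ.*-identityˡ p))
      classify [] T≢[] |T|≤ Σ≡0 (divides (suc (suc zero)) eq)   = contradiction ≡.refl T≢[]
      classify (t ∷ T) T≢[] |T|≤ Σ≡0 (divides (suc (suc zero)) eq) = short-in-2p t T |T| Σ≡0
        where
        |T| : length T ≡ suc (2 * q)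
        |T| = ℕₚ.suc-injective (≡.trans eq (≡.trans (cong (2 *_) p≡1+q) (ℕₚ.*-suc 2 q)))
      classify T T≢[] |T|≤ Σ≡0 (divides (suc (suc (suc k))) eq) = contradiction |T|≤ (ℕₚ.<⇒≱ (begin
        suc (suc (3 * q))    ≤⟨ ℕₚ.n≤1+n _ ⟩
        3 + 3 * q            ≡⟨ ℕₚ.*-suc 3 q ⟨
        3 * suc q            ≡⟨ cong (3 *_) p≡1+q ⟨
        3 * p                ≤⟨ ℕₚ.*-monoˡ-≤ p (ℕₚ.m≤m+n 3 k) ⟩
        (3 + k) * p          ≡⟨ eq ⟨
        length T             ∎))
        where open ℕₚ.≤-Reasoning
      from-3 : ∃[ T ] (T ⊆ S′ × T ≢ [] × ZeroSum T × p ∣ length T) → ∃₂ λ T R → S ↭ T ++ R × Block T × length T ≤ p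
      from-3 (T , T⊆ , T≢[] , Σ≡0 , p∣|T|) =
        let T′ , R , T↭ , block , |T′|≤p = classify T T≢[] (subst (length T ≤_) |S′| (⊆ₚ.length-mono-≤ T⊆)) Σ≡0 p∣|T|
            R′ , S↭ = ⊆-complement (⊆-trans T⊆ (⊆ₚ.take-⊆ (suc (3 * q)) S))
        in T′ , R ++ R′ , ↭-trans S↭ (↭-trans (↭ₚ.++⁺ʳ R′ T↭) (↭-reflexive (Listₚ.++-assoc T′ R R′))) , block , |T′|≤p

    -- Blocks of length at most p are removed while at least two are still wanted, which leaves more
    -- than 3 (p - 1) elements to search. The last block may have any length, and 2p - 1 elements
    -- suffice for it.
    blocks : ∀ m S → p * m + p ≤ suc (length S) → ∃₂ λ Bs R → length Bs ≡ m × All Block Bs × S ↭ concat Bs ++ R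
    blocks zero S len = [] , S , ≡.refl , [] , ↭-refl
    blocks (suc zero) S len =
      let T , T⊆ , T≢[] , Σ≡0 = zero-sum-2 S large
          R , S↭ = ⊆-complement T⊆
      in T ∷ [] , R , ≡.refl , (T≢[] , Σ≡0) ∷ [] , subst (λ T → S ↭ T ++ R) (sym (Listₚ.++-identityʳ T)) S↭
      where
      large : 2 * q < length S
      large = ℕₚ.≤-pred (begin
        suc (suc (2 * q))  ≡⟨ ℕₚ.*-suc 2 q ⟨
        2 * suc q          ≡⟨ cong (2 *_) p≡1+q ⟨
        p + (p + 0)        ≡⟨ cong₂ _+_ (sym (ℕₚ.*-identityʳ p)) (ℕₚ.+-identityʳ p) ⟩
        p * 1 + p          ≤⟨ len ⟩
        suc (length S)     ∎)
        where open ℕₚ.≤-Reasoning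
    blocks (suc (suc m)) S len =
      let T , R , S↭ , block , |T|≤p = short-block S large
          Bs , R′ , |Bs| , all-block , R↭ = blocks (suc m) R (rest-large T R S↭ |T|≤p)
      in T ∷ Bs , R′ , cong suc |Bs| , block ∷ all-block ,
         ↭-trans S↭ (↭-trans (↭ₚ.++⁺ˡ T R↭) (↭-reflexive (sym (Listₚ.++-assoc T (concat Bs) R′))))
      where
      open ℕₚ.≤-Reasoning
      large : 3 * q < length S
      large = ℕₚ.≤-pred (begin
        2 + 3 * q              ≤⟨ ℕₚ.n≤1+n _ ⟩
        3 + 3 * q              ≡⟨ ℕₚ.*-suc 3 q ⟨
        3 * suc q              ≡⟨ cong (3 *_) p≡1+q ⟨
        p + 2 * p              ≡⟨ ℕₚ.+-comm p (2 * p) ⟩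
        2 * p + p              ≡⟨ cong (_+ p) (ℕₚ.*-comm 2 p) ⟩
        p * 2 + p              ≤⟨ ℕₚ.+-monoˡ-≤ p (ℕₚ.*-monoʳ-≤ p (ℕₚ.m≤m+n 2 m)) ⟩
        p * (2 + m) + p        ≤⟨ len ⟩
        suc (length S)         ∎)
      rest-large : ∀ T R → S ↭ T ++ R → length T ≤ p → p * suc m + p ≤ suc (length R)
      rest-large T R S↭ |T|≤p = ℕₚ.+-cancelˡ-≤ p _ _ (begin
        p + (p * suc m + p)           ≡⟨ ℕₚ.+-assoc p (p * suc m) p ⟨
        p + p * suc m + p             ≡⟨ cong (_+ p) (ℕₚ.*-suc p (suc m)) ⟨
        p * (2 + m) + p               ≤⟨ len ⟩
        suc (length S)                ≡⟨ cong suc (≡.trans (↭ₚ.↭-length S↭) (Listₚ.length-++ T)) ⟩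
        suc (length T + length R)     ≤⟨ s≤s (ℕₚ.+-monoˡ-≤ (length R) |T|≤p) ⟩
        suc (p + length R)            ≡⟨ ℕₚ.+-suc p (length R) ⟨
        p + suc (length R)            ∎)

    -- The second coordinates of the n blocks sum to multiples of p. Divided by p they form a
    -- sequence of length n over C_n, which has a nonempty zero-sum subsequence; the union of its
    -- blocks vanishes modulo p n.
    zero-sum-pn : ∀ n .{{_ : NonZero n}} S → p * n + p ≤ suc (length S) →
                  ∃[ T ] (T ⊆ S × T ≢ [] × p ∣ W w₁ T × p * n ∣ W w₂ T)
    zero-sum-pn n S len =
      let Bs , R , |Bs| , all-block , S↭ = blocks n S len
          Cs , Cs⊆ , Cs≢[] , n∣ = cyclic-zero-sum n (λ B → W w₂ B / p) Bs |Bs|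
          blocks-Cs = ⊆ₚ.All-resp-⊆ Cs⊆ all-block
          T , T⊆ , T↭ = ⊆-↭ (⊆ₚ.++⁺ʳ R (concat-⊆ Cs⊆)) (↭-sym S↭)
      in T , T⊆ , (λ T≡[] → concat≢[] Cs Cs≢[] blocks-Cs (↭ₚ.↭-empty-inv (subst (concat Cs ↭_) T≡[] T↭))) ,
         subst (p ∣_) (W-↭ w₁ T↭) (p∣W₁ Cs blocks-Cs) ,
         subst (p * n ∣_) (≡.trans (sym (W₂≡ Cs blocks-Cs)) (W-↭ w₂ T↭)) (*-monoʳ-∣ p n∣)
      where
      concat≢[] : ∀ Cs → Cs ≢ [] → All Block Cs → concat Cs ≢ []
      concat≢[] []             Cs≢[] _                  eq = Cs≢[] ≡.refl
      concat≢[] ([] ∷ Cs)      Cs≢[] ((C≢[] , _) ∷ _)   eq = C≢[] ≡.refl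
      p∣W₁ : ∀ Cs → All Block Cs → p ∣ W w₁ (concat Cs)
      p∣W₁ []       []                          = divides 0 ≡.refl
      p∣W₁ (C ∷ Cs) ((_ , p∣ , _) ∷ blocks-Cs)  = subst (p ∣_) (sym (W-++ w₁ C (concat Cs))) (∣m∣n⇒∣m+n p∣ (p∣W₁ Cs blocks-Cs))
      W₂≡ : ∀ Cs → All Block Cs → W w₂ (concat Cs) ≡ p * sum (map (λ B → W w₂ B / p) Cs)
      W₂≡ []       []                          = sym (ℕₚ.*-zeroʳ p)
      W₂≡ (C ∷ Cs) ((_ , _ , p∣) ∷ blocks-Cs)  = ≡.trans (W-++ w₂ C (concat Cs))
        (≡.trans (cong₂ _+_ (≡.trans (sym (m/n*n≡m p∣)) (ℕₚ.*-comm (W w₂ C / p) p)) (W₂≡ Cs blocks-Cs)) (sym (ℕₚ.*-distribˡ-+ p (W w₂ C / p) _)))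

-- Lines of four slopes that cannot cover all planes when p ≥ 5.

module UncoverablePlanes where
  open Lists
  open import Data.Nat as ℕ using (ℕ; zero; suc; _≤_; _<_; s≤s; z≤n)
  open import Data.Nat.ListAction using (sum)
  open import Data.Nat.ListAction.Properties using (sum-↭)
  open import Data.Nat.Primality using (Prime; euclidsLemma; prime⇒irreducible)
  open import Data.Nat.Tactic.RingSolver using () renaming (solve-∀ to ℕ-solve-∀)
  open import Data.Integer using (ℤ; +_; -[1+_]; 0ℤ; 1ℤ; _+_; _*_; _-_; -_; ∣_∣)
  open import Data.Integer.Divisibility.Signed using (_∣_; _∣?_; divides; ∣m∣n⇒∣m+n; ∣m∣n⇒∣m-n; ∣n⇒∣m*n; ∣ᵤ⇒∣; ∣⇒∣ᵤ)
  open import Data.Integer.Tactic.RingSolver using (solve-∀)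
  open import Data.Fin using (Fin; zero; suc; toℕ)
  open import Data.Fin.Patterns using (0F; 1F; 2F; 3F)
  open import Data.List using (List; []; _∷_; _++_; length; map; lookup; allFin; tabulate; foldr)
  open import Data.List.Relation.Binary.Permutation.Propositional using (_↭_; refl; prep; swap; ↭-trans)
  open import Relation.Nullary.Decidable using (toWitness; _⊎-dec_; _×-dec_)
  open import Relation.Binary.PropositionalEquality as ≡ using (_≡_; _≢_; cong; cong₂; subst; subst₂; sym; trans)

  sum-map-+ : ∀ {a} {A : Set a} (f g : A → ℕ) xs → sum (map (λ x → f x ℕ.+ g x) xs) ≡ sum (map f xs) ℕ.+ sum (map g xs)
  sum-map-+ f g []       = ≡.refl
  sum-map-+ f g (x ∷ xs) = trans (cong (f x ℕ.+ g x ℕ.+_) (sum-map-+ f g xs)) (interchange (f x) (g x) (sum (map f xs)) (sum (map g xs)))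
    where open import Algebra.Properties.CommutativeSemigroup ℕₚ.+-commutativeSemigroup using (interchange)

  Σ : ∀ {a} {A : Set a} → (A → ℤ) → List A → ℤ
  Σ f = foldr (λ x s → f x + s) 0ℤ

  -- The remaining entries are returned too, so that a second plane can be sought among them.
  ∃-below-average : ∀ {a} {A : Set a} (f : A → ℕ) m ts → sum (map f ts) < length ts ℕ.* m →
                    ∃₂ λ t us → ts ↭ t ∷ us × f t < m
  ∃-below-average f m (t ∷ ts) Σ< with f t ℕₚ.<? m
  ... | yes ft<m = t , ts , refl , ft<m
  ... | no  ft≮m with u , us , ts↭ , fu<m ← ∃-below-average f m ts
          (ℕₚ.+-cancelˡ-< m _ _ (ℕₚ.≤-<-trans (ℕₚ.+-monoˡ-≤ (sum (map f ts)) (ℕₚ.≮⇒≥ ft≮m)) Σ<)) =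
        u , t ∷ us , ↭-trans (prep t ts↭) (swap t u refl) , fu<m

  -- If x ↦ its partner in ys is injective and there are no more ys than xs, it is bijective, so weights can be summed over either list.
  module Matching {a b r} {A : Set a} {B : Set b} (R : A → B → Set r)
                  (injective : ∀ {x x′ y} → R x y → R x′ y → x ≡ x′) where

    skip : ∀ {x x′ y} ys zs → R x y → x ≢ x′ → Any (R x′) (ys ++ y ∷ zs) → Any (R x′) (ys ++ zs)
    skip []        zs r x≢x′ (here r′)   = contradiction (injective r r′) x≢x′
    skip []        zs r x≢x′ (there any) = any
    skip (y ∷ ys)  zs r x≢x′ (here r′)   = here r′
    skip (y ∷ ys)  zs r x≢x′ (there any) = there (skip ys zs r x≢x′ any)

    length-∷ : ∀ (ys : List B) y zs → length (ys ++ y ∷ zs) ≡ suc (length (ys ++ zs))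
    length-∷ []       y zs = ≡.refl
    length-∷ (_ ∷ ys) y zs = cong suc (length-∷ ys y zs)

    length≤ : ∀ xs ys → Unique xs → All (λ x → Any (R x) ys) xs → length xs ≤ length ys
    length≤ []       ys xs!          hits         = z≤n
    length≤ (x ∷ xs) ys (x∉xs ∷ xs!) (hit ∷ hits) with y , y∈ , r ← find hit with us , vs , ≡.refl ← ∈ₚ.∈-∃++ y∈ =
      subst (suc (length xs) ≤_) (sym (length-∷ us y vs))
        (s≤s (length≤ xs (us ++ vs) xs! (All.zipWith (λ (x≢x′ , hit′) → skip us vs r x≢x′ hit′) (x∉xs , hits))))

    module _ (p : ℕ) (v : A → ℤ) (w : B → ℤ) (v≈w : ∀ {x y} → R x y → + p ∣ v x - w y) where

      Σ-∷ : ∀ ys y zs → Σ w (ys ++ y ∷ zs) ≡ w y + Σ w (ys ++ zs)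
      Σ-∷ []        y zs = ≡.refl
      Σ-∷ (y′ ∷ ys) y zs = trans (cong (λ s → w y′ + s) (Σ-∷ ys y zs)) (exchange (w y′) (w y) (Σ w (ys ++ zs)))
        where
        exchange : ∀ a b c → a + (b + c) ≡ b + (a + c)
        exchange = solve-∀

      Σ≈Σ : ∀ xs ys → Unique xs → All (λ x → Any (R x) ys) xs → length ys ≤ length xs → + p ∣ Σ v xs - Σ w ys
      Σ≈Σ []       []  xs!          hits         len = divides 0ℤ ≡.refl
      Σ≈Σ (x ∷ xs) ys  (x∉xs ∷ xs!) (hit ∷ hits) len with y , y∈ , r ← find hit with us , vs , ≡.refl ← ∈ₚ.∈-∃++ y∈ =
        subst (+ p ∣_) (trans (regroup (v x) (w y) (Σ v xs) (Σ w (us ++ vs))) (cong (λ s → v x + Σ v xs - s) (sym (Σ-∷ us y vs))))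
          (∣m∣n⇒∣m+n (v≈w r) (Σ≈Σ xs (us ++ vs) xs! (All.zipWith (λ (x≢x′ , hit′) → skip us vs r x≢x′ hit′) (x∉xs , hits))
            (ℕₚ.≤-pred (subst (_≤ suc (length xs)) (length-∷ us y vs) len))))
        where
        regroup : ∀ a b c d → (a - b) + (c - d) ≡ (a + c) - (b + d)
        regroup = solve-∀

  -- The line of slope x and value c in the plane is { (j , k) : k + x j ≡ c (mod p) }; a point is given by integers j and k.
  module PlaneCovers (p : ℕ) (pp : Prime p) (5≤p : 5 ≤ p) where

    infix 4 _≈_
    _≈_ : ℤ → ℤ → Set
    x ≈ y = + p ∣ x - y

    ≈-trans-sym : ∀ x y z → x ≈ z → y ≈ z → x ≈ y
    ≈-trans-sym x y z x≈z y≈z = subst (+ p ∣_) (cancel x y z) (∣m∣n⇒∣m-n x≈z y≈z)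
      where
      cancel : ∀ x y z → (x - z) - (y - z) ≡ x - y
      cancel = solve-∀

    residue-injective : ∀ {a b : Fin p} → + toℕ a ≈ + toℕ b → a ≡ b
    residue-injective {a} {b} a≈b = Finₚ.toℕ-injective (ℤₚ.+-injective (ℤₚ.i-j≡0⇒i≡j (+ toℕ a) (+ toℕ b)
      (ℤₚ.∣i∣≡0⇒i≡0 (small (∣⇒∣ᵤ a≈b) (subst (_< p) (cong ∣_∣ (sym (ℤₚ.m-n≡m⊖n (toℕ a) (toℕ b))))
        (ℕₚ.≤-<-trans (ℤₚ.∣m⊝n∣≤m⊔n (toℕ a) (toℕ b)) (ℕₚ.⊔-lub (Finₚ.toℕ<n a) (Finₚ.toℕ<n b))))))))
      where
      small : ∀ {d} → p ℕ∣.∣ d → d < p → d ≡ 0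
      small {zero}  p∣d d<p = ≡.refl
      small {suc d} p∣d d<p = contradiction (ℕ∣.∣⇒≤ p∣d) (ℕₚ.<⇒≱ d<p)

    slope : Fin 4 → ℤ
    slope 0F = 0ℤ
    slope 1F = 1ℤ
    slope 2F = -[1+ 0 ]
    slope 3F = + 2

    -- Two different slopes among 0, 1, -1, 2 are at most 3 apart, which is less than p.
    slopes-distinct : ∀ {d e} → d ≢ e → ¬ (+ p ∣ slope d - slope e)
    slopes-distinct {d} {e} d≢e p∣ = case toWitness {a? = check} _ d e of λ where
        (inj₁ d≡e)       → d≢e d≡e
        (inj₂ (0< , ≤3)) → ℕₚ.<⇒≱ (ℕₚ.≤-trans (s≤s ≤3) (ℕₚ.≤-trans (ℕₚ.n≤1+n 4) 5≤p)) (ℕ∣.∣⇒≤ {{ℕ.>-nonZero 0<}} (∣⇒∣ᵤ p∣))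
      where
      check : Dec (∀ d e → d ≡ e ⊎ (1 ≤ ∣ slope d - slope e ∣ × ∣ slope d - slope e ∣ ≤ 3))
      check = Finₚ.all? λ d → Finₚ.all? λ e → (d Finₚ.≟ e) ⊎-dec ((1 ℕₚ.≤? ∣ slope d - slope e ∣) ×-dec (∣ slope d - slope e ∣ ℕₚ.≤? 3))

    *-cancel-residue : ∀ s {a b : Fin p} → ¬ (+ p ∣ s) → s * + toℕ a ≈ s * + toℕ b → a ≡ b
    *-cancel-residue s {a} {b} p∤s sa≈sb = case euclidsLemma ∣ s ∣ ∣ + toℕ a - + toℕ b ∣ pp
        (subst (p ℕ∣.∣_) (ℤₚ.abs-* s (+ toℕ a - + toℕ b)) (∣⇒∣ᵤ (subst (+ p ∣_) (factor-out s (+ toℕ a) (+ toℕ b)) sa≈sb))) of λ where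
        (inj₁ p∣s) → contradiction (∣ᵤ⇒∣ p∣s) p∤s
        (inj₂ p∣d) → residue-injective (∣ᵤ⇒∣ p∣d)
      where
      factor-out : ∀ s a b → s * a - s * b ≡ s * (a - b)
      factor-out = solve-∀

    allFin-length : ∀ m → length (allFin m) ≡ m
    allFin-length m = Listₚ.length-tabulate (λ i → i)

    missing-residue : ∀ cs → length cs < p → ∃[ v ] All (λ c → ¬ (+ toℕ {p} v ≈ c)) cs
    missing-residue cs len = case Finₚ.all? (λ (v : Fin p) → any? (λ c → + p ∣? (+ toℕ v - c)) cs) of λ where
      (yes all-hit) → contradiction
        (subst (_≤ length cs) (allFin-length p) (Matching.length≤ (λ (v : Fin p) c → + toℕ v ≈ c) (λ {v} {v′} {c} v≈c v′≈c → residue-injective (≈-trans-sym (+ toℕ v) (+ toℕ v′) c v≈c v′≈c))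
          (allFin p) cs (Uniqueₚ.allFin⁺ p) (All.tabulate (λ {v} _ → all-hit v)))) (ℕₚ.<⇒≱ len)
      (no ¬all-hit) → let v , v∉ = Finₚ.¬∀⟶∃¬ p _ (λ (v : Fin p) → any? (λ c → + p ∣? (+ toℕ v - c)) cs) ¬all-hit in v , Allₚ.¬Any⇒All¬ cs v∉

    -- An entry `(o , c)` of `Ls d` is the line of slope `slope d` and value `c` in plane `o`, one
    -- of `P` planes. Coordinates range over all integers, so that points of a line can be written
    -- down without reduction modulo p.
    module _ {P : ℕ} (Ls : Fin 4 → List (Fin P × ℤ))
             (cover : ∀ u j k → ∃[ d ] Any (λ (o , c) → o ≡ u × (k + slope d * j) ≈ c) (Ls d)) where
      open Fibers {A = Fin P × ℤ} Finₚ._≟_ proj₁ using (fiber; sum-fibers)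

      count : Fin P → Fin 4 → ℕ
      count u d = length (fiber u (Ls d))

      lines : Fin P → List (Fin 4) → List (Fin 4 × ℤ)
      lines u []       = []
      lines u (d ∷ ds) = map (λ (o , c) → d , c) (fiber u (Ls d)) ++ lines u ds

      length-lines : ∀ u ds → length (lines u ds) ≡ sum (map (count u) ds)
      length-lines u []       = ≡.refl
      length-lines u (d ∷ ds) = trans (Listₚ.length-++ (map (λ (o , c) → d , c) (fiber u (Ls d))))
        (cong₂ ℕ._+_ (Listₚ.length-map (λ (o , c) → d , c) (fiber u (Ls d))) (length-lines u ds))

      ∈-fiber : ∀ u j k d → Any (λ (o , c) → o ≡ u × (k + slope d * j) ≈ c) (Ls d) →
                Any (λ (o , c) → (k + slope d * j) ≈ c) (fiber u (Ls d))
      ∈-fiber u j k d any with (o , c) , ∈Ls , o≡u , on-line ← find any =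
        Any.map (λ { ≡.refl → on-line }) (∈ₚ.∈-filter⁺ (λ x → proj₁ x Finₚ.≟ u) ∈Ls o≡u)

      ∈-lines : ∀ {q} {Q : Fin 4 × ℤ → Set q} u d ds → d ∈ ds → Any (λ (o , c) → Q (d , c)) (fiber u (Ls d)) → Any Q (lines u ds)
      ∈-lines u d (_ ∷ ds) (here ≡.refl) any = Anyₚ.++⁺ˡ (Anyₚ.map⁺ any)
      ∈-lines u d (e ∷ ds) (there d∈)    any = Anyₚ.++⁺ʳ (map (λ (o , c) → e , c) (fiber u (Ls e))) (∈-lines u d ds d∈ any)

      -- The points of a line of direction e with value v, indexed by j, against the lines of other directions.
      Meets : Fin 4 → ℤ → Fin p → Fin 4 × ℤ → Set
      Meets e v j (d , c) = d ≢ e × (v - slope e * + toℕ j + slope d * + toℕ j) ≈ c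

      -- The difference of the two slopes is invertible modulo p, so lines of different directions
      -- share at most one point.
      meets-injective : ∀ e v {j j′ ℓ} → Meets e v j ℓ → Meets e v j′ ℓ → j ≡ j′
      meets-injective e v {j} {j′} {d , c} (d≢e , on) (_ , on′) = *-cancel-residue (slope d - slope e) (slopes-distinct d≢e)
        (subst (+ p ∣_) (regroup v (slope e) (slope d) (+ toℕ j) (+ toℕ j′)) (≈-trans-sym (v - slope e * + toℕ j + slope d * + toℕ j) (v - slope e * + toℕ j′ + slope d * + toℕ j′) c on on′))
        where
        regroup : ∀ v e d j j′ → (v - e * j + d * j) - (v - e * j′ + d * j′) ≡ (d - e) * j - (d - e) * j′
        regroup = solve-∀

      uncovered-line : ∀ u e ds v → (∀ d → d ≢ e → d ∈ ds) → All (λ (o , c) → ¬ (v ≈ c)) (fiber u (Ls e)) →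
                       All (λ j → Any (Meets e v j) (lines u ds)) (allFin p)
      uncovered-line u e ds v others v∉ = All.tabulate (λ {j} _ → hit j (cover u (+ toℕ j) (v - slope e * + toℕ j)))
        where
        cancel : ∀ v e j c → (v - e * j + e * j) - c ≡ v - c
        cancel = solve-∀
        hit : ∀ j → ∃[ d ] Any (λ (o , c) → o ≡ u × (v - slope e * + toℕ j + slope d * + toℕ j) ≈ c) (Ls d) → Any (Meets e v j) (lines u ds)
        hit j (d , any) with d Finₚ.≟ e
        ... | no  d≢e    = ∈-lines u d ds (others d d≢e) (Any.map (d≢e ,_) (∈-fiber u (+ toℕ j) (v - slope e * + toℕ j) d any))
        ... | yes ≡.refl with (_ , c) , ∈fiber , on ← find (∈-fiber u (+ toℕ j) (v - slope e * + toℕ j) d any) =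
          contradiction (subst (+ p ∣_) (cancel v (slope d) (+ toℕ j) c) on) (All.lookup v∉ ∈fiber)

      -- Some line of direction `e` is missing from the list, and its p points must lie on p
      -- different lines of other directions.
      p≤other-lines : ∀ u e ds → (∀ d → d ≢ e → d ∈ ds) → count u e < p → p ≤ sum (map (count u) ds)
      p≤other-lines u e ds others few =
        let v , v∉ = missing-residue (map proj₂ (fiber u (Ls e))) (subst (_< p) (sym (Listₚ.length-map proj₂ (fiber u (Ls e)))) few)
        in subst₂ _≤_ (allFin-length p) (length-lines u ds)
             (Matching.length≤ (Meets e (+ toℕ v)) (meets-injective e (+ toℕ v)) (allFin p) (lines u ds) (Uniqueₚ.allFin⁺ p)
               (uncovered-line u e ds (+ toℕ v) others (Allₚ.map⁻ v∉)))

      -- For nonzero slope this is 2 / slope: from s j = c - v it recovers 2 j. The factor 2 keeps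
      -- slope 2 free of denominators.
      multiplier : Fin 4 → ℤ
      multiplier 0F = 0ℤ
      multiplier 1F = + 2
      multiplier 2F = -[1+ 1 ]
      multiplier 3F = 1ℤ

      multiplier-slope : ∀ d → d ≢ 0F → multiplier d * slope d ≡ + 2
      multiplier-slope 0F d≢0 = contradiction ≡.refl d≢0
      multiplier-slope 1F d≢0 = ≡.refl
      multiplier-slope 2F d≢0 = ≡.refl
      multiplier-slope 3F d≢0 = ≡.refl

      Σ-intersections : ∀ v (ls : List (Fin 4 × ℤ)) → Σ (λ (d , c) → multiplier d * (c - v)) ls ≡
                        Σ (λ (d , c) → multiplier d * c) ls - v * Σ (λ (d , c) → multiplier d) ls
      Σ-intersections v []             = sym (zero-case v)
        where
        zero-case : ∀ v → 0ℤ - v * 0ℤ ≡ 0ℤ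
        zero-case = solve-∀
      Σ-intersections v ((d , c) ∷ ls) = trans (cong (λ s → multiplier d * (c - v) + s) (Σ-intersections v ls))
        (regroup (multiplier d) c v (Σ (λ (d , c) → multiplier d * c) ls) (Σ (λ (d , c) → multiplier d) ls))
        where
        regroup : ∀ m c v s t → m * (c - v) + (s - v * t) ≡ (m * c + s) - v * (m + t)
        regroup = solve-∀

      Σ-multipliers : ∀ u ds → Σ (λ (d , c) → multiplier d) (lines u ds) ≡ Σ (λ d → multiplier d * + count u d) ds
      Σ-multipliers u []       = ≡.refl
      Σ-multipliers u (d ∷ ds) = trans (prefix (fiber u (Ls d))) (cong (λ s → multiplier d * + count u d + s) (Σ-multipliers u ds))
        where
        step : ∀ m l s → m + (m * l + s) ≡ m * (1ℤ + l) + s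
        step = solve-∀
        start : ∀ m s → s ≡ m * 0ℤ + s
        start = solve-∀
        prefix : ∀ xs → Σ (λ (d , c) → multiplier d) (map (λ (o , c) → d , c) xs ++ lines u ds) ≡
                 multiplier d * + length xs + Σ (λ (d , c) → multiplier d) (lines u ds)
        prefix []       = start (multiplier d) _
        prefix (x ∷ xs) = trans (cong (λ s → multiplier d + s) (prefix xs)) (step (multiplier d) (+ length xs) _)

      others₀ : List (Fin 4)
      others₀ = 1F ∷ 2F ∷ 3F ∷ []

      ∈-others₀ : ∀ d → d ≢ 0F → d ∈ others₀
      ∈-others₀ 0F d≢0 = contradiction ≡.refl d≢0
      ∈-others₀ 1F d≢0 = here ≡.refl
      ∈-others₀ 2F d≢0 = there (here ≡.refl)
      ∈-others₀ 3F d≢0 = there (there (here ≡.refl))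

      -- If the lines of nonzero slope are just p in number, each point of an uncovered line k = v lies on
      -- exactly one of them; summing 2 j over these points determines v modulo p.
      uncovered-value : ∀ u → sum (map (count u) others₀) ≡ p → Σ (λ d → multiplier d * + count u d) others₀ ≡ 1ℤ →
        ∀ v → All (λ (o , c) → ¬ (v ≈ c)) (fiber u (Ls 0F)) →
        Σ (λ j → + 2 * + toℕ j) (allFin p) ≈ Σ (λ (d , c) → multiplier d * c) (lines u others₀) - v
      uncovered-value u total≡p multipliers≡1 v v∉ = subst (λ s → Σ (λ j → + 2 * + toℕ j) (allFin p) ≈ s)
        (trans (Σ-intersections v (lines u others₀)) (cong (λ t → Σ (λ (d , c) → multiplier d * c) (lines u others₀) - t)
          (trans (cong (v *_) (trans (Σ-multipliers u others₀) multipliers≡1)) (ℤₚ.*-identityʳ v))))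
        (Matching.Σ≈Σ (Meets 0F v) (meets-injective 0F v) p (λ j → + 2 * + toℕ j) (λ (d , c) → multiplier d * (c - v)) meets-value
          (allFin p) (lines u others₀) (Uniqueₚ.allFin⁺ p) (uncovered-line u 0F others₀ v ∈-others₀ v∉)
          (ℕₚ.≤-reflexive (trans (length-lines u others₀) (trans total≡p (sym (allFin-length p))))))
        where
        meets-value : ∀ {j ℓ} → Meets 0F v j ℓ → + p ∣ + 2 * + toℕ j - multiplier (proj₁ ℓ) * (proj₂ ℓ - v)
        meets-value {j} {d , c} (d≢0 , on) = subst (+ p ∣_)
          (trans (regroup (multiplier d) v (slope d) (+ toℕ j) c) (cong (λ t → t * + toℕ j - multiplier d * (c - v)) (multiplier-slope d d≢0)))
          (∣n⇒∣m*n (multiplier d) on)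
          where
          regroup : ∀ m v s j c → m * ((v - 0ℤ * j + s * j) - c) ≡ (m * s) * j - m * (c - v)
          regroup = solve-∀

      -- By `uncovered-value` each uncovered v satisfies the same congruence, which determines it;
      -- but there is room for two.
      not-tight : ∀ u → suc (count u 0F) < p → sum (map (count u) others₀) ≡ p → Σ (λ d → multiplier d * + count u d) others₀ ≡ 1ℤ → ⊥
      not-tight u few total≡p multipliers≡1 =
        let cs = map proj₂ (fiber u (Ls 0F))
            |cs| = Listₚ.length-map proj₂ (fiber u (Ls 0F))
            v , v∉ = missing-residue cs (subst (_< p) (sym |cs|) (ℕₚ.<-trans (ℕₚ.n<1+n _) few))
            -- Putting `v` among the values to avoid makes `v′` a different one; this takes the
            -- extra `suc` in `few`.
            v′ , v′∉ = missing-residue (+ toℕ v ∷ cs) (subst (_< p) (cong suc (sym |cs|)) few)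
            determined = uncovered-value u total≡p multipliers≡1
        in All.head v′∉ (subst (+ p ∣_) (cancel (Σ (λ j → + 2 * + toℕ j) (allFin p)) (Σ (λ (d , c) → multiplier d * c) (lines u others₀)) (+ toℕ v′) (+ toℕ v))
             (∣m∣n⇒∣m-n (determined (+ toℕ v′) (Allₚ.map⁻ (All.tail v′∉))) (determined (+ toℕ v) (Allₚ.map⁻ v∉))))
        where
        cancel : ∀ s m v v′ → (s - (m - v)) - (s - (m - v′)) ≡ v - v′
        cancel = solve-∀

      weight : Fin P → ℕ
      weight t = count t 0F ℕ.+ count t 1F ℕ.+ count t 2F ℕ.+ count t 3F

      -- Either at least p lines of slope 0 are present, or one is missing and costs p lines of the
      -- other slopes.
      p≤weight : ∀ t → p ≤ weight t
      p≤weight t with count t 0F ℕₚ.<? p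
      ... | yes few = ℕₚ.≤-trans (p≤other-lines t 0F others₀ ∈-others₀ few)
                        (subst (sum (map (count t) others₀) ≤_) (regroup (count t 0F) (count t 1F) (count t 2F) (count t 3F)) (ℕₚ.m≤n+m _ (count t 0F)))
        where
        regroup : ∀ a b c d → a ℕ.+ (b ℕ.+ (c ℕ.+ (d ℕ.+ 0))) ≡ a ℕ.+ b ℕ.+ c ℕ.+ d
        regroup = ℕ-solve-∀
      ... | no ¬few = ℕₚ.≤-trans (ℕₚ.≮⇒≥ ¬few) (ℕₚ.≤-trans (ℕₚ.m≤m+n _ (count t 1F))
                        (ℕₚ.≤-trans (ℕₚ.m≤m+n _ (count t 2F)) (ℕₚ.m≤m+n _ (count t 3F))))

      Σ-weight : ∀ ts → sum (map weight ts) ≡ sum (map (λ t → count t 0F) ts) ℕ.+ sum (map (λ t → count t 1F) ts) ℕ.+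
                        sum (map (λ t → count t 2F) ts) ℕ.+ sum (map (λ t → count t 3F) ts)
      Σ-weight ts = trans (sum-map-+ (λ t → count t 0F ℕ.+ count t 1F ℕ.+ count t 2F) (λ t → count t 3F) ts)
        (cong (ℕ._+ sum (map (λ t → count t 3F) ts))
          (trans (sum-map-+ (λ t → count t 0F ℕ.+ count t 1F) (λ t → count t 2F) ts)
            (cong (ℕ._+ sum (map (λ t → count t 2F) ts)) (sum-map-+ (λ t → count t 0F) (λ t → count t 1F) ts))))

      Σ-count≤ : ∀ d → sum (map (λ t → count t d) (allFin P)) ≤ length (Ls d)
      Σ-count≤ d = sum-fibers (allFin P) (Ls d) (Uniqueₚ.allFin⁺ P)

      p-odd : ∀ h → p ≢ h ℕ.+ h
      p-odd h p≡2h = case prime⇒irreducible pp {2} (ℕ∣.divides h (trans p≡2h (double h))) of λ where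
          (inj₂ 2≡p) → contradiction 5≤p (ℕₚ.<⇒≱ (subst (_< 5) 2≡p (ℕₚ.m≤m+n 3 2)))
        where
        double : ∀ h → h ℕ.+ h ≡ h ℕ.* 2
        double = ℕ-solve-∀

      p≤complements : ∀ u → count u 0F < p → count u 1F < p → count u 2F < p →
            p ≤ count u 1F ℕ.+ count u 2F ℕ.+ count u 3F ×
            p ≤ count u 0F ℕ.+ count u 2F ℕ.+ count u 3F ×
            p ≤ count u 0F ℕ.+ count u 1F ℕ.+ count u 3F
      p≤complements u a<p b<p c<p =
        subst (p ≤_) (flat (count u 1F) _ _) (p≤other-lines u 0F others₀ ∈-others₀ a<p) ,
        subst (p ≤_) (flat (count u 0F) _ _) (p≤other-lines u 1F (0F ∷ 2F ∷ 3F ∷ []) others₁ b<p) ,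
        subst (p ≤_) (flat (count u 0F) _ _) (p≤other-lines u 2F (0F ∷ 1F ∷ 3F ∷ []) others₂ c<p)
        where
        flat : ∀ a b c → a ℕ.+ (b ℕ.+ (c ℕ.+ 0)) ≡ a ℕ.+ b ℕ.+ c
        flat = ℕ-solve-∀
        others₁ : ∀ d → d ≢ 1F → d ∈ 0F ∷ 2F ∷ 3F ∷ []
        others₁ 0F d≢1 = here ≡.refl
        others₁ 1F d≢1 = contradiction ≡.refl d≢1
        others₁ 2F d≢1 = there (here ≡.refl)
        others₁ 3F d≢1 = there (there (here ≡.refl))
        others₂ : ∀ d → d ≢ 2F → d ∈ 0F ∷ 1F ∷ 3F ∷ []
        others₂ 0F d≢2 = here ≡.refl
        others₂ 1F d≢2 = there (here ≡.refl)
        others₂ 2F d≢2 = contradiction ≡.refl d≢2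
        others₂ 3F d≢2 = there (there (here ≡.refl))

      -- The three lower bounds add up to the left side of the upper bound, so each is an equality.
      -- Then a = b = c and 2a + d = p, and d = 0 or d = 2 would make p even.
      tight-numbers : ∀ a b c d → p ≤ b ℕ.+ c ℕ.+ d → p ≤ a ℕ.+ c ℕ.+ d → p ≤ a ℕ.+ b ℕ.+ d → d ≤ 2 →
        2 ℕ.* (a ℕ.+ b ℕ.+ c ℕ.+ d) ℕ.+ d ≤ 3 ℕ.* p → b ≡ a × c ≡ a × d ≡ 1 × a ℕ.+ a ℕ.+ 1 ≡ p
      tight-numbers a b c d p≤bcd p≤acd p≤abd d≤2 ≤3p = b≡a , c≡a , proj₁ (finish d d≤2 aad≡p) , proj₂ (finish d d≤2 aad≡p)
        where
        total : ∀ a b c d → (b ℕ.+ c ℕ.+ d) ℕ.+ ((a ℕ.+ c ℕ.+ d) ℕ.+ (a ℕ.+ b ℕ.+ d)) ≡ 2 ℕ.* (a ℕ.+ b ℕ.+ c ℕ.+ d) ℕ.+ d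
        total = ℕ-solve-∀
        triple : ∀ p → 3 ℕ.* p ≡ p ℕ.+ (p ℕ.+ p)
        triple = ℕ-solve-∀
        sum≤ : (b ℕ.+ c ℕ.+ d) ℕ.+ ((a ℕ.+ c ℕ.+ d) ℕ.+ (a ℕ.+ b ℕ.+ d)) ≤ p ℕ.+ (p ℕ.+ p)
        sum≤ = subst₂ _≤_ (sym (total a b c d)) (triple p) ≤3p
        squeeze : ∀ {x y z} → p ≤ x → p ≤ y → p ≤ z → x ℕ.+ (y ℕ.+ z) ≤ p ℕ.+ (p ℕ.+ p) → x ≡ p × y ≡ p × z ≡ p
        squeeze {x} {y} {z} p≤x p≤y p≤z ≤pp =
          ℕₚ.≤-antisym (ℕₚ.+-cancelʳ-≤ (p ℕ.+ p) x p (ℕₚ.≤-trans (ℕₚ.+-monoʳ-≤ x (ℕₚ.+-mono-≤ p≤y p≤z)) ≤pp)) p≤x ,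
          ℕₚ.≤-antisym (ℕₚ.+-cancelʳ-≤ p y p (ℕₚ.+-cancelˡ-≤ p _ _ (ℕₚ.≤-trans (ℕₚ.+-mono-≤ p≤x (ℕₚ.+-monoʳ-≤ y p≤z)) ≤pp))) p≤y ,
          ℕₚ.≤-antisym (ℕₚ.+-cancelˡ-≤ p z p (ℕₚ.+-cancelˡ-≤ p _ _ (ℕₚ.≤-trans (ℕₚ.+-mono-≤ p≤x (ℕₚ.+-monoˡ-≤ z p≤y)) ≤pp))) p≤z
        equalities = squeeze p≤bcd p≤acd p≤abd sum≤
        b≡a : b ≡ a
        b≡a = ℕₚ.+-cancelʳ-≡ c b a (ℕₚ.+-cancelʳ-≡ d _ _ (trans (proj₁ equalities) (sym (proj₁ (proj₂ equalities)))))
        c≡a : c ≡ a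
        c≡a = trans (ℕₚ.+-cancelˡ-≡ a c b (ℕₚ.+-cancelʳ-≡ d _ _ (trans (proj₁ (proj₂ equalities)) (sym (proj₂ (proj₂ equalities)))))) b≡a
        aad≡p : a ℕ.+ a ℕ.+ d ≡ p
        aad≡p = trans (cong (λ x → a ℕ.+ x ℕ.+ d) (sym b≡a)) (proj₂ (proj₂ equalities))
        finish : ∀ d → d ≤ 2 → a ℕ.+ a ℕ.+ d ≡ p → d ≡ 1 × a ℕ.+ a ℕ.+ 1 ≡ p
        finish 0 _ eq = contradiction (trans (sym eq) (ℕₚ.+-identityʳ _)) (p-odd a)
        finish 1 _ eq = ≡.refl , eq
        finish 2 _ eq = contradiction (trans (sym eq) (double a)) (p-odd (suc a))
          where
          double : ∀ a → a ℕ.+ a ℕ.+ 2 ≡ suc a ℕ.+ suc a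
          double = ℕ-solve-∀
        finish (suc (suc (suc _))) (s≤s (s≤s ()))

      module _ (|A| : suc (length (Ls 0F)) ℕ.+ p ≤ P ℕ.* p) (|B| : suc (length (Ls 1F)) ≤ p)
               (|C| : suc (length (Ls 2F)) ≤ p) (|D| : length (Ls 3F) ≤ 2) where

        two-planes : ∀ u v vs → allFin P ↭ u ∷ v ∷ vs → count u 0F < p → count v 0F < p → ⊥
        two-planes u v vs ts↭′ au<p av<p = not-tight u a+1<p total≡p multipliers≡1
          where
          P≡ : P ≡ suc (suc (length vs))
          P≡ = trans (sym (allFin-length P)) (↭ₚ.↭-length ts↭′)
          split : ∀ (f : Fin P → ℕ) → sum (map f (allFin P)) ≡ f u ℕ.+ (f v ℕ.+ sum (map f vs))
          split f = sum-↭ (↭ₚ.map⁺ f ts↭′)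
          pair≤ : ∀ d → count u d ℕ.+ count v d ≤ length (Ls d)
          pair≤ d = ℕₚ.≤-trans (ℕₚ.≤-trans (ℕₚ.+-monoʳ-≤ (count u d) (ℕₚ.m≤m+n (count v d) _)) (ℕₚ.≤-reflexive (sym (split (λ t → count t d))))) (Σ-count≤ d)
          au = count u 0F
          bu = count u 1F
          cu = count u 2F
          du = count u 3F
          av = count v 0F
          bv = count v 1F
          cv = count v 2F
          dv = count v 3F
          u≤ : ∀ d → count u d ≤ length (Ls d)
          u≤ d = ℕₚ.≤-trans (ℕₚ.m≤m+n (count u d) (count v d)) (pair≤ d)
          v≤ : ∀ d → count v d ≤ length (Ls d)
          v≤ d = ℕₚ.≤-trans (ℕₚ.m≤n+m (count v d) (count u d)) (pair≤ d)
          u-bounds = p≤complements u au<p (ℕₚ.≤-<-trans (u≤ 1F) |B|) (ℕₚ.≤-<-trans (u≤ 2F) |C|)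
          v-bounds = p≤complements v av<p (ℕₚ.≤-<-trans (v≤ 1F) |B|) (ℕₚ.≤-<-trans (v≤ 2F) |C|)
          Σp≤ : ∀ ts → length ts ℕ.* p ≤ sum (map weight ts)
          Σp≤ []       = z≤n
          Σp≤ (t ∷ ts) = ℕₚ.+-mono-≤ (p≤weight t) (Σp≤ ts)
          -- At most P p + p - 1 lines exist in all, and each of the P - 2 other planes takes at
          -- least p of them.
          w≤ : suc (weight u ℕ.+ weight v) ≤ 3 ℕ.* p
          w≤ = ℕₚ.+-cancelʳ-≤ (length vs ℕ.* p ℕ.+ (2 ℕ.+ p)) _ _ (begin
            suc (weight u ℕ.+ weight v) ℕ.+ (length vs ℕ.* p ℕ.+ (2 ℕ.+ p))
              ≡⟨ regroup₁ (weight u) (weight v) (length vs ℕ.* p) p ⟩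
            3 ℕ.+ p ℕ.+ (weight u ℕ.+ (weight v ℕ.+ length vs ℕ.* p))
              ≤⟨ ℕₚ.+-monoʳ-≤ (3 ℕ.+ p) (ℕₚ.+-monoʳ-≤ (weight u) (ℕₚ.+-monoʳ-≤ (weight v) (Σp≤ vs))) ⟩
            3 ℕ.+ p ℕ.+ (weight u ℕ.+ (weight v ℕ.+ sum (map weight vs)))
              ≡⟨ cong (3 ℕ.+ p ℕ.+_) (trans (sym (split weight)) (Σ-weight (allFin P))) ⟩
            3 ℕ.+ p ℕ.+ (sum (map (λ t → count t 0F) (allFin P)) ℕ.+ sum (map (λ t → count t 1F) (allFin P)) ℕ.+
              sum (map (λ t → count t 2F) (allFin P)) ℕ.+ sum (map (λ t → count t 3F) (allFin P)))
              ≤⟨ ℕₚ.+-monoʳ-≤ (3 ℕ.+ p) (ℕₚ.+-mono-≤ (ℕₚ.+-mono-≤ (ℕₚ.+-mono-≤ (Σ-count≤ 0F) (Σ-count≤ 1F)) (Σ-count≤ 2F)) (Σ-count≤ 3F)) ⟩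
            3 ℕ.+ p ℕ.+ (length (Ls 0F) ℕ.+ length (Ls 1F) ℕ.+ length (Ls 2F) ℕ.+ length (Ls 3F))
              ≡⟨ regroup₂ p (length (Ls 0F)) (length (Ls 1F)) (length (Ls 2F)) (length (Ls 3F)) ⟩
            (suc (length (Ls 0F)) ℕ.+ p) ℕ.+ (suc (length (Ls 1F)) ℕ.+ (suc (length (Ls 2F)) ℕ.+ length (Ls 3F)))
              ≤⟨ ℕₚ.+-mono-≤ |A| (ℕₚ.+-mono-≤ |B| (ℕₚ.+-mono-≤ |C| |D|)) ⟩
            P ℕ.* p ℕ.+ (p ℕ.+ (p ℕ.+ 2))
              ≡⟨ cong (λ m → m ℕ.* p ℕ.+ (p ℕ.+ (p ℕ.+ 2))) P≡ ⟩
            suc (suc (length vs)) ℕ.* p ℕ.+ (p ℕ.+ (p ℕ.+ 2))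
              ≡⟨ regroup₃ p (length vs ℕ.* p) ⟩
            3 ℕ.* p ℕ.+ (length vs ℕ.* p ℕ.+ (2 ℕ.+ p)) ∎)
            where
            open ℕₚ.≤-Reasoning
            regroup₁ : ∀ w w′ m p → suc (w ℕ.+ w′) ℕ.+ (m ℕ.+ (2 ℕ.+ p)) ≡ 3 ℕ.+ p ℕ.+ (w ℕ.+ (w′ ℕ.+ m))
            regroup₁ = ℕ-solve-∀
            regroup₂ : ∀ p a b c d → 3 ℕ.+ p ℕ.+ (a ℕ.+ b ℕ.+ c ℕ.+ d) ≡ (suc a ℕ.+ p) ℕ.+ (suc b ℕ.+ (suc c ℕ.+ d))
            regroup₂ = ℕ-solve-∀
            regroup₃ : ∀ p m → p ℕ.+ (p ℕ.+ m) ℕ.+ (p ℕ.+ (p ℕ.+ 2)) ≡ 3 ℕ.* p ℕ.+ (m ℕ.+ (2 ℕ.+ p))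
            regroup₃ = ℕ-solve-∀
          lower : ∀ {a b c d} → p ≤ b ℕ.+ c ℕ.+ d × p ≤ a ℕ.+ c ℕ.+ d × p ≤ a ℕ.+ b ℕ.+ d → 3 ℕ.* p ≤ 2 ℕ.* (a ℕ.+ b ℕ.+ c ℕ.+ d) ℕ.+ d
          lower {a} {b} {c} {d} (x , y , z) = subst₂ _≤_ (sym (triple p)) (total a b c d) (ℕₚ.+-mono-≤ x (ℕₚ.+-mono-≤ y z))
            where
            total : ∀ a b c d → (b ℕ.+ c ℕ.+ d) ℕ.+ ((a ℕ.+ c ℕ.+ d) ℕ.+ (a ℕ.+ b ℕ.+ d)) ≡ 2 ℕ.* (a ℕ.+ b ℕ.+ c ℕ.+ d) ℕ.+ d
            total = ℕ-solve-∀
            triple : ∀ p → 3 ℕ.* p ≡ p ℕ.+ (p ℕ.+ p)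
            triple = ℕ-solve-∀
          -- Doubling `w≤` loses 2, exactly what du + dv ≤ 2 gives back; what remains of 6p after
          -- the lower bound 3p for plane `v` is 3p.
          upper : 2 ℕ.* weight u ℕ.+ du ≤ 3 ℕ.* p
          upper = ℕₚ.+-cancelʳ-≤ (3 ℕ.* p) _ _ (begin
            2 ℕ.* weight u ℕ.+ du ℕ.+ 3 ℕ.* p                             ≤⟨ ℕₚ.+-monoʳ-≤ (2 ℕ.* weight u ℕ.+ du) (lower {av} {bv} {cv} {dv} v-bounds) ⟩
            2 ℕ.* weight u ℕ.+ du ℕ.+ (2 ℕ.* weight v ℕ.+ dv)             ≡⟨ regroup (weight u) du (weight v) dv ⟩
            2 ℕ.* (weight u ℕ.+ weight v) ℕ.+ (du ℕ.+ dv)                 ≤⟨ ℕₚ.+-monoʳ-≤ _ (ℕₚ.≤-trans (pair≤ 3F) |D|) ⟩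
            2 ℕ.* (weight u ℕ.+ weight v) ℕ.+ 2                           ≡⟨ trans (ℕₚ.+-comm _ 2) (sym (ℕₚ.*-suc 2 _)) ⟩
            2 ℕ.* suc (weight u ℕ.+ weight v)                             ≤⟨ ℕₚ.*-monoʳ-≤ 2 w≤ ⟩
            2 ℕ.* (3 ℕ.* p)                                               ≡⟨ cong (3 ℕ.* p ℕ.+_) (ℕₚ.+-identityʳ _) ⟩
            3 ℕ.* p ℕ.+ 3 ℕ.* p                                           ∎)
            where
            open ℕₚ.≤-Reasoning
            regroup : ∀ w d w′ d′ → 2 ℕ.* w ℕ.+ d ℕ.+ (2 ℕ.* w′ ℕ.+ d′) ≡ 2 ℕ.* (w ℕ.+ w′) ℕ.+ (d ℕ.+ d′)
            regroup = ℕ-solve-∀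
          tight = tight-numbers au bu cu du (proj₁ u-bounds) (proj₁ (proj₂ u-bounds)) (proj₂ (proj₂ u-bounds))
                    (ℕₚ.≤-trans (u≤ 3F) |D|) upper
          bu≡ = proj₁ tight
          cu≡ = proj₁ (proj₂ tight)
          du≡ = proj₁ (proj₂ (proj₂ tight))
          p≡ = proj₂ (proj₂ (proj₂ tight))
          2≤ : ∀ a → a ℕ.+ a ℕ.+ 1 ≡ p → 2 ≤ a
          2≤ 0             eq = contradiction 5≤p (ℕₚ.<⇒≱ (subst (_< 5) eq (ℕₚ.m≤m+n 2 3)))
          2≤ 1             eq = contradiction 5≤p (ℕₚ.<⇒≱ (subst (_< 5) eq (ℕₚ.m≤m+n 4 1)))
          2≤ (suc (suc _)) eq = s≤s (s≤s z≤n)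
          a+1<p : suc au < p
          a+1<p = ℕₚ.≤-trans (ℕₚ.≤-trans (ℕₚ.+-monoˡ-≤ au (2≤ au p≡)) (ℕₚ.m≤m+n (au ℕ.+ au) 1)) (ℕₚ.≤-reflexive p≡)
          total≡p : sum (map (count u) others₀) ≡ p
          total≡p = trans (cong₂ (λ b c → b ℕ.+ (c ℕ.+ (du ℕ.+ 0))) bu≡ cu≡) (trans (cong (λ d → au ℕ.+ (au ℕ.+ (d ℕ.+ 0))) du≡) (trans (sym (ℕₚ.+-assoc au au 1)) p≡))
          multipliers≡1 : Σ (λ d → multiplier d * + count u d) others₀ ≡ 1ℤ
          multipliers≡1 = trans (cong₂ (λ b c → + 2 * + b + (-[1+ 1 ] * + c + (1ℤ * + du + 0ℤ))) bu≡ cu≡)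
            (trans (cong (λ d → + 2 * + au + (-[1+ 1 ] * + au + (1ℤ * + d + 0ℤ))) du≡) (cancel (+ au)))
            where
            cancel : ∀ a → + 2 * a + (- + 2 * a + (1ℤ * 1ℤ + 0ℤ)) ≡ 1ℤ
            cancel = solve-∀

        -- There are fewer than (P - 1) p lines of slope 0, so after one plane with fewer than p of
        -- them is set aside, the others still average below p and provide a second.
        no-cover : ⊥
        no-cover = first (∃-below-average (λ t → count t 0F) p (allFin P)
            (ℕₚ.≤-<-trans (Σ-count≤ 0F) (ℕₚ.<-≤-trans (ℕₚ.≤-trans (ℕₚ.m≤m+n _ p) |A|) (ℕₚ.≤-reflexive (cong (ℕ._* p) (sym (allFin-length P)))))))
          where
          first : (∃₂ λ u us → allFin P ↭ u ∷ us × count u 0F < p) → ⊥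
          first (u , us , ts↭ , au<p) =
            let v , vs , us↭ , av<p = ∃-below-average (λ t → count t 0F) p us (ℕₚ.≤-<-trans Σus≤ |A|<)
            in two-planes u v vs (↭-trans ts↭ (prep u us↭)) au<p av<p
            where
            P≡ : P ≡ suc (length us)
            P≡ = trans (sym (allFin-length P)) (↭ₚ.↭-length ts↭)
            |A|< : length (Ls 0F) < length us ℕ.* p
            |A|< = ℕₚ.+-cancelʳ-≤ p _ _ (subst (suc (length (Ls 0F)) ℕ.+ p ≤_) (trans (cong (ℕ._* p) P≡) (ℕₚ.+-comm p _)) |A|)
            Σus≤ : sum (map (λ t → count t 0F) us) ≤ length (Ls 0F)
            Σus≤ = ℕₚ.≤-trans (ℕₚ.m≤n+m _ (count u 0F)) (ℕₚ.≤-trans (ℕₚ.≤-reflexive (sym (sum-↭ (↭ₚ.map⁺ (λ t → count t 0F) ts↭)))) (Σ-count≤ 0F))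

-- A good sequence of length pn + p - 1 for p ≥ 5 and n ≥ 2.

module GoodSequences where
  open Fields
  open Groups
  open Lists
  open GroupAlgebras
  open RootsOfUnity
  open UncoverablePlanes
  open import Data.Nat as ℕ using (ℕ; zero; suc; NonZero; _≤_; _<_; s≤s; z≤n)
  open import Data.Nat.DivMod using (_mod_)
  open import Data.Nat.Primality using (Prime)
  open import Data.Nat.Tactic.RingSolver using () renaming (solve-∀ to ℕ-solve-∀)
  open import Data.Integer as ℤ using (ℤ; +_; 0ℤ)
  open import Data.Integer.DivMod using (_%ℕ_; _/ℕ_; a≡a%ℕn+[a/ℕn]*n)
  open import Data.Integer.Divisibility.Signed as ℤ∣ using (divides; _∣?_; ∣m∣n⇒∣m+n; ∣m⇒∣-m; ∣n⇒∣m*n)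
  open import Data.Integer.Tactic.RingSolver using (solve-∀)
  open import Data.Fin as Fin using (Fin; zero; suc; toℕ)
  open import Data.Fin.Patterns using (0F; 1F; 2F; 3F)
  open import Data.List using (List; []; _∷_; _++_; length; map; lookup; replicate)
  open import Relation.Nullary.Decidable using (decidable-stable; _×-dec_; ¬¬-excluded-middle)
  open import Relation.Binary.PropositionalEquality as ≡ using (_≡_)

  module _ {a b} {A : Set a} {B : Set b} where

    map-proj₁-++ : ∀ xs ys (ps : List (A × B)) → map proj₁ ps ≡ xs ++ ys →
                   ∃₂ λ qs rs → ps ≡ qs ++ rs × map proj₁ qs ≡ xs × map proj₁ rs ≡ ys
    map-proj₁-++ []       ys ps       eq = [] , ps , ≡.refl , ≡.refl , eq
    map-proj₁-++ (x ∷ xs) ys (p ∷ ps) eq =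
      let qs , rs , ps≡ , qs≡ , rs≡ = map-proj₁-++ xs ys ps (Listₚ.∷-injectiveʳ eq)
      in p ∷ qs , rs , ≡.cong (p ∷_) ps≡ , ≡.cong₂ _∷_ (Listₚ.∷-injectiveˡ eq) qs≡ , rs≡

    map-proj₁-replicate : ∀ m x (ps : List (A × B)) → map proj₁ ps ≡ replicate m x →
                          ∃[ bs ] (ps ≡ map (x ,_) bs × length bs ≡ m)
    map-proj₁-replicate zero    x []             eq = [] , ≡.refl , ≡.refl
    map-proj₁-replicate (suc m) x ((y , b) ∷ ps) eq with ≡.refl ← Listₚ.∷-injectiveˡ eq =
      let bs , ps≡ , |bs| = map-proj₁-replicate m x ps (Listₚ.∷-injectiveʳ eq)
      in b ∷ bs , ≡.cong ((x , b) ∷_) ps≡ , ≡.cong suc |bs|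

  module Counterexample {c ℓ : Level} (K : CommutativeRing c ℓ) (K-field : IsField K)
                        (p n : ℕ) (pp : Prime p) .{{p≢0 : NonZero p}} .{{n≢0 : NonZero n}} .{{N≢0 : NonZero (p ℕ.* n)}}
                        (roots : HasExactlyRootsOfUnity K (p ℕ.* n)) (5≤p : 5 ≤ p) (2≤n : 2 ≤ n) where
    open Grp p (p ℕ.* n)
    open Grp.GroupAlgebra p (p ℕ.* n) K
    open CommutativeRing K hiding (zero)
    open FieldLemmas K K-field
    open Characters K K-field p (p ℕ.* n)
    open Roots K K-field p n pp roots using (N; root; root^N; class-≡; planes; planes-distinct; |planes|≡n; θ; θ^p≈1; θ^N≈1;
      N-root≉0; θ^-injective-≤; *-root; ^-root)
    open PlaneCovers p pp 5≤p using (slope; no-cover) renaming (_≈_ to _≈ₚ_; ≈-trans-sym to ≈ₚ-trans-sym)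
    open import Relation.Binary.Reasoning.Setoid setoid

    Plane : Set
    Plane = Fin (length planes)

    r : Plane → Carrier
    r u = root (lookup planes u)

    exponent : Fin 4 → ℕ
    exponent 0F = 0
    exponent 1F = 1
    exponent 2F = ℕ.pred p
    exponent 3F = 2

    exponent<p : ∀ d → exponent d < p
    exponent<p 0F = ℕₚ.≤-trans (s≤s z≤n) 5≤p
    exponent<p 1F = ℕₚ.≤-trans (ℕₚ.m≤m+n 2 3) 5≤p
    exponent<p 2F = ℕₚ.≤-reflexive (ℕₚ.suc-pred p)
    exponent<p 3F = ℕₚ.≤-trans (ℕₚ.m≤m+n 3 2) 5≤p

    exponent≈slope : ∀ d → + exponent d ≈ₚ slope d
    exponent≈slope 0F = divides 0ℤ ≡.refl
    exponent≈slope 1F = divides 0ℤ ≡.refl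
    exponent≈slope 2F = divides (+ 1) (≡.trans (≡.cong +_ (≡.trans (ℕₚ.+-comm (ℕ.pred p) 1) (ℕₚ.suc-pred p))) (≡.sym (ℤₚ.*-identityˡ (+ p))))
    exponent≈slope 3F = divides 0ℤ ≡.refl

    element : Fin 4 → G
    element d = exponent d mod p , 1 mod (p ℕ.* n)

    value : Plane → ℕ → ℕ → G → Carrier
    value u j k = χ (θ ^ j) (r u * θ ^ k)

    1<N : 1 < p ℕ.* n
    1<N = ℕₚ.≤-trans (ℕₚ.≤-trans (ℕₚ.m≤m+n 2 3) 5≤p) (ℕₚ.m≤m*n p n)

    value-element : ∀ u j k d → value u j k (element d) ≈ r u * θ ^ (k ℕ.+ exponent d ℕ.* j)
    value-element u j k d = begin
      (θ ^ j) ^ toℕ (exponent d mod p) * (r u * θ ^ k) ^ toℕ (1 mod (p ℕ.* n))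
        ≡⟨ ≡.cong₂ (λ x y → (θ ^ j) ^ x * (r u * θ ^ k) ^ y) (toℕ-mod-small p (exponent<p d)) (toℕ-mod-small (p ℕ.* n) 1<N) ⟩
      (θ ^ j) ^ exponent d * ((r u * θ ^ k) * 1#)
        ≈⟨ *-cong (trans (sym (^-* θ j (exponent d))) (reflexive (≡.cong (θ ^_) (ℕₚ.*-comm j (exponent d))))) (*-identityʳ _) ⟩
      θ ^ (exponent d ℕ.* j) * (r u * θ ^ k)
        ≈⟨ trans (*-comm _ _) (*-assoc _ _ _) ⟩
      r u * (θ ^ k * θ ^ (exponent d ℕ.* j))
        ≈⟨ *-congˡ (sym (^-+ θ k (exponent d ℕ.* j))) ⟩
      r u * θ ^ (k ℕ.+ exponent d ℕ.* j) ∎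

    r≉0 : ∀ u → ¬ (r u ≈ 0#)
    r≉0 u = N-root≉0 (root^N (lookup planes u))

    p-th-power : ∀ u e → (r u * θ ^ e) ^ p ≈ r u ^ p
    p-th-power u e = begin
      (r u * θ ^ e) ^ p      ≈⟨ *-^ (r u) (θ ^ e) p ⟩
      r u ^ p * (θ ^ e) ^ p  ≈⟨ *-congˡ (trans (sym (^-* θ e p)) (^-∣ θ^p≈1 (ℕ∣.divides e ≡.refl))) ⟩
      r u ^ p * 1#           ≈⟨ *-identityʳ _ ⟩
      r u ^ p                ∎

    -- Every element used has second coordinate 1, so its values keep the factor `r u`, whose p-th
    -- power identifies the plane. Hence one scalar is attained in at most one plane.
    same-plane : ∀ u u′ e e′ → r u * θ ^ e ≈ r u′ * θ ^ e′ → u ≡ u′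
    same-plane u u′ e e′ eq = lookup-injective ≡.sym planes-distinct u u′ (class-≡ (lookup planes u) (lookup planes u′)
      (trans (sym (p-th-power u e)) (trans (^-cong p eq) (p-th-power u′ e′))))

    ∣∸⇒≈ₚ : ∀ {a b} → a ≤ b → p ℕ∣.∣ b ℕ.∸ a → + b ≈ₚ + a
    ∣∸⇒≈ₚ {a} {b} a≤b (ℕ∣.divides q eq) = divides (+ q) (≡.trans (≡.cong (ℤ._- + a) b≡) (≡.trans (cancel (+ a) (+ (q ℕ.* p))) (ℤₚ.pos-* q p)))
      where
      b≡ : + b ≡ + a ℤ.+ + (q ℕ.* p)
      b≡ = ≡.trans (≡.cong +_ (≡.trans (≡.sym (ℕₚ.m+[n∸m]≡n a≤b)) (≡.cong (a ℕ.+_) eq))) (ℤₚ.pos-+ a (q ℕ.* p))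
      cancel : ∀ a b → (a ℤ.+ b) ℤ.- a ≡ b
      cancel = solve-∀

    same-exponent : ∀ u e e′ → r u * θ ^ e ≈ r u * θ ^ e′ → + e ≈ₚ + e′
    same-exponent u e e′ eq with ℕₚ.≤-total e e′
    ... | inj₁ e≤e′ = ≡.subst (+ p ℤ∣.∣_) (negate (+ e′) (+ e)) (∣m⇒∣-m (∣∸⇒≈ₚ e≤e′ (θ^-injective-≤ e≤e′ (*-cancelˡ (r≉0 u) eq))))
      where
      negate : ∀ a b → ℤ.- (a ℤ.- b) ≡ b ℤ.- a
      negate = solve-∀
    ... | inj₂ e′≤e = ∣∸⇒≈ₚ e′≤e (θ^-injective-≤ e′≤e (sym (*-cancelˡ (r≉0 u) eq)))

    Through : Plane → ℕ → ℕ → Fin 4 → Plane × ℤ → Set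
    Through u j k d (o , c) = o ≡ u × (+ k ℤ.+ slope d ℤ.* + j) ≈ₚ c

    line-of : ∀ d a → (∃[ u ] ∃₂ λ j k → value u j k (element d) ≈ a) →
              ∃ λ (line : Plane × ℤ) → ∀ u j k → value u j k (element d) ≈ a → Through u j k d line
    line-of d a (u , j , k , hit) = (u , + (k ℕ.+ exponent d ℕ.* j)) , λ u′ j′ k′ hit′ →
      let eq = trans (sym (value-element u′ j′ k′ d)) (trans hit′ (trans (sym hit) (value-element u j k d)))
      in through u′ j′ k′ (same-plane u′ u (k′ ℕ.+ exponent d ℕ.* j′) (k ℕ.+ exponent d ℕ.* j) eq) eq
      where
      through : ∀ u′ j′ k′ → u′ ≡ u → r u′ * θ ^ (k′ ℕ.+ exponent d ℕ.* j′) ≈ r u * θ ^ (k ℕ.+ exponent d ℕ.* j) →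
                Through u′ j′ k′ d (u , + (k ℕ.+ exponent d ℕ.* j))
      through u′ j′ k′ ≡.refl eq = ≡.refl , ≡.subst (+ p ℤ∣.∣_) (regroup (+ k′) (+ j′) (slope d) (+ exponent d) (+ (k ℕ.+ exponent d ℕ.* j)))
        (∣m∣n⇒∣m+n (≡.subst (_≈ₚ + (k ℕ.+ exponent d ℕ.* j)) exponent≡ (same-exponent u (k′ ℕ.+ exponent d ℕ.* j′) (k ℕ.+ exponent d ℕ.* j) eq)) (∣m⇒∣-m (∣n⇒∣m*n (+ j′) (exponent≈slope d))))
        where
        exponent≡ : + (k′ ℕ.+ exponent d ℕ.* j′) ≡ + k′ ℤ.+ + exponent d ℤ.* + j′
        exponent≡ = ≡.trans (ℤₚ.pos-+ k′ _) (≡.cong (λ e → + k′ ℤ.+ e) (ℤₚ.pos-* (exponent d) j′))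
        regroup : ∀ k j s x c → (k ℤ.+ x ℤ.* j ℤ.- c) ℤ.+ ℤ.- (j ℤ.* (x ℤ.- s)) ≡ k ℤ.+ s ℤ.* j ℤ.- c
        regroup = solve-∀

    -- Whether a scalar a is a value of a character at element d is not decidable in K, but the final
    -- contradiction may assume it decided; a scalar that is no such value gets an arbitrary line.
    line : ∀ u₀ d a → ¬ ¬ (∃ λ (line : Plane × ℤ) → ∀ u j k → value u j k (element d) ≈ a → Through u j k d line)
    line u₀ d a none = ¬¬-excluded-middle {A = ∃[ u ] ∃₂ λ j k → value u j k (element d) ≈ a} λ where
      (yes hit) → none (line-of d a hit)
      (no ¬hit) → none ((u₀ , 0ℤ) , λ u j k hit → contradiction (u , j , k , hit) ¬hit)

    Lines : Fin 4 → List Carrier → List (Plane × ℤ) → Set (c ⊔ ℓ)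
    Lines d as ls = length ls ≡ length as ×
      (∀ u j k → Any (λ a → value u j k (element d) ≈ a) as → Any (Through u j k d) ls)

    lines : ∀ u₀ d as → ¬ ¬ (∃[ ls ] Lines d as ls)
    lines u₀ d []       none = none ([] , ≡.refl , λ u j k ())
    lines u₀ d (a ∷ as) none = line u₀ d a λ (l , l-through) → lines u₀ d as λ (ls , |ls| , ls-through) →
      none (l ∷ ls , ≡.cong suc |ls| , λ where
        u j k (here hit)  → here (l-through u j k hit)
        u j k (there any) → there (ls-through u j k any))

    block : ℕ → Fin 4 → List G
    block m d = replicate m (element d)

    sequence : ℕ → ℕ → ℕ → ℕ → List G
    sequence m₀ m₁ m₂ m₃ = block m₀ 0F ++ (block m₁ 1F ++ (block m₂ 2F ++ block m₃ 3F))

    Hit : Plane → ℕ → ℕ → List (G × Carrier) → Set (c ⊔ ℓ)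
    Hit u j k = Any (λ (g , a) → value u j k g ≈ a)

    family : ∀ {a} {A : Set a} → A → A → A → A → Fin 4 → A
    family x₀ x₁ x₂ x₃ 0F = x₀
    family x₀ x₁ x₂ x₃ 1F = x₁
    family x₀ x₁ x₂ x₃ 2F = x₂
    family x₀ x₁ x₂ x₃ 3F = x₃

    assemble : List Carrier → List Carrier → List Carrier → List Carrier → List (G × Carrier)
    assemble as bs cs ds = map (element 0F ,_) as ++ (map (element 1F ,_) bs ++
      (map (element 2F ,_) cs ++ map (element 3F ,_) ds))

    split : ∀ m₀ m₁ m₂ m₃ ps → map proj₁ ps ≡ sequence m₀ m₁ m₂ m₃ →
            ∃₂ λ (as bs : List Carrier) → ∃₂ λ (cs ds : List Carrier) → length as ≡ m₀ × length bs ≡ m₁ × length cs ≡ m₂ × length ds ≡ m₃ ×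
            ps ≡ assemble as bs cs ds
    split m₀ m₁ m₂ m₃ ps eq =
      let ps₀ , qs₀ , ps≡ , ps₀≡ , qs₀≡ = map-proj₁-++ (block m₀ 0F) _ ps eq
          ps₁ , qs₁ , qs₀≡′ , ps₁≡ , qs₁≡ = map-proj₁-++ (block m₁ 1F) _ qs₀ qs₀≡
          ps₂ , ps₃ , qs₁≡′ , ps₂≡ , ps₃≡ = map-proj₁-++ (block m₂ 2F) _ qs₁ qs₁≡
          as , ps₀≡′ , |as| = map-proj₁-replicate m₀ _ ps₀ ps₀≡
          bs , ps₁≡′ , |bs| = map-proj₁-replicate m₁ _ ps₁ ps₁≡
          cs , ps₂≡′ , |cs| = map-proj₁-replicate m₂ _ ps₂ ps₂≡
          ds , ps₃≡′ , |ds| = map-proj₁-replicate m₃ _ ps₃ ps₃≡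
      in as , bs , cs , ds , |as| , |bs| , |cs| , |ds| ,
         ≡.trans ps≡ (≡.cong₂ _++_ ps₀≡′ (≡.trans qs₀≡′ (≡.cong₂ _++_ ps₁≡′ (≡.trans qs₁≡′ (≡.cong₂ _++_ ps₂≡′ ps₃≡′)))))

    hit-direction : ∀ u j k as bs cs ds → Hit u j k (assemble as bs cs ds) →
                    ∃[ d ] Any (λ a → value u j k (element d) ≈ a) (family as bs cs ds d)
    hit-direction u j k as bs cs ds hit with Anyₚ.++⁻ (map (element 0F ,_) as) hit
    ... | inj₁ h = 0F , Anyₚ.map⁻ {f = element 0F ,_} h
    ... | inj₂ hit′ with Anyₚ.++⁻ (map (element 1F ,_) bs) hit′
    ... | inj₁ h = 1F , Anyₚ.map⁻ {f = element 1F ,_} h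
    ... | inj₂ hit″ with Anyₚ.++⁻ (map (element 2F ,_) cs) hit″
    ... | inj₁ h = 2F , Anyₚ.map⁻ {f = element 2F ,_} h
    ... | inj₂ h = 3F , Anyₚ.map⁻ {f = element 3F ,_} h

    -- Characters have natural exponents, points of the plane argument integer coordinates; lines
    -- only see residues modulo p.
    through-ℤ : ∀ d (Ls : Fin 4 → List (Plane × ℤ)) u j k → Any (Through u (j %ℕ p) (k %ℕ p) d) (Ls d) →
                Any (λ (o , c) → o ≡ u × (k ℤ.+ slope d ℤ.* j) ≈ₚ c) (Ls d)
    through-ℤ d Ls u j k = Any.map λ { {o , c} (o≡u , on) → o≡u ,
        ≡.subst (+ p ℤ∣.∣_) (regroup (+ (k %ℕ p)) (+ (j %ℕ p)) (slope d) k j c)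
          (∣m∣n⇒∣m+n on (∣m∣n⇒∣m+n (reduce k) (∣n⇒∣m*n (slope d) (reduce j)))) }
      where
      reduce : ∀ j → j ≈ₚ + (j %ℕ p)
      reduce j = divides (j /ℕ p) (≡.trans (≡.cong (ℤ._- + (j %ℕ p)) (a≡a%ℕn+[a/ℕn]*n j p)) (cancel (+ (j %ℕ p)) (j /ℕ p ℤ.* + p)))
        where
        cancel : ∀ a b → (a ℤ.+ b) ℤ.- a ≡ b
        cancel = solve-∀
      regroup : ∀ k′ j′ s k j c → (k′ ℤ.+ s ℤ.* j′ ℤ.- c) ℤ.+ ((k ℤ.- k′) ℤ.+ s ℤ.* (j ℤ.- j′)) ≡ k ℤ.+ s ℤ.* j ℤ.- c
      regroup = solve-∀

    u₀ : Plane
    u₀ = Fin.fromℕ< (≡.subst (0 <_) (≡.sym |planes|≡n) (ℕₚ.≤-trans (s≤s z≤n) 2≤n))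

    Bounds : (Fin 4 → ℕ) → Set
    Bounds m = suc (m 0F) ℕ.+ p ≤ n ℕ.* p × suc (m 1F) ≤ p × suc (m 2F) ≤ p × m 3F ≤ 2

    -- Incidence of points and lines is decidable, so the doubly negated covering inherited from K
    -- becomes a genuine one at this point.
    lines-miss : ∀ (Ls : Fin 4 → List (Plane × ℤ)) → Bounds (length ∘ Ls) →
                 ¬ (∀ u j k → ¬ ¬ (∃[ d ] Any (Through u j k d) (Ls d)))
    lines-miss Ls (b₀ , b₁ , b₂ , b₃) cover = no-cover Ls
      (λ u j k → let d , any = decidable-stable (Finₚ.any? λ d → any? (through? u (j %ℕ p) (k %ℕ p) d) (Ls d)) (cover u (j %ℕ p) (k %ℕ p))
                 in d , through-ℤ d Ls u j k any)
      (≡.subst (λ P → suc (length (Ls 0F)) ℕ.+ p ≤ P ℕ.* p) (≡.sym |planes|≡n) b₀) b₁ b₂ b₃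
      where
      through? : ∀ u j k d line → Dec (Through u j k d line)
      through? u j k d (o , c) = (o Finₚ.≟ u) ×-dec (+ p ∣? (+ k ℤ.+ slope d ℤ.* + j ℤ.- c))

    nonvanishing : ∀ m₀ m₁ m₂ m₃ → Bounds (family m₀ m₁ m₂ m₃) → Nonvanishing (sequence m₀ m₁ m₂ m₃)
    nonvanishing m₀ m₁ m₂ m₃ bounds ps elements nonzero zero-product = refute (split m₀ m₁ m₂ m₃ ps elements)
      where
      hits : ∀ u j k → ¬ ¬ Hit u j k ps
      hits u j k = isZero⇒hit {θ ^ j} {r u * θ ^ k} (trans (sym (^-* θ j p)) (^-∣ θ^p≈1 (ℕ∣.divides j ≡.refl)))
        (*-root N (root^N (lookup planes u)) (^-root k θ^N≈1)) ps zero-product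
      refute : ¬ (∃₂ λ (as bs : List Carrier) → ∃₂ λ (cs ds : List Carrier) →
                  length as ≡ m₀ × length bs ≡ m₁ × length cs ≡ m₂ × length ds ≡ m₃ × ps ≡ assemble as bs cs ds)
      refute (as , bs , cs , ds , ≡.refl , ≡.refl , ≡.refl , ≡.refl , ps≡) =
        -- The goal is absurdity, so the four doubly negated lists of lines may be taken as given.
        lines u₀ 0F as λ (l₀ , |l₀| , through₀) → lines u₀ 1F bs λ (l₁ , |l₁| , through₁) →
        lines u₀ 2F cs λ (l₂ , |l₂| , through₂) → lines u₀ 3F ds λ (l₃ , |l₃| , through₃) →
        let b₀ , b₁ , b₂ , b₃ = bounds
            transport : ∀ u j k d → Any (λ a → value u j k (element d) ≈ a) (family as bs cs ds d) → Any (Through u j k d) (family l₀ l₁ l₂ l₃ d)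
            transport u j k = λ where
              0F → through₀ u j k
              1F → through₁ u j k
              2F → through₂ u j k
              3F → through₃ u j k
        in lines-miss (family l₀ l₁ l₂ l₃)
             (≡.subst (λ m → suc m ℕ.+ p ≤ n ℕ.* p) (≡.sym |l₀|) b₀ , ≡.subst (λ m → suc m ≤ p) (≡.sym |l₁|) b₁ ,
              ≡.subst (λ m → suc m ≤ p) (≡.sym |l₂|) b₂ , ≡.subst (_≤ 2) (≡.sym |l₃|) b₃)
             (λ u j k none → hits u j k (λ hit →
               let d , any = hit-direction u j k as bs cs ds (≡.subst (Hit u j k) ps≡ hit) in none (d , transport u j k d any)))

    good-sequence : ∃[ S ] (Good S × suc (length S) ≡ p ℕ.* n ℕ.+ p)
    good-sequence = sequence m₀ (ℕ.pred p) (ℕ.pred p) 2 ,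
      nonvanishing⇒good (nonvanishing m₀ (ℕ.pred p) (ℕ.pred p) 2 (ℕₚ.≤-reflexive (≡.trans (≡.cong (ℕ._+ p) suc-m₀) n-1) ,
        ℕₚ.≤-reflexive (ℕₚ.suc-pred p) , ℕₚ.≤-reflexive (ℕₚ.suc-pred p) , ℕₚ.≤-refl)) ,
      total
      where
      m₀ : ℕ
      m₀ = ℕ.pred (ℕ.pred n ℕ.* p)
      suc-m₀ : suc m₀ ≡ ℕ.pred n ℕ.* p
      -- Here n ≥ 2 enters: (n - 1) p is positive and has a true predecessor.
      suc-m₀ = ℕₚ.suc-pred (ℕ.pred n ℕ.* p) {{ℕₚ.m*n≢0 (ℕ.pred n) p {{ℕ.>-nonZero (ℕₚ.≤-pred (≡.subst (2 ≤_) (≡.sym (ℕₚ.suc-pred n)) 2≤n))}}}}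
      n-1 : ℕ.pred n ℕ.* p ℕ.+ p ≡ n ℕ.* p
      n-1 = ≡.trans (ℕₚ.+-comm _ p) (≡.cong (ℕ._* p) (ℕₚ.suc-pred n))
      total : suc (length (sequence m₀ (ℕ.pred p) (ℕ.pred p) 2)) ≡ p ℕ.* n ℕ.+ p
      total = ≡.trans (≡.cong suc lengths) (≡.trans (regroup m₀ (ℕ.pred p) (ℕ.pred p))
        (≡.trans (≡.cong₂ (λ a b → a ℕ.+ (b ℕ.+ b)) suc-m₀ (ℕₚ.suc-pred p))
          (≡.trans (≡.sym (ℕₚ.+-assoc _ p p)) (≡.cong (ℕ._+ p) (≡.trans n-1 (ℕₚ.*-comm n p))))))
        where
        regroup : ∀ a b c → suc (a ℕ.+ (b ℕ.+ (c ℕ.+ 2))) ≡ suc a ℕ.+ (suc b ℕ.+ suc c)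
        regroup = ℕ-solve-∀
        lengths : length (sequence m₀ (ℕ.pred p) (ℕ.pred p) 2) ≡ m₀ ℕ.+ (ℕ.pred p ℕ.+ (ℕ.pred p ℕ.+ 2))
        lengths = ≡.trans (Listₚ.length-++ (block m₀ 0F)) (≡.cong₂ ℕ._+_ (Listₚ.length-replicate m₀)
          (≡.trans (Listₚ.length-++ (block (ℕ.pred p) 1F)) (≡.cong₂ ℕ._+_ (Listₚ.length-replicate (ℕ.pred p))
            (≡.trans (Listₚ.length-++ (block (ℕ.pred p) 2F)) (≡.cong (ℕ._+ 2) (Listₚ.length-replicate (ℕ.pred p)))))))

-- The value of d(G), and the two parts of the theorem.

open Groups
open ParallelClassesOfLines
open OlsonTheorem
open DavenportConstants
open GroupAlgebras
open CoveringPlanes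
open GoodSequences
open import Data.Nat as ℕ using (ℕ; zero; suc; NonZero; _≤_; _<_; _*_; _+_; s≤s; z≤n)
open import Data.Nat.Divisibility using (_∣_; ∣-antisym; ∣-refl; m∣m*n; ∣⇒≤)
open import Data.Nat.DivMod using (_mod_)
open import Data.Nat.LCM using (lcm; lcm-least; n∣lcm[m,n])
open import Data.Nat.ListAction using (sum)
open import Data.Nat.ListAction.Properties using (sum-++)
open import Data.Nat.Primality using (Prime; prime⇒nonZero; prime⇒nonTrivial; ¬prime[1])
open import Data.Fin using (toℕ)
open import Data.List using (List; []; _∷_; _++_; length; map; replicate)
open import Data.List.Relation.Binary.Sublist.Propositional using (_⊆_; []; _∷_; _∷ʳ_)
open import Relation.Binary.PropositionalEquality

module StandardSequence (m₁ m₂ : ℕ) .{{_ : NonZero m₁}} .{{_ : NonZero m₂}} (1<m₁ : 1 < m₁) (1<m₂ : 1 < m₂) where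
  open Grp m₁ m₂
  open GroupLemmas m₁ m₂

  e₁ e₂ : G
  e₁ = 1 mod m₁ , 0 mod m₂
  e₂ = 0 mod m₁ , 1 mod m₂

  standard : List G
  standard = replicate (ℕ.pred m₁) e₁ ++ replicate (ℕ.pred m₂) e₂

  length-standard : length standard ≡ ℕ.pred m₁ + ℕ.pred m₂
  length-standard = trans (Listₚ.length-++ (replicate (ℕ.pred m₁) e₁)) (cong₂ _+_ (Listₚ.length-replicate (ℕ.pred m₁)) (Listₚ.length-replicate (ℕ.pred m₂)))

  sum-⊆ : ∀ (w : G → ℕ) {T S} → T ⊆ S → sum (map w T) ≤ sum (map w S)
  sum-⊆ w []          = z≤n
  sum-⊆ w (g ∷ʳ T⊆)   = ℕₚ.≤-trans (sum-⊆ w T⊆) (ℕₚ.m≤n+m _ (w g))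
  sum-⊆ w (refl ∷ T⊆) = ℕₚ.+-monoʳ-≤ _ (sum-⊆ w T⊆)

  sum-replicate : ∀ (w : G → ℕ) k g → sum (map w (replicate k g)) ≡ k * w g
  sum-replicate w zero    g = refl
  sum-replicate w (suc k) g = cong (w g +_) (sum-replicate w k g)

  sum-standard : ∀ (w : G → ℕ) → sum (map w standard) ≡ ℕ.pred m₁ * w e₁ + ℕ.pred m₂ * w e₂
  sum-standard w = trans (cong sum (Listₚ.map-++ w (replicate (ℕ.pred m₁) e₁) (replicate (ℕ.pred m₂) e₂)))
    (trans (sum-++ (map w (replicate (ℕ.pred m₁) e₁)) (map w (replicate (ℕ.pred m₂) e₂))) (cong₂ _+_ (sum-replicate w (ℕ.pred m₁) e₁) (sum-replicate w (ℕ.pred m₂) e₂)))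

  sum₁-standard : sum₁ standard ≡ ℕ.pred m₁
  sum₁-standard = trans (sum-standard (toℕ ∘ proj₁)) (trans (cong₂ (λ a b → ℕ.pred m₁ * a + ℕ.pred m₂ * b) (toℕ-mod-small m₁ 1<m₁) (toℕ-0mod m₁))
    (trans (cong₂ _+_ (ℕₚ.*-identityʳ (ℕ.pred m₁)) (ℕₚ.*-zeroʳ (ℕ.pred m₂))) (ℕₚ.+-identityʳ _)))

  sum₂-standard : sum₂ standard ≡ ℕ.pred m₂
  sum₂-standard = trans (sum-standard (toℕ ∘ proj₂)) (trans (cong₂ (λ a b → ℕ.pred m₁ * a + ℕ.pred m₂ * b) (toℕ-0mod m₂) (toℕ-mod-small m₂ 1<m₂))
    (cong₂ _+_ (ℕₚ.*-zeroʳ (ℕ.pred m₁)) (ℕₚ.*-identityʳ (ℕ.pred m₂))))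

  length≤sums : ∀ T → All (λ g → 1 ≤ toℕ (proj₁ g) + toℕ (proj₂ g)) T → length T ≤ sum₁ T + sum₂ T
  length≤sums []            []       = z≤n
  length≤sums ((i , j) ∷ T) (1≤ ∷ T≥1) = ℕₚ.≤-trans (ℕₚ.+-mono-≤ 1≤ (length≤sums T T≥1))
    (ℕₚ.≤-reflexive (interchange (toℕ i) (toℕ j) (sum₁ T) (sum₂ T)))
    where open import Algebra.Properties.CommutativeSemigroup ℕₚ.+-commutativeSemigroup using (interchange)

  standard-nonzero : All (λ g → 1 ≤ toℕ (proj₁ g) + toℕ (proj₂ g)) standard
  standard-nonzero = Allₚ.++⁺
    (Allₚ.replicate⁺ (ℕ.pred m₁) (ℕₚ.≤-trans (ℕₚ.≤-reflexive (sym (toℕ-mod-small m₁ 1<m₁))) (ℕₚ.m≤m+n _ _)))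
    (Allₚ.replicate⁺ (ℕ.pred m₂) (ℕₚ.≤-trans (ℕₚ.≤-reflexive (sym (toℕ-mod-small m₂ 1<m₂))) (ℕₚ.m≤n+m _ _)))

  -- The coordinate sums of a subsequence stay below m₁ and m₂, so divisibility makes both zero; as
  -- every element adds at least 1 to one of them, the subsequence is empty.
  standard-zeroSumFree : ZeroSumFree standard
  standard-zeroSumFree T T⊆ T≢[] σT≡0 = empty T T≢[] (subst₂ (λ a b → length T ≤ a + b)
      (vanish m₁ (proj₁ (σ≡0⇒∣ T σT≡0)) (subst (sum₁ T ≤_) sum₁-standard (sum-⊆ (toℕ ∘ proj₁) T⊆)))
      (vanish m₂ (proj₂ (σ≡0⇒∣ T σT≡0)) (subst (sum₂ T ≤_) sum₂-standard (sum-⊆ (toℕ ∘ proj₂) T⊆)))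
      (length≤sums T (⊆ₚ.All-resp-⊆ T⊆ standard-nonzero)))
    where
    vanish : ∀ m .{{_ : NonZero m}} {a} → m ∣ a → a ≤ ℕ.pred m → a ≡ 0
    vanish m {zero}  m∣a a≤ = refl
    vanish m {suc a} m∣a a≤ = contradiction (ℕₚ.≤-trans (s≤s a≤) (ℕₚ.≤-reflexive (ℕₚ.suc-pred m))) (ℕₚ.≤⇒≯ (∣⇒≤ m∣a))
    empty : ∀ T → T ≢ [] → ¬ (length T ≤ 0)
    empty []      T≢[] _  = T≢[] refl
    empty (_ ∷ _) T≢[] ()

module SmallDavenport (p n : ℕ) (pp : Prime p) .{{_ : NonZero p}} .{{_ : NonZero n}} .{{_ : NonZero (p * n)}} where
  open Grp p (p * n)
  open GroupLemmas p (p * n)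

  1<p : 1 < p
  1<p = ℕ.nonTrivial⇒n>1 p {{prime⇒nonTrivial pp}}

  lower-bound : ∀ {l} → IsSmallDavenport l → p * n + p ≤ suc (suc l)
  lower-bound {l} (_ , maximal) = begin
    p * n + p                                  ≡⟨ cong₂ _+_ (ℕₚ.suc-pred (p * n)) (ℕₚ.suc-pred p) ⟨
    suc (ℕ.pred (p * n)) + suc (ℕ.pred p)      ≡⟨ ℕₚ.+-comm (suc (ℕ.pred (p * n))) (suc (ℕ.pred p)) ⟩
    suc (ℕ.pred p) + suc (ℕ.pred (p * n))      ≡⟨ ℕₚ.+-suc (suc (ℕ.pred p)) (ℕ.pred (p * n)) ⟩
    suc (suc (ℕ.pred p + ℕ.pred (p * n)))      ≡⟨ cong (suc ∘ suc) length-standard ⟨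
    suc (suc (length standard))                ≤⟨ s≤s (s≤s (maximal standard standard-zeroSumFree)) ⟩
    suc (suc l)                                ∎
    where
    open ℕₚ.≤-Reasoning
    open StandardSequence p (p * n) 1<p (ℕₚ.<-≤-trans 1<p (ℕₚ.m≤m*n p n))

  upper-bound : ∀ {l} → IsSmallDavenport l → suc l < p * n + p
  upper-bound {l} ((S , free , |S|≡l) , _) = ℕₚ.≰⇒> λ large →
    let T , T⊆ , T≢[] , p∣ , pn∣ = ShortZeroSums.zero-sum-pn p pp (toℕ ∘ proj₁) (toℕ ∘ proj₂) n S (subst (λ k → p * n + p ≤ suc k) (sym |S|≡l) large)
    in free T T⊆ T≢[] (∣⇒σ≡0 T p∣ pn∣)

-- The splitting field condition is stated with lcm(p, pn), the exponent of the group.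
lcm[p,pn] : ∀ p n → lcm p (p * n) ≡ p * n
lcm[p,pn] p n = ∣-antisym (lcm-least {p} (m∣m*n n) ∣-refl) (n∣lcm[m,n] p (p * n))

module _ {c ℓ : Level} (p n : ℕ) (pp : Prime p) .{{p≢0 : NonZero p}} .{{n≢0 : NonZero n}} .{{N≢0 : NonZero (p * n)}}
         (K : CommutativeRing c ℓ) (K-field : IsField K) (roots : HasExactlyRootsOfUnity K (p * n)) where
  open Grp p (p * n)
  open Grp.GroupAlgebra p (p * n) K
  open SmallDavenport p n pp

  -- A longest zero-sum free sequence is itself good. By the lower bound for d(G), a good sequence
  -- longer than it would have at least pn + p - 1 elements, enough to cover all planes.
  part-one : p ≡ 2 ⊎ p ≡ 3 → Lines.ParallelClasses p → ∀ l → IsSmallDavenport l → Is-dGR l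
  part-one small classes l davenport@((S , free , |S|≡l) , _) =
    (S , Characters.zeroSumFree⇒good K K-field p (p * n) free , |S|≡l) , λ S′ good → ℕₚ.≮⇒≥ λ l<|S′| →
      Covering.long⇒¬good K K-field p n pp roots small classes S′ (ℕₚ.≤-trans (lower-bound davenport) (s≤s l<|S′|)) good

  -- The good sequence has length pn + p - 1, which exceeds Olson's upper bound pn + p - 2 for d(G).
  part-two : 5 ≤ p → 2 ≤ n → ∀ l → IsSmallDavenport l → l <dGR
  part-two 5≤p 2≤n l davenport =
    let S , good , |S| = Counterexample.good-sequence K K-field p n pp roots 5≤p 2≤n
    in S , good , ℕₚ.≤-pred (subst (suc l <_) (sym |S|) (upper-bound davenport))

parallelClasses : ∀ p .{{_ : NonZero p}} → Prime p → p ≤ 3 → (p ≡ 2 ⊎ p ≡ 3) × Lines.ParallelClasses p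
parallelClasses 1 pp p≤3 = contradiction pp ¬prime[1]
parallelClasses 2 pp p≤3 = inj₁ refl , parallelClasses₂
parallelClasses 3 pp p≤3 = inj₂ refl , parallelClasses₃
parallelClasses (suc (suc (suc (suc _)))) pp (s≤s (s≤s (s≤s ())))

theorem1p1 : ∀ {c ℓ : Level} (p n : ℕ) (pp : Prime p) .{{_ : NonZero n}}
    (K : CommutativeRing c ℓ) → IsField K → HasExactlyRootsOfUnity K (lcm p (p * n)) →
    (p ≤ 3 → ∀ (l : ℕ) → Cp⊕Cpn.IsSmallDavenport p n pp l → Cp⊕Cpn.Is-dGR p n pp K l)
    × (5 ≤ p → 2 ≤ n → ∀ (l : ℕ) → Cp⊕Cpn.IsSmallDavenport p n pp l → Cp⊕Cpn.LessThan-dGR p n pp K l)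
theorem1p1 p n pp K K-field roots =
  (λ p≤3 → let small , classes = parallelClasses p pp p≤3 in part-one p n pp K K-field roots′ small classes) ,
  part-two p n pp K K-field roots′
  where
  instance
    p≢0 : NonZero p
    p≢0 = prime⇒nonZero pp
    N≢0 : NonZero (p * n)
    N≢0 = ℕₚ.m*n≢0 p n
  roots′ : HasExactlyRootsOfUnity K (p * n)
  roots′ = subst (HasExactlyRootsOfUnity K) (lcm[p,pn] p n) roots
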